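{- Let $p,r\ge 2$ be integers and $i$ an integer with $i\ge p-1$ and $i\ge 1$. There is a constant $C_{p,r,i}$ depending only on $p,r,i$ such that every flag $(d-1)$-dimensional simplicial complex $\Gamma$ with $n$ vertices and $\mathrm{gr}_{p-1}(\Gamma)>2p+2r-4$ satisfies $$f_{i-1}(\Gamma)\le C_{p,r,i}\, d^{\,i-a_{p,r,i}}\,n^{\,a_{p,r,i}}.$$
   Context: A simplicial complex $\Gamma$ on a finite vertex set $V=V(\Gamma)$ is a family of subsets of $V$ (faces) closed under taking subsets; its dimension is $\max\{|F|:F\in\Gamma\}-1$; $f_j(\Gamma)$ is the number of faces with $j+1$ elements. $\Gamma$ is flag if every vertex set all of whose 2-element subsets are faces is itself a face. For $W\subseteq V$, $\Gamma[W]=\{F\in\Gamma:F\subseteq W\}$; for a face $F$ (possibly empty), $\mathrm{lk}_\Gamma(F)=\{G\setminus F: F\subseteq G\in\Gamma\}$. Fix a field $\mathbf{k}$; $\tilde H_j(\cdot;\mathbf{k})$ is reduced simplicial homology. The $(p-1)$-girth is $\mathrm{gr}_{p-1}(\Gamma)=\min\{|W|: W\subseteq V(\Gamma),\ \tilde H_{p-1}(\mathrm{lk}_\Gamma(F)[W];\mathbf{k})\neq 0 \text{ for some face } F\in\Gamma \text{ (including } F=\emptyset)\}$, or $\infty$ if none exists. The exponents are defined recursively: $a_{2,r,i}=1+1/r+\cdots+1/r^{i-1}$ for $i\ge1$; for $p\ge 3$, $a_{p,r,p-1}=p-1$ and $a_{p,r,i}=\tfrac12 a_{p-1,r,i-1}+\tfrac12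 a_{p,r,i-1}+1$ for $i\ge p$. -}

module Defs where

open import Algebra.Apartness.Bundles using (HeytingField; HeytingCommutativeRing)
open import Algebra.Bundles using (CommutativeRing; Semiring)
import Algebra.Definitions.RawMonoid as RawMonoid
import Algebra.Definitions.RawSemiring as RawSemiring
open import Data.Bool using (true; false; T; if_then_else_)
open import Data.Fin using (Fin)
import Data.Fin.Properties as Fin
open import Data.Fin.Subset
  using (Subset; inside; outside; _∈_; _∉_; _⊆_; _∩_; _∪_; _─_; ⁅_⁆; ∣_∣)
open import Data.Fin.Subset.Properties
  using (_∈?_; _⊆?_; anySubset?; ⊆-antisym; ⊆-trans; x∈p∪q⁺; x∈p∪q⁻; q⊆p∪q; p─q⊆p; x∈p∧x∉q⇒x∈p─q)
import Data.Integer as ℤ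
open import Data.Integer.Tactic.RingSolver using (solve-∀)
open import Data.List using (List; []; _∷_; _++_; map; filter; length)
open import Data.List.Extrema.Nat using (max)
import Data.Nat as ℕ
open import Data.Nat using (ℕ; zero; suc; _*_; _∸_; _≤_; _<_; _^_; NonZero; _≡ᵇ_)
import Data.Nat.Properties as ℕ
open import Data.Nat.Induction using (<-wellFounded)
open import Data.Product using (∃; ∃-syntax; _×_; _,_)
import Data.Rational as ℚ
import Data.Rational.Properties as ℚ
import Data.Rational.Unnormalised as ℚᵘ
import Data.Rational.Unnormalised.Properties as ℚᵘ
open import Data.Rational using (ℚ; 0ℚ; 1ℚ; ½; ↥_; ↧ₙ_)
open import Data.Sum using (inj₁; inj₂; [_,_]′)
import Data.Vec as Vec
open import Function using (_∘_; case_of_)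
open import Induction.WellFounded using (Acc; acc)
open import Level using (0ℓ; _⊔_)
open import Relation.Binary.PropositionalEquality using (_≡_; refl; sym; cong; subst; module ≡-Reasoning)
open import Relation.Nullary using (¬_; does; yes; no; contradiction; _×-dec_)
open import Relation.Nullary.Construct.Add.Supremum using (_⁺; [_]; ⊤⁺)
open import Relation.Unary using (Pred; Decidable)
import Data.Vec.Properties as VecP
import Data.Bool.Properties as Bool

private
  variable
    n : ℕ

-- A simplicial complex on the vertex set Fin n.  Faces are decidable, as
-- they must be for the face numbers to be defined.
record Complex (n : ℕ) : Set₁ where
  field
    Face        : Pred (Subset n) 0ℓ
    face?       : Decidable Face
    down-closed : ∀ {F G} → F ⊆ G → Face G → Face F

open Complex public

subsets : ∀ n → List (Subset n)
subsets zero    = Vec.[] ∷ []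
subsets (suc n) = map (outside Vec.∷_) (subsets n) ++ map (inside Vec.∷_) (subsets n)

faces : Complex n → List (Subset n)
faces Γ = filter (face? Γ) (subsets _)

dim : Complex n → ℤ.ℤ
dim Γ = ℤ.+ max 0 (map ∣_∣ (faces Γ)) ℤ.- ℤ.1ℤ

f : Complex n → ℕ → ℕ
f Γ j = length (filter (λ F → ∣ F ∣ ℕ.≟ suc j) (faces Γ))

-- In particular ∅ and all singletons are faces of a flag complex, having no
-- 2-element subsets; so a flag complex on Fin n has exactly n vertices.
Flag : Complex n → Set
Flag Γ = ∀ W → (∀ E → ∣ E ∣ ≡ 2 → E ⊆ W → Face Γ E) → Face Γ W

_⟦_⟧ : Complex n → Subset n → Complex n
Γ ⟦ W ⟧ = record
  { Face        = λ F → Face Γ F × F ⊆ W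
  ; face?       = λ F → face? Γ F ×-dec F ⊆? W
  ; down-closed = λ F⊆G (G∈Γ , G⊆W) → down-closed Γ F⊆G G∈Γ , ⊆-trans F⊆G G⊆W
  }

private
  ─⇒∉ : ∀ {n} (p q : Subset n) {x} → x ∈ p ─ q → x ∉ q
  ─⇒∉ (_ Vec.∷ p)      (outside Vec.∷ q) (Vec.there x∈) (Vec.there x∈q) = ─⇒∉ p q x∈ x∈q
  ─⇒∉ (_ Vec.∷ p)      (inside Vec.∷ q)  (Vec.there x∈) (Vec.there x∈q) = ─⇒∉ p q x∈ x∈q

  ∪─-cancel : (H F : Subset n) → (∀ {x} → x ∈ H → x ∉ F) → H ≡ (H ∪ F) ─ F
  ∪─-cancel H F disj = ⊆-antisym
    (λ x∈H → x∈p∧x∉q⇒x∈p─q (x∈p∪q⁺ (inj₁ x∈H)) (disj x∈H))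
    (λ x∈ → case x∈p∪q⁻ H F (p─q⊆p (H ∪ F) F x∈) of λ where
      (inj₁ x∈H) → x∈H
      (inj₂ x∈F) → contradiction x∈F (─⇒∉ (H ∪ F) F x∈))

lk : Complex n → Subset n → Complex n
lk Γ F = record
  { Face        = λ H → ∃[ G ] F ⊆ G × Face Γ G × H ≡ G ─ F
  ; face?       = λ H → anySubset? λ G → F ⊆? G ×-dec face? Γ G ×-dec VecP.≡-dec Bool._≟_ H (G ─ F)
  ; down-closed = λ H⊆H′ (G , F⊆G , G∈Γ , H′≡) → down H⊆H′ G F⊆G G∈Γ H′≡
  }
  where
  down : ∀ {H H′} → H ⊆ H′ → ∀ G → F ⊆ G → Face Γ G → H′ ≡ G ─ F →
         ∃[ G′ ] F ⊆ G′ × Face Γ G′ × H ≡ G′ ─ F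
  down {H} H⊆G─F G F⊆G G∈Γ refl =
    H ∪ F , q⊆p∪q H F ,
    down-closed Γ ([ p─q⊆p G F ∘ H⊆G─F , F⊆G ]′ ∘ x∈p∪q⁻ H F) G∈Γ ,
    ∪─-cancel H F (─⇒∉ G F ∘ H⊆G─F)

module Homology {c ℓ₁ ℓ₂} (k : HeytingField c ℓ₁ ℓ₂) where

  open HeytingField k using (Carrier; _≈_; 0#; 1#; -_; heytingCommutativeRing)
    renaming (_*_ to _*ᵏ_)
  open CommutativeRing (HeytingCommutativeRing.commutativeRing heytingCommutativeRing)
    using (semiring)
  open Semiring semiring using (+-rawMonoid; rawSemiring)
  open RawMonoid +-rawMonoid using (sum)
  open RawSemiring rawSemiring using () renaming (_^_ to _^ᵏ_)

  -- The formal sum Σ c(F)·F.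
  Coeffs : ℕ → Set c
  Coeffs n = Subset n → Carrier

  -- The space of j-chains: only faces with j+1 elements occur.
  IsChain : Complex n → ℕ → Coeffs n → Set ℓ₁
  IsChain Δ j c = ∀ F → ¬ (Face Δ F × ∣ F ∣ ≡ suc j) → c F ≈ 0#

  below : Fin n → Subset n
  below v = Vec.tabulate λ u → does (u Fin.<? v)

  -- ∂F = Σ_{v∈F} (-1)^{#{u∈F : u<v}} (F∖v), read off coefficientwise: the
  -- faces F with F∖v = G, v∈F, are the G∪{v} with v∉G.  As G may be empty,
  -- this includes the augmentation C₀ → C₋₁ = k of reduced homology.
  ∂ : Coeffs n → Coeffs n
  ∂ c G = sum λ v →
    if does (v ∈? G) then 0# else (- 1#) ^ᵏ ∣ G ∩ below v ∣ *ᵏ c (G ∪ ⁅ v ⁆)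

  IsCycle : Complex n → ℕ → Coeffs n → Set ℓ₁
  IsCycle Δ j z = IsChain Δ j z × (∀ G → ∂ z G ≈ 0#)

  IsBoundary : Complex n → ℕ → Coeffs n → Set (c ⊔ ℓ₁)
  IsBoundary Δ j z = ∃[ b ] IsChain Δ (suc j) b × (∀ G → ∂ b G ≈ z G)

  -- The quotient H̃ⱼ(Δ;k) of cycles by boundaries is nonzero.
  H̃≢0 : Complex n → ℕ → Set (c ⊔ ℓ₁)
  H̃≢0 Δ j = ∃[ z ] IsCycle Δ j z × ¬ IsBoundary Δ j z

-- Minimum of a set of natural numbers, with min ∅ = ∞.
IsMin : ∀ {a} → Pred ℕ a → ℕ ⁺ → Set a
IsMin S [ m ] = S m × (∀ s → S s → m ≤ s)
IsMin S ⊤⁺    = ∀ s → ¬ S s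

module _ {c ℓ₁ ℓ₂} (k : HeytingField c ℓ₁ ℓ₂) where

  open Homology k

  -- IsGirth k Γ q g  means  gr_q(Γ) = g  over the field k.  It is a relation
  -- because nonvanishing of homology is not decidable over a general k; by
  -- ¬¬-girth below this loses nothing for decidable conclusions.
  IsGirth : Complex n → ℕ → ℕ ⁺ → Set (c ⊔ ℓ₁)
  IsGirth Γ q = IsMin λ s →
    ∃[ W ] ∣ W ∣ ≡ s × ∃[ F ] Face Γ F × H̃≢0 (lk Γ F ⟦ W ⟧) q

¬¬-min : ∀ {a} (S : Pred ℕ a) → ¬ ¬ ∃ (IsMin S)
¬¬-min S ¬min = ¬min (⊤⁺ , λ s → go s (<-wellFounded s))
  where
  go : ∀ s → Acc _<_ s → ¬ S s
  go s (acc rs) s∈S = ¬min ([ s ] , s∈S , λ t t∈S →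
    case t ℕ.<? s of λ where
      (yes t<s) → contradiction t∈S (go t (rs t<s))
      (no  t≮s) → ℕ.≮⇒≥ t≮s)

¬¬-girth : ∀ {c ℓ₁ ℓ₂} (k : HeytingField c ℓ₁ ℓ₂) (Γ : Complex n) q → ¬ ¬ ∃ (IsGirth k Γ q)
¬¬-girth k Γ q = ¬¬-min _

fromℕ : ℕ → ℚ
fromℕ m = ℤ.+ m ℚ./ 1

geometric : (r : ℕ) .{{_ : NonZero r}} → ℕ → ℚ
geometric r zero    = 0ℚ
geometric r (suc j) = geometric r j ℚ.+ (ℤ.1ℤ ℚ./ (r ^ j)) {{ℕ.m^n≢0 r j}}

-- Meaningful for p ≥ 2 and i ≥ max(1, p-1) only; the recursion from such
-- arguments never leaves this range.
a : (p r : ℕ) .{{_ : NonZero r}} (i : ℕ) → ℚ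
a 0 r i = 0ℚ
a 1 r i = 0ℚ
a 2 r i = geometric r i
a (suc (suc (suc p))) r zero = 0ℚ
a (suc p₁@(suc (suc _))) r (suc i) =
  if suc i ≡ᵇ p₁
  then fromℕ p₁
  else ½ ℚ.* a p₁ r i ℚ.+ ½ ℚ.* a (suc p₁) r i ℚ.+ 1ℚ

private
  0≤/ : ∀ m d .{{_ : NonZero d}} → 0ℚ ℚ.≤ ℤ.+ m ℚ./ d
  0≤/ m d = ℚ.nonNegative⁻¹ _ {{ℚ.normalize-nonNeg m d}}

  1/≤1 : ∀ d .{{_ : NonZero d}} → ℤ.1ℤ ℚ./ d ℚ.≤ 1ℚ
  1/≤1 d@(suc d-1) = ℚ.toℚᵘ-cancel-≤
    (ℚᵘ.≤-respˡ-≃ (ℚᵘ.≃-sym (ℚ.toℚᵘ-fromℚᵘ (ℚᵘ.mkℚᵘ ℤ.1ℤ d-1)))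
      (ℚᵘ.*≤* (ℤ.+≤+ (ℕ.≤-trans (ℕ.≤-reflexive (ℕ.*-identityʳ 1)) (ℕ.≤-trans (ℕ.s≤s ℕ.z≤n) (ℕ.≤-reflexive (sym (ℕ.*-identityˡ d))))))))

  fromℕ-suc : ∀ m → fromℕ m ℚ.+ 1ℚ ≡ fromℕ (suc m)
  fromℕ-suc m = ℚ.toℚᵘ-injective (begin
    ℚ.toℚᵘ (fromℕ m ℚ.+ 1ℚ)              ≈⟨ ℚ.toℚᵘ-homo-+ (fromℕ m) 1ℚ ⟩
    ℚ.toℚᵘ (fromℕ m) ℚᵘ.+ ℚᵘ.1ℚᵘ         ≈⟨ ℚᵘ.+-congˡ ℚᵘ.1ℚᵘ (ℚ.toℚᵘ-fromℚᵘ (ℚᵘ.mkℚᵘ (ℤ.+ m) 0)) ⟩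
    ℚᵘ.mkℚᵘ (ℤ.+ m) 0 ℚᵘ.+ ℚᵘ.1ℚᵘ        ≈⟨ ℚᵘ.*≡* (lemma (ℤ.+ m)) ⟩
    ℚᵘ.mkℚᵘ (ℤ.+ suc m) 0                ≈⟨ ℚ.toℚᵘ-fromℚᵘ (ℚᵘ.mkℚᵘ (ℤ.+ suc m) 0) ⟨
    ℚ.toℚᵘ (fromℕ (suc m))               ∎)
    where
    open ℚᵘ.≃-Reasoning
    lemma : ∀ x → (x ℤ.* ℤ.1ℤ ℤ.+ ℤ.1ℤ) ℤ.* ℤ.1ℤ ≡ (ℤ.1ℤ ℤ.+ x) ℤ.* ℤ.1ℤ
    lemma = solve-∀

  ½x+½x : ∀ x → ½ ℚ.* x ℚ.+ ½ ℚ.* x ≡ x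
  ½x+½x x = begin
    ½ ℚ.* x ℚ.+ ½ ℚ.* x  ≡⟨ ℚ.*-distribʳ-+ x ½ ½ ⟨
    1ℚ ℚ.* x             ≡⟨ ℚ.*-identityˡ x ⟩
    x                    ∎
    where open ≡-Reasoning

  0≤geometric : ∀ r .{{_ : NonZero r}} i → 0ℚ ℚ.≤ geometric r i
  0≤geometric r zero    = ℚ.≤-refl
  0≤geometric r (suc i) =
    ℚ.+-mono-≤ (0≤geometric r i) (0≤/ 1 (r ^ i) {{ℕ.m^n≢0 r i}})

  geometric≤ : ∀ r .{{_ : NonZero r}} i → geometric r i ℚ.≤ fromℕ i
  geometric≤ r zero    = ℚ.≤-refl
  geometric≤ r (suc i) = ℚ.≤-trans
    (ℚ.+-mono-≤ (geometric≤ r i) (1/≤1 (r ^ i) {{ℕ.m^n≢0 r i}}))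
    (ℚ.≤-reflexive (fromℕ-suc i))

0≤a : ∀ p r .{{_ : NonZero r}} i → 0ℚ ℚ.≤ a p r i
0≤a 0 r i = ℚ.≤-refl
0≤a 1 r i = ℚ.≤-refl
0≤a 2 r i = 0≤geometric r i
0≤a (suc (suc (suc p))) r zero = ℚ.≤-refl
0≤a (suc p₁@(suc (suc _))) r (suc i) with suc i ≡ᵇ p₁
... | true  = 0≤/ p₁ 1
... | false = ℚ.+-mono-≤
  (ℚ.+-mono-≤ (ℚ.*-monoˡ-≤-nonNeg ½ (0≤a p₁ r i)) (ℚ.*-monoˡ-≤-nonNeg ½ (0≤a (suc p₁) r i)))
  (0≤/ 1 1)

a≤i : ∀ p r .{{_ : NonZero r}} i → a p r i ℚ.≤ fromℕ i
a≤i 0 r i = 0≤/ i 1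
a≤i 1 r i = 0≤/ i 1
a≤i 2 r i = geometric≤ r i
a≤i (suc (suc (suc p))) r zero = ℚ.≤-refl
a≤i (suc p₁@(suc (suc _))) r (suc i) with suc i ≡ᵇ p₁ in eq
... | true  = ℚ.≤-reflexive (cong fromℕ (sym (ℕ.≡ᵇ⇒≡ (suc i) p₁ (subst T (sym eq) _))))
... | false = begin
  ½ ℚ.* a p₁ r i ℚ.+ ½ ℚ.* a (suc p₁) r i ℚ.+ 1ℚ
    ≤⟨ ℚ.+-monoˡ-≤ 1ℚ (ℚ.+-mono-≤ (ℚ.*-monoˡ-≤-nonNeg ½ (a≤i p₁ r i))
                                   (ℚ.*-monoˡ-≤-nonNeg ½ (a≤i (suc p₁) r i))) ⟩
  ½ ℚ.* fromℕ i ℚ.+ ½ ℚ.* fromℕ i ℚ.+ 1ℚ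
    ≡⟨ cong (ℚ._+ 1ℚ) (½x+½x (fromℕ i)) ⟩
  fromℕ i ℚ.+ 1ℚ
    ≡⟨ fromℕ-suc i ⟩
  fromℕ (suc i) ∎
  where open ℚ.≤-Reasoning

-- x ≤ C·d^α·n^β for rational α, β ≥ 0 (real powers, 0^0 = 1), with both
-- sides raised to the power N, a common denominator of α and β.  Used only
-- for α = i-a and β = a, which are nonnegative by a≤i and 0≤a.
_≤_·_^[_]·_^[_] : (x C d : ℕ) (α : ℚ) (n : ℕ) (β : ℚ) → Set
x ≤ C · d ^[ α ]· n ^[ β ] =
  x ^ N ≤ C ^ N * d ^ (ℤ.∣ ↥ α ∣ * ↧ₙ β) * n ^ (ℤ.∣ ↥ β ∣ * ↧ₙ α)
  where N = ↧ₙ α * ↧ₙ β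

{-# OPTIONS --safe #-}
module Submission where

-- A cycle of length ℓ suspended p - 2 times is a flag (p-1)-sphere with
-- ℓ + 2(p-2) vertices, so the girth hypothesis excludes it as an induced
-- subcomplex for 4 ≤ ℓ ≤ 2r.  This condition on the graph of Γ passes to links,
-- and the common neighbourhood of two nonadjacent vertices satisfies it for p - 1.
-- For p ≥ 3, Cauchy–Schwarz over the (i-1)-element faces bounds f_{i-1}² by f_{i-2}
-- times the number of (i-1)-element faces in the common neighbourhoods of pairs of
-- vertices; nonadjacent pairs are a positive proportion of all pairs in a link with
-- many more than d vertices, whence the exponent ½ a_{p-1,r,i-1} + ½ a_{p,r,i-1} + 1.
-- For p = 2, between two vertices there are at most d^(r-1) locally induced walks of
-- length r, since the possible first steps form a clique.  As most walks of length r
-- in a graph of minimum degree Δ ≫ d are locally induced, Δ^r = O(d^(r-1) n).  So the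
-- graph is O(d^(1-1/r) n^(1/r))-degenerate, and a_{2,r,i} = 1 + a_{2,r,i-1} / r.

-- Walks are required to be only locally induced because this constrains just two consecutive edges:
-- it can be tested one step at a time by a union bound over pairs of equal or adjacent neighbours,
-- and short locally induced walks are induced anyway. The union bound needs few edges inside every
-- neighbourhood, which is once more the Cauchy-Schwarz estimate, now for 2-cliques. Degrees may
-- vary, so walks are weighted by inverse degrees.
--
-- The proportion of nonadjacent pairs comes from excluding cross-polytopes. Since r ≥ 2, the
-- excluded cycles include the 4-cycle, so after p - 1 nested passages to common neighbourhoods of
-- nonadjacent pairs only a clique is left, with at most d vertices; each passage costs a factor 16.
--
-- Real powers never occur. An estimate for ordered i-cliques compares M-th powers, with integer
-- exponents α on d and β on the number of vertices, where α + β = iM. Where an induction needs a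
-- uniform bound, the integer root of the right-hand side serves.

open import Defs
open import Algebra.Apartness.Bundles using (HeytingField; HeytingCommutativeRing)
open import Algebra.Bundles using (AbelianGroup; CommutativeRing; Semiring)
import Algebra.Definitions.RawSemiring as RawSemiring
import Algebra.Properties.CommutativeMonoid.Sum as CommutativeMonoidSum
import Algebra.Properties.Ring as RingProperties
import Algebra.Properties.Semiring.Sum as SemiringSum
open import Data.Bool using (Bool; true; false; T; not; _∧_; if_then_else_)
open import Data.Empty using (⊥-elim; ⊥)
open import Data.Fin using (Fin; zero; suc)
import Data.Fin as Fin
import Data.Fin.Properties as Fin
open import Data.Fin.Subset using (Subset; inside; outside; ∣_∣; _∪_; _∩_; _─_; _-_; ⁅_⁆)
  renaming (_∈_ to _∈ₛ_; _∉_ to _∉ₛ_; _⊆_ to _⊆ₛ_; ⊥ to ∅)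
open import Data.Fin.Subset.Properties
open import Data.List using (List; []; _∷_; _++_; _∷ʳ_; _ʳ++_; map; length; filterᵇ; allFin)
open import Data.List.Membership.Propositional using (_∈_; lose; find)
open import Data.List.Relation.Unary.Any as Any using (here; there)
open import Data.List.Relation.Unary.Linked as Linked using (Linked; []; [-]; _∷_)
open import Data.Nat using (ℕ; zero; suc; _≤_; _<_; z≤n; s≤s; s≤s⁻¹; _≡ᵇ_)
import Data.Nat.Properties as ℕ
open import Data.Product using (∃-syntax; _×_; _,_; proj₁; proj₂)
open import Data.Sum using (_⊎_; inj₁; inj₂; [_,_]′)
open import Data.Vec as Vec using ([]; _∷_; here; there)
import Data.Vec.Properties as VecP
open import Function using (_∘_; id)
open import Level using (_⊔_)
open import Relation.Binary.Definitions using (DecidableEquality; tri<; tri≈; tri>)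
import Relation.Binary.PropositionalEquality as ≡
open import Relation.Binary.PropositionalEquality
  using (_≡_; _≢_; refl; sym; trans; cong; cong₂; subst; subst₂; module ≡-Reasoning)
open import Relation.Nullary using (¬_; Dec; yes; no; does; contradiction)
open import Relation.Nullary.Decidable using (T?; dec-true; dec-false)

-- Finite sets of vertices

module _ where

  private variable
    n : ℕ
    p q : Subset n
    x y : Fin n

  ∈∪ˡ : x ∈ₛ p → x ∈ₛ p ∪ q
  ∈∪ˡ x∈ = x∈p∪q⁺ (inj₁ x∈)

  ∈∪ʳ : x ∈ₛ q → x ∈ₛ p ∪ q
  ∈∪ʳ x∈ = x∈p∪q⁺ (inj₂ x∈)

  ∈∪⁅⁆⁻ : ∀ (p : Subset n) y → x ∈ₛ p ∪ ⁅ y ⁆ → x ∈ₛ p ⊎ x ≡ y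
  ∈∪⁅⁆⁻ p y x∈ with x∈p∪q⁻ p ⁅ y ⁆ x∈
  ... | inj₁ x∈p = inj₁ x∈p
  ... | inj₂ x∈y = inj₂ (x∈⁅y⁆⇒x≡y y x∈y)

  x∉p-x : ∀ (p : Subset n) x → x ∉ₛ p - x
  x∉p-x (s ∷ p) zero    ()
  x∉p-x (s ∷ p) (suc x) (there x∈) = x∉p-x p x x∈

  ∈-⁻ : ∀ (p : Subset n) y → x ∈ₛ p - y → x ∈ₛ p × x ≢ y
  ∈-⁻ p y x∈ = p─q⊆p p ⁅ y ⁆ x∈ , λ { refl → x∉p-x p y x∈ }

  p-x∪x≡p : x ∈ₛ p → (p - x) ∪ ⁅ x ⁆ ≡ p
  p-x∪x≡p {x = x} {p = p} x∈p = ⊆-antisym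
    (λ y∈ → [ proj₁ ∘ ∈-⁻ p x , (λ { refl → x∈p }) ]′ (∈∪⁅⁆⁻ (p - x) x y∈))
    (λ {y} y∈p → back y y∈p)
    where
    back : ∀ y → y ∈ₛ p → y ∈ₛ (p - x) ∪ ⁅ x ⁆
    back y y∈p with y Fin.≟ x
    ... | yes refl = ∈∪ʳ (x∈⁅x⁆ x)
    ... | no  y≢x  = ∈∪ˡ (x∈p∧x≢y⇒x∈p-y y∈p y≢x)

  p∪x-x≡p : x ∉ₛ p → (p ∪ ⁅ x ⁆) - x ≡ p
  p∪x-x≡p {x = x} {p = p} x∉p = ⊆-antisym
    (λ y∈ → let y∈∪ , y≢x = ∈-⁻ (p ∪ ⁅ x ⁆) x y∈ in [ id , (λ y≡x → contradiction y≡x y≢x) ]′ (∈∪⁅⁆⁻ p x y∈∪))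
    (λ y∈p → x∈p∧x≢y⇒x∈p-y (∈∪ˡ y∈p) λ { refl → x∉p y∈p })

  p∪y-x≡p-x∪y : ∀ (p : Subset n) → x ≢ y → (p ∪ ⁅ y ⁆) - x ≡ (p - x) ∪ ⁅ y ⁆
  p∪y-x≡p-x∪y {x = x} {y = y} p x≢y = ⊆-antisym
    (λ z∈ → let z∈∪ , z≢x = ∈-⁻ (p ∪ ⁅ y ⁆) x z∈ in
      [ (λ z∈p → ∈∪ˡ (x∈p∧x≢y⇒x∈p-y z∈p z≢x)) , (λ { refl → ∈∪ʳ (x∈⁅x⁆ y) }) ]′ (∈∪⁅⁆⁻ p y z∈∪))
    (λ z∈ → [ (λ z∈p-x → let z∈p , z≢x = ∈-⁻ p x z∈p-x in x∈p∧x≢y⇒x∈p-y (∈∪ˡ z∈p) z≢x)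
            , (λ { refl → x∈p∧x≢y⇒x∈p-y (∈∪ʳ (x∈⁅x⁆ y)) (x≢y ∘ sym) }) ]′ (∈∪⁅⁆⁻ (p - x) y z∈))

  ∣p∪x∣≡1+∣p∣ : ∀ (p : Subset n) x → x ∉ₛ p → ∣ p ∪ ⁅ x ⁆ ∣ ≡ suc ∣ p ∣
  ∣p∪x∣≡1+∣p∣ (inside  ∷ p) zero    x∉ = contradiction here x∉
  ∣p∪x∣≡1+∣p∣ (outside ∷ p) zero    x∉ = cong (suc ∘ ∣_∣) (∪-identityʳ p)
  ∣p∪x∣≡1+∣p∣ (inside  ∷ p) (suc x) x∉ = cong suc (∣p∪x∣≡1+∣p∣ p x (x∉ ∘ there))
  ∣p∪x∣≡1+∣p∣ (outside ∷ p) (suc x) x∉ = ∣p∪x∣≡1+∣p∣ p x (x∉ ∘ there)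

  ∣p∣≡1+∣p-x∣ : x ∈ₛ p → ∣ p ∣ ≡ suc ∣ p - x ∣
  ∣p∣≡1+∣p-x∣ {x = x} {p = p} x∈p =
    trans (cong ∣_∣ (sym (p-x∪x≡p x∈p))) (∣p∪x∣≡1+∣p∣ (p - x) x (x∉p-x p x))

  ∣p∪x∣≤1+∣p∣ : ∀ (p : Subset n) x → ∣ p ∪ ⁅ x ⁆ ∣ ≤ suc ∣ p ∣
  ∣p∪x∣≤1+∣p∣ p x with x ∈? p
  ... | no  x∉p = ℕ.≤-reflexive (∣p∪x∣≡1+∣p∣ p x x∉p)
  ... | yes x∈p = ℕ.m≤n⇒m≤1+n (p⊆q⇒∣p∣≤∣q∣ {p = p ∪ ⁅ x ⁆} {q = p} λ y∈ → [ id , (λ { refl → x∈p }) ]′ (∈∪⁅⁆⁻ p x y∈))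

  ∈⇒∣∣≢0 : x ∈ₛ p → ∣ p ∣ ≢ 0
  ∈⇒∣∣≢0 x∈p eq with () ← trans (sym eq) (∣p∣≡1+∣p-x∣ x∈p)

  nonempty : ∀ (p : Subset n) → 1 ≤ ∣ p ∣ → ∃[ x ] x ∈ₛ p
  nonempty {n} p 1≤ with nonempty? p
  ... | yes ne = ne
  ... | no  ¬ne = contradiction (subst (1 ≤_) (trans (cong ∣_∣ (Empty-unique ¬ne)) (∣⊥∣≡0 n)) 1≤) λ ()

  ∣∣≡0⇒≡∅ : ∀ (p : Subset n) → ∣ p ∣ ≡ 0 → p ≡ ∅
  ∣∣≡0⇒≡∅ p eq = Empty-unique λ (_ , x∈) → ∈⇒∣∣≢0 x∈ eq

  remove-one : ∀ k (p : Subset n) → suc k ≤ ∣ p ∣ → ∃[ x ] (x ∈ₛ p × k ≤ ∣ p - x ∣)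
  remove-one k p le with x , x∈ ← nonempty p (ℕ.≤-trans (s≤s z≤n) le) =
    x , x∈ , s≤s⁻¹ (ℕ.≤-trans le (ℕ.≤-reflexive (∣p∣≡1+∣p-x∣ x∈)))

  three-elements : ∀ (p : Subset n) → 3 ≤ ∣ p ∣ →
                   ∃[ x ] ∃[ y ] ∃[ z ] (x ∈ₛ p × y ∈ₛ p × z ∈ₛ p × x ≢ y × x ≢ z × y ≢ z)
  three-elements p le
    with x , x∈ , le₁ ← remove-one 2 p le
    with y , y∈ , le₂ ← remove-one 1 (p - x) le₁
    with z , z∈ , _   ← remove-one 0 (p - x - y) le₂
    with y∈p , y≢x ← ∈-⁻ p x y∈
    with z∈p-x , z≢y ← ∈-⁻ (p - x) y z∈
    with z∈p , z≢x ← ∈-⁻ p x z∈p-x =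
    x , y , z , x∈ , y∈p , z∈p , y≢x ∘ sym , z≢x ∘ sym , z≢y ∘ sym

  two-elements : x ∈ₛ p → y ∈ₛ p - x → ∣ p - x - y ∣ ≡ 0 → p ≡ ⁅ y ⁆ ∪ ⁅ x ⁆
  two-elements {x = x} {p = p} {y = y} x∈ y∈ eq = begin
    p                                    ≡⟨ p-x∪x≡p x∈ ⟨
    (p - x) ∪ ⁅ x ⁆                      ≡⟨ cong (_∪ ⁅ x ⁆) (p-x∪x≡p y∈) ⟨
    ((p - x - y) ∪ ⁅ y ⁆) ∪ ⁅ x ⁆        ≡⟨ cong (λ s → (s ∪ ⁅ y ⁆) ∪ ⁅ x ⁆) (∣∣≡0⇒≡∅ (p - x - y) eq) ⟩
    (∅ ∪ ⁅ y ⁆) ∪ ⁅ x ⁆                  ≡⟨ cong (_∪ ⁅ x ⁆) (∪-identityˡ ⁅ y ⁆) ⟩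
    ⁅ y ⁆ ∪ ⁅ x ⁆                        ∎
    where open ≡-Reasoning

  pair : ∀ (p : Subset n) → ∣ p ∣ ≡ 2 → ∃[ x ] ∃[ y ] (x ∈ₛ p × y ∈ₛ p × y ≢ x × p ≡ ⁅ y ⁆ ∪ ⁅ x ⁆)
  pair p eq
    with x , x∈ , le ← remove-one 1 p (ℕ.≤-reflexive (sym eq))
    with y , y∈ , _  ← remove-one 0 (p - x) le
    with y∈p , y≢x ← ∈-⁻ p x y∈ =
    x , y , x∈ , y∈p , y≢x , two-elements x∈ y∈
      (ℕ.suc-injective (ℕ.suc-injective (trans (cong suc (sym (∣p∣≡1+∣p-x∣ y∈))) (trans (sym (∣p∣≡1+∣p-x∣ x∈)) eq))))

  ∣∪∩∣-∈ : ∀ (p q : Subset n) → x ∉ₛ p → x ∈ₛ q → ∣ (p ∪ ⁅ x ⁆) ∩ q ∣ ≡ suc ∣ p ∩ q ∣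
  ∣∪∩∣-∈ {x = x} p q x∉p x∈q = trans
    (cong ∣_∣ (⊆-antisym {i = (p ∪ ⁅ x ⁆) ∩ q} {j = (p ∩ q) ∪ ⁅ x ⁆}
      (λ y∈ → let y∈∪ , y∈q = x∈p∩q⁻ (p ∪ ⁅ x ⁆) q y∈ in
        [ (λ y∈p → ∈∪ˡ (x∈p∩q⁺ (y∈p , y∈q))) , (λ { refl → ∈∪ʳ (x∈⁅x⁆ x) }) ]′ (∈∪⁅⁆⁻ p x y∈∪))
      (λ y∈ → [ (λ y∈∩ → let y∈p , y∈q = x∈p∩q⁻ p q y∈∩ in x∈p∩q⁺ (∈∪ˡ y∈p , y∈q))
              , (λ { refl → x∈p∩q⁺ (∈∪ʳ (x∈⁅x⁆ x) , x∈q) }) ]′ (∈∪⁅⁆⁻ (p ∩ q) x y∈))))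
    (∣p∪x∣≡1+∣p∣ (p ∩ q) x (x∉p ∘ proj₁ ∘ x∈p∩q⁻ p q))

  ∪∩-∉ : ∀ (p q : Subset n) → x ∉ₛ q → (p ∪ ⁅ x ⁆) ∩ q ≡ p ∩ q
  ∪∩-∉ {x = x} p q x∉q = ⊆-antisym
    (λ y∈ → let y∈∪ , y∈q = x∈p∩q⁻ (p ∪ ⁅ x ⁆) q y∈ in
      [ (λ y∈p → x∈p∩q⁺ (y∈p , y∈q)) , (λ { refl → contradiction y∈q x∉q }) ]′ (∈∪⁅⁆⁻ p x y∈∪))
    (λ y∈ → let y∈p , y∈q = x∈p∩q⁻ p q y∈ in x∈p∩q⁺ (∈∪ˡ y∈p , y∈q))

  fromList : List (Fin n) → Subset n
  fromList []       = ∅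
  fromList (x ∷ xs) = fromList xs ∪ ⁅ x ⁆

  ∈-fromList⁺ : ∀ {xs} → x ∈ xs → x ∈ₛ fromList xs
  ∈-fromList⁺ (here refl) = ∈∪ʳ (x∈⁅x⁆ _)
  ∈-fromList⁺ (there x∈)  = ∈∪ˡ (∈-fromList⁺ x∈)

  ∈-fromList⁻ : ∀ xs → x ∈ₛ fromList xs → x ∈ xs
  ∈-fromList⁻ []       x∈ = contradiction x∈ ∉⊥
  ∈-fromList⁻ (y ∷ xs) x∈ = [ there ∘ ∈-fromList⁻ xs , here ]′ (∈∪⁅⁆⁻ (fromList xs) y x∈)

  ∣fromList∣≤ : ∀ (xs : List (Fin n)) → ∣ fromList xs ∣ ≤ length xs
  ∣fromList∣≤ {n} [] = ℕ.≤-reflexive (∣⊥∣≡0 n)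
  ∣fromList∣≤ (x ∷ xs) = ℕ.≤-trans (∣p∪x∣≤1+∣p∣ (fromList xs) x) (s≤s (∣fromList∣≤ xs))

-- Cycles of flag spheres

module Chains {c ℓ₁ ℓ₂} (k : HeytingField c ℓ₁ ℓ₂) where

  open Homology k public
  open HeytingField k using (invertible⇒#; #-irrefl; heytingCommutativeRing)
  open CommutativeRing (HeytingCommutativeRing.commutativeRing heytingCommutativeRing)
    hiding (zero; _-_) renaming (refl to ≈-refl; sym to ≈-sym; trans to ≈-trans)
  open RawSemiring (Semiring.rawSemiring semiring) using () renaming (_^_ to _^ᵏ_)
  open RingProperties ring using (-1*x≈-x; -‿distribˡ-*; -‿distribʳ-*; -‿involutive; -0#≈0#)
  open CommutativeMonoidSum +-commutativeMonoid using (sum; sum-cong-≋; sum-replicate-zero; ∑-distrib-+)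
  open SemiringSum semiring using (*-distribˡ-sum)
  open import Relation.Binary.Reasoning.Setoid setoid

  private variable
    n : ℕ
    F G : Subset n
    u v w x y z : Fin n

  -- If `1# ≈ 0#`, the difference of `1#` with itself is invertible with inverse `1#`, so `1#` is
  -- apart from itself.
  1≉0 : ¬ 1# ≈ 0#
  1≉0 1≈0 = #-irrefl ≈-refl (invertible⇒# {1#} {1#}
    (1# , ≈-trans (*-identityˡ _) (≈-trans (-‿inverseʳ 1#) (≈-sym 1≈0)) , ≈-trans (*-identityʳ _) (≈-trans (-‿inverseʳ 1#) (≈-sym 1≈0))))

  sum-zero : (t : Fin n → Carrier) → (∀ v → t v ≈ 0#) → sum t ≈ 0#
  sum-zero {n} t t≈0 = ≈-trans (sum-cong-≋ t≈0) (sum-replicate-zero n)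

  sum-single : (t : Fin n → Carrier) (u : Fin n) → (∀ v → v ≢ u → t v ≈ 0#) → sum t ≈ t u
  sum-single {suc n} t zero t≈0 = ≈-trans (+-congˡ (sum-zero (t ∘ suc) λ v → t≈0 (suc v) λ ())) (+-identityʳ _)
  sum-single {suc n} t (suc u) t≈0 = ≈-trans (+-cong (t≈0 zero λ ()) (sum-single (t ∘ suc) u λ v v≢u → t≈0 (suc v) (v≢u ∘ Fin.suc-injective)))
    (+-identityˡ _)

  sgn : Fin n → Subset n → Carrier
  sgn v G = (- 1#) ^ᵏ ∣ G ∩ below v ∣

  ∈-below⁺ : x Fin.< v → x ∈ₛ below v
  ∈-below⁺ {x = x} {v = v} x<v =
    VecP.lookup⇒[]= x (below v) (trans (VecP.lookup∘tabulate _ x) (dec-true (x Fin.<? v) x<v))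

  ∈-below⁻ : x ∈ₛ below v → x Fin.< v
  ∈-below⁻ {x = x} {v = v} x∈ = decide (x Fin.<? v) (trans (sym (VecP.lookup∘tabulate _ x)) (VecP.[]=⇒lookup x∈))
    where
    decide : (d : Dec (x Fin.< v)) → does d ≡ inside → x Fin.< v
    decide (yes x<v) _ = x<v

  sgn-∪-< : ∀ (G : Subset n) → x ∉ₛ G → x Fin.< v → sgn v (G ∪ ⁅ x ⁆) ≈ - sgn v G
  sgn-∪-< {x = x} {v = v} G x∉ x<v =
    ≈-trans (reflexive (cong ((- 1#) ^ᵏ_) (∣∪∩∣-∈ G (below v) x∉ (∈-below⁺ x<v)))) (-1*x≈-x (sgn v G))

  sgn-∪-≮ : ∀ (G : Subset n) → ¬ (x Fin.< v) → sgn v (G ∪ ⁅ x ⁆) ≈ sgn v G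
  sgn-∪-≮ {v = v} G x≮v = reflexive (cong (λ s → (- 1#) ^ᵏ ∣ s ∣) (∪∩-∉ G (below v) (x≮v ∘ ∈-below⁻)))

  sgn² : ∀ (u : Fin n) G → sgn u G * sgn u G ≈ 1#
  sgn² u G = go ∣ G ∩ below u ∣
    where
    go : ∀ m → (- 1#) ^ᵏ m * (- 1#) ^ᵏ m ≈ 1#
    go zero    = *-identityˡ 1#
    go (suc m) = begin
      (- 1# * s) * (- 1# * s)   ≈⟨ *-cong (-1*x≈-x s) (-1*x≈-x s) ⟩
      (- s) * (- s)             ≈⟨ -‿distribˡ-* s (- s) ⟨
      - (s * - s)               ≈⟨ -‿cong (-‿distribʳ-* s s) ⟨
      - - (s * s)               ≈⟨ -‿involutive (s * s) ⟩
      s * s                     ≈⟨ go m ⟩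
      1#                        ∎
      where s = (- 1#) ^ᵏ m

  sgn-cancel : ∀ (u : Fin n) G {a} → sgn u G * a ≈ 0# → a ≈ 0#
  sgn-cancel u G {a} sa≈0 = begin
    a                            ≈⟨ *-identityˡ a ⟨
    1# * a                       ≈⟨ *-congʳ (sgn² u G) ⟨
    sgn u G * sgn u G * a        ≈⟨ *-assoc _ _ _ ⟩
    sgn u G * (sgn u G * a)      ≈⟨ *-congˡ sa≈0 ⟩
    sgn u G * 0#                 ≈⟨ zeroʳ _ ⟩
    0#                           ∎

  -- Exactly one of u < v and v < u holds, so that exactly one of the two signs changes.
  sgn-anticommute : ∀ (H : Subset n) → u ≢ v → u ∉ₛ H → v ∉ₛ H →
    sgn v (H ∪ ⁅ u ⁆) * sgn u ((H ∪ ⁅ u ⁆) ∪ ⁅ v ⁆) ≈ - (sgn u (H ∪ ⁅ u ⁆) * sgn v H)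
  sgn-anticommute {u = u} {v = v} H u≢v u∉ v∉ with Fin.<-cmp u v
  ... | tri≈ _ u≡v _ = contradiction u≡v u≢v
  ... | tri< u<v _ v≮u = begin
    sgn v (H ∪ ⁅ u ⁆) * sgn u ((H ∪ ⁅ u ⁆) ∪ ⁅ v ⁆)   ≈⟨ *-cong (sgn-∪-< H u∉ u<v) (sgn-∪-≮ (H ∪ ⁅ u ⁆) v≮u) ⟩
    - sgn v H * sgn u (H ∪ ⁅ u ⁆)                     ≈⟨ -‿distribˡ-* _ _ ⟨
    - (sgn v H * sgn u (H ∪ ⁅ u ⁆))                   ≈⟨ -‿cong (*-comm _ _) ⟩
    - (sgn u (H ∪ ⁅ u ⁆) * sgn v H)                   ∎
  ... | tri> u≮v _ v<u = begin
    sgn v (H ∪ ⁅ u ⁆) * sgn u ((H ∪ ⁅ u ⁆) ∪ ⁅ v ⁆)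
      ≈⟨ *-cong (sgn-∪-≮ H u≮v) (sgn-∪-< (H ∪ ⁅ u ⁆) v∉′ v<u) ⟩
    sgn v H * - sgn u (H ∪ ⁅ u ⁆)                     ≈⟨ -‿distribʳ-* _ _ ⟨
    - (sgn v H * sgn u (H ∪ ⁅ u ⁆))                   ≈⟨ -‿cong (*-comm _ _) ⟩
    - (sgn u (H ∪ ⁅ u ⁆) * sgn v H)                   ∎
    where
    v∉′ : v ∉ₛ H ∪ ⁅ u ⁆
    v∉′ v∈ = [ v∉ , u≢v ∘ sym ]′ (∈∪⁅⁆⁻ H u v∈)

  ∂-term : Coeffs n → Subset n → Fin n → Carrier
  ∂-term c G v = if does (v ∈? G) then 0# else sgn v G * c (G ∪ ⁅ v ⁆)

  ∂-term-∈ : ∀ (c : Coeffs n) {G v} → v ∈ₛ G → ∂-term c G v ≈ 0#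
  ∂-term-∈ c {G} {v} v∈ with v ∈? G
  ... | yes _  = ≈-refl
  ... | no  v∉ = contradiction v∈ v∉

  ∂-term-∉ : ∀ (c : Coeffs n) {G v} → v ∉ₛ G → ∂-term c G v ≈ sgn v G * c (G ∪ ⁅ v ⁆)
  ∂-term-∉ c {G} {v} v∉ with v ∈? G
  ... | yes v∈ = contradiction v∈ v∉
  ... | no  _  = ≈-refl

  ∂-term-zero : ∀ (c : Coeffs n) {G v} → (v ∉ₛ G → c (G ∪ ⁅ v ⁆) ≈ 0#) → ∂-term c G v ≈ 0#
  ∂-term-zero c {G} {v} c≈0 with v ∈? G
  ... | yes _  = ≈-refl
  ... | no  v∉ = ≈-trans (*-congˡ (c≈0 v∉)) (zeroʳ _)

  ∂-zero : ∀ (c : Coeffs n) → (∀ F → c F ≈ 0#) → ∀ G → ∂ c G ≈ 0#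
  ∂-zero c c≈0 G = sum-zero (∂-term c G) λ v → ∂-term-zero c λ _ → c≈0 _

  infixl 6 _⊞_
  _⊞_ : Coeffs n → Coeffs n → Coeffs n
  (c ⊞ e) F = c F + e F

  ⊟_ : Coeffs n → Coeffs n
  (⊟ c) F = - c F

  ∂-⊞ : ∀ (c e : Coeffs n) G → ∂ (c ⊞ e) G ≈ ∂ c G + ∂ e G
  ∂-⊞ c e G = ≈-trans (sum-cong-≋ term) (∑-distrib-+ (∂-term c G) (∂-term e G))
    where
    term : ∀ v → ∂-term (c ⊞ e) G v ≈ ∂-term c G v + ∂-term e G v
    term v with does (v ∈? G)
    ... | true  = ≈-sym (+-identityˡ 0#)
    ... | false = distribˡ _ _ _

  sum-*ˡ : ∀ a (t t′ : Fin n → Carrier) → (∀ v → t v ≈ a * t′ v) → sum t ≈ a * sum t′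
  sum-*ˡ a t t′ eq = ≈-trans (sum-cong-≋ eq) (≈-sym (*-distribˡ-sum a t′))

  ∂-⊟ : ∀ (c : Coeffs n) G → ∂ (⊟ c) G ≈ - ∂ c G
  ∂-⊟ c G = ≈-trans (sum-*ˡ (- 1#) (∂-term (⊟ c) G) (∂-term c G) term) (-1*x≈-x _)
    where
    term : ∀ v → ∂-term (⊟ c) G v ≈ - 1# * ∂-term c G v
    term v with does (v ∈? G)
    ... | true  = ≈-sym (zeroʳ _)
    ... | false = ≈-trans (≈-sym (-‿distribʳ-* _ _)) (≈-sym (-1*x≈-x _))

  -- `sgn u F` equals the sign that `∂` attaches to the passage from `F` to `F - u`. The two cancel,
  -- so away from `u` the boundary of the cone is `c` itself.
  cone : Fin n → Coeffs n → Coeffs n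
  cone u c F = if does (u ∈? F) then sgn u F * c (F - u) else 0#

  cone-∉ : ∀ (c : Coeffs n) → u ∉ₛ F → cone u c F ≈ 0#
  cone-∉ {u = u} {F = F} c u∉ with u ∈? F
  ... | yes u∈ = contradiction u∈ u∉
  ... | no  _  = ≈-refl

  cone-∈ : ∀ (c : Coeffs n) → u ∈ₛ F → cone u c F ≈ sgn u F * c (F - u)
  cone-∈ {u = u} {F = F} c u∈ with u ∈? F
  ... | yes _  = ≈-refl
  ... | no  u∉ = contradiction u∈ u∉

  cone-zero : ∀ (c : Coeffs n) → (u ∈ₛ F → c (F - u) ≈ 0#) → cone u c F ≈ 0#
  cone-zero {u = u} {F = F} c c≈0 with u ∈? F
  ... | yes u∈ = ≈-trans (*-congˡ (c≈0 u∈)) (zeroʳ _)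
  ... | no  _  = ≈-refl

  OffStar : Fin n → Coeffs n → Set ℓ₁
  OffStar u c = ∀ F → u ∈ₛ F → c F ≈ 0#

  -- Only the deletion of `u` leads from the cone to a set without `u`. Together with `∂-cone-∈`
  -- this is the identity ∂(u * c) = c - u * ∂c for the join with `u`.
  ∂-cone-∉ : ∀ (c : Coeffs n) → u ∉ₛ G → ∂ (cone u c) G ≈ c G
  ∂-cone-∉ {u = u} {G = G} c u∉ = begin
    ∂ (cone u c) G                                            ≈⟨ sum-single (∂-term (cone u c) G) u others ⟩
    ∂-term (cone u c) G u                                     ≈⟨ ∂-term-∉ (cone u c) u∉ ⟩
    sgn u G * cone u c (G ∪ ⁅ u ⁆)                            ≈⟨ *-congˡ (cone-∈ c (∈∪ʳ (x∈⁅x⁆ u))) ⟩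
    sgn u G * (sgn u (G ∪ ⁅ u ⁆) * c ((G ∪ ⁅ u ⁆) - u))
      ≈⟨ *-congˡ (*-cong (sgn-∪-≮ G (Fin.<-irrefl refl)) (reflexive (cong c (p∪x-x≡p u∉)))) ⟩
    sgn u G * (sgn u G * c G)                                 ≈⟨ *-assoc _ _ _ ⟨
    sgn u G * sgn u G * c G                                   ≈⟨ *-congʳ (sgn² u G) ⟩
    1# * c G                                                  ≈⟨ *-identityˡ _ ⟩
    c G                                                       ∎
    where
    others : ∀ v → v ≢ u → ∂-term (cone u c) G v ≈ 0#
    others v v≢u = ∂-term-zero (cone u c) λ _ → cone-∉ c λ u∈ → [ u∉ , v≢u ∘ sym ]′ (∈∪⁅⁆⁻ G v u∈)

  ∂-cone-∈ : ∀ (c : Coeffs n) → OffStar u c → u ∈ₛ G → ∂ (cone u c) G ≈ - sgn u G * ∂ c (G - u)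
  ∂-cone-∈ {u = u} {G = G} c off u∈ = sum-*ˡ (- sgn u G) (∂-term (cone u c) G) (∂-term c H) term
    where
    H = G - u
    u∉H = x∉p-x G u
    G≡ : H ∪ ⁅ u ⁆ ≡ G
    G≡ = p-x∪x≡p u∈
    term : ∀ v → ∂-term (cone u c) G v ≈ - sgn u G * ∂-term c H v
    term v with v Fin.≟ u
    ... | yes refl = ≈-trans (∂-term-∈ (cone u c) u∈)
      (≈-sym (≈-trans (*-congˡ (∂-term-zero c λ _ → off _ (∈∪ʳ (x∈⁅x⁆ u)))) (zeroʳ _)))
    ... | no v≢u = by-membership (v ∈? G)
      where
      by-membership : _ → ∂-term (cone u c) G v ≈ - sgn u G * ∂-term c H v
      by-membership (yes v∈) = ≈-trans (∂-term-∈ (cone u c) v∈)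
        (≈-sym (≈-trans (*-congˡ (∂-term-∈ c (x∈p∧x≢y⇒x∈p-y v∈ v≢u))) (zeroʳ _)))
      by-membership (no v∉) = begin
        ∂-term (cone u c) G v                                       ≈⟨ ∂-term-∉ (cone u c) v∉ ⟩
        sgn v G * cone u c (G ∪ ⁅ v ⁆)                              ≈⟨ *-congˡ (cone-∈ c (∈∪ˡ u∈)) ⟩
        sgn v G * (sgn u (G ∪ ⁅ v ⁆) * c ((G ∪ ⁅ v ⁆) - u))         ≈⟨ *-assoc _ _ _ ⟨
        sgn v G * sgn u (G ∪ ⁅ v ⁆) * c ((G ∪ ⁅ v ⁆) - u)
          ≈⟨ *-cong signs (reflexive (cong c (p∪y-x≡p-x∪y G (v≢u ∘ sym)))) ⟩
        - (sgn u G * sgn v H) * c (H ∪ ⁅ v ⁆)                       ≈⟨ *-congʳ (-‿distribˡ-* _ _) ⟩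
        - sgn u G * sgn v H * c (H ∪ ⁅ v ⁆)                         ≈⟨ *-assoc _ _ _ ⟩
        - sgn u G * (sgn v H * c (H ∪ ⁅ v ⁆))                       ≈⟨ *-congˡ (∂-term-∉ c v∉H) ⟨
        - sgn u G * ∂-term c H v                                    ∎
        where
        v∉H : v ∉ₛ H
        v∉H v∈ = v∉ (proj₁ (∈-⁻ G u v∈))
        signs : sgn v G * sgn u (G ∪ ⁅ v ⁆) ≈ - (sgn u G * sgn v H)
        signs = subst (λ K → sgn v K * sgn u (K ∪ ⁅ v ⁆) ≈ - (sgn u K * sgn v H)) G≡
          (sgn-anticommute H (v≢u ∘ sym) u∉H v∉H)

  ∂-cone-cycle : ∀ (c : Coeffs n) → OffStar u c → (∀ G → ∂ c G ≈ 0#) → ∀ G → ∂ (cone u c) G ≈ c G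
  ∂-cone-cycle {u = u} c off ∂c≈0 G with u ∈? G
  ... | no  u∉ = ∂-cone-∉ c u∉
  ... | yes u∈ = ≈-trans (∂-cone-∈ c off u∈) (≈-trans (*-congˡ (∂c≈0 _)) (≈-trans (zeroʳ _) (≈-sym (off G u∈))))

  -- A cycle in the top dimension D of the induced complex on W, hence not a boundary.
  record TopCycle (Γ : Complex n) (W : Subset n) (D : ℕ) : Set (c ⊔ ℓ₁) where
    field
      chain   : Coeffs n
      support : ∀ F → ¬ (Face Γ F × F ⊆ₛ W × ∣ F ∣ ≡ suc D) → chain F ≈ 0#
      cycle   : ∀ G → ∂ chain G ≈ 0#
      simplex : Subset n
      nonzero : ¬ chain simplex ≈ 0#
      top     : ∀ F → Face Γ F → F ⊆ₛ W → ∣ F ∣ ≤ suc D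

  -- A chain bounding the cycle would live on faces with D + 2 elements, which `top` rules out; so
  -- it is zero, and so is its boundary, against `nonzero`.
  TopCycle⇒H̃≢0 : ∀ {Γ : Complex n} {W D} → TopCycle Γ W D → H̃≢0 (lk Γ ∅ ⟦ W ⟧) D
  TopCycle⇒H̃≢0 {Γ = Γ} {W} {D} t = chain , (isChain , cycle) , notBoundary
    where
    open TopCycle t
    isChain : IsChain (lk Γ ∅ ⟦ W ⟧) D chain
    isChain F ¬face = support F λ (F∈Γ , F⊆W , size) →
      ¬face (((F , ⊆-min F , F∈Γ , sym (p─⊥≡p F)) , F⊆W) , size)
    notBoundary : ¬ IsBoundary (lk Γ ∅ ⟦ W ⟧) D chain
    notBoundary (b , b-chain , ∂b≈) = nonzero (≈-trans (≈-sym (∂b≈ simplex)) (∂-zero b b≈0 simplex))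
      where
      b≈0 : ∀ F → b F ≈ 0#
      b≈0 F = b-chain F λ { (((G , _ , G∈Γ , F≡) , F⊆W) , size) →
        ℕ.<-irrefl refl (ℕ.≤-trans (ℕ.≤-reflexive (sym size))
          (top F (subst (Face Γ) (sym (trans F≡ (p─⊥≡p G))) G∈Γ) F⊆W)) }

  -- The generator of C₋₁. Vertices and edges are iterated cones over it, so that their boundaries
  -- follow from the cone formulas.
  empty : Coeffs n
  empty F = if ∣ F ∣ ≡ᵇ 0 then 1# else 0#

  empty-zero : ∣ F ∣ ≢ 0 → empty F ≈ 0#
  empty-zero {F = F} ≢0 with ∣ F ∣
  ... | zero  = contradiction refl ≢0
  ... | suc _ = ≈-refl

  empty-one : ∣ F ∣ ≡ 0 → empty F ≈ 1#
  empty-one {F = F} eq with ∣ F ∣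
  empty-one refl | zero = ≈-refl

  empty-off : OffStar u empty
  empty-off F u∈ = empty-zero {F = F} (∈⇒∣∣≢0 u∈)

  ∂-empty : ∀ (G : Subset n) → ∂ empty G ≈ 0#
  ∂-empty G = sum-zero (∂-term empty G) λ v → ∂-term-zero empty {G} {v} λ _ → empty-off (G ∪ ⁅ v ⁆) (∈∪ʳ (x∈⁅x⁆ v))

  vertex : Fin n → Coeffs n
  vertex y = cone y empty

  vertex-off : x ≢ y → OffStar x (vertex y)
  vertex-off {y = y} x≢y F x∈ = cone-zero {u = y} {F = F} empty λ _ → empty-off (F - y) (x∈p∧x≢y⇒x∈p-y x∈ x≢y)

  edge : Fin n → Fin n → Coeffs n
  edge x y = cone x (vertex y)

  ∂-edge : x ≢ y → ∀ G → ∂ (edge x y) G ≈ vertex y G + - vertex x G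
  ∂-edge {x = x} {y = y} x≢y G with x ∈? G
  ... | no  x∉ = begin
    ∂ (edge x y) G              ≈⟨ ∂-cone-∉ (vertex y) x∉ ⟩
    vertex y G                  ≈⟨ +-identityʳ _ ⟨
    vertex y G + 0#             ≈⟨ +-congˡ -0#≈0# ⟨
    vertex y G + - 0#           ∎
  ... | yes x∈ = begin
    ∂ (edge x y) G                             ≈⟨ ∂-cone-∈ (vertex y) (vertex-off x≢y) x∈ ⟩
    - sgn x G * ∂ (vertex y) (G - x)           ≈⟨ *-congˡ (∂-cone-cycle empty empty-off ∂-empty (G - x)) ⟩
    - sgn x G * empty (G - x)                  ≈⟨ -‿distribˡ-* _ _ ⟨
    - (sgn x G * empty (G - x))                ≈⟨ +-identityˡ _ ⟨
    0# + - (sgn x G * empty (G - x))           ≈⟨ +-congʳ (vertex-off x≢y G x∈) ⟨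
    vertex y G + - (sgn x G * empty (G - x))   ∎

  edge-zero : x ∈ₛ F → x ≢ y → x ≢ z → edge y z F ≈ 0#
  edge-zero {F = F} {y = y} {z = z} x∈ x≢y x≢z =
    cone-zero {u = y} {F = F} (vertex z) λ _ → vertex-off x≢z (F - y) (x∈p∧x≢y⇒x∈p-y x∈ x≢y)

  pathChain : List (Fin n) → Coeffs n
  pathChain (x ∷ y ∷ zs) = edge x y ⊞ pathChain (y ∷ zs)
  pathChain _            = λ _ → 0#

  pathChain-zero : x ∈ₛ F → ∀ ys → (∀ {y} → y ∈ ys → x ≢ y) → pathChain ys F ≈ 0#
  pathChain-zero x∈ []           _    = ≈-refl
  pathChain-zero x∈ (y ∷ [])     _    = ≈-refl
  pathChain-zero x∈ (y ∷ z ∷ ys) x≢ =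
    ≈-trans (+-cong (edge-zero x∈ (x≢ (here refl)) (x≢ (there (here refl)))) (pathChain-zero x∈ (z ∷ ys) (x≢ ∘ there)))
          (+-identityˡ 0#)

  ⊞-zero : ∀ (c e : Coeffs n) → c F ≈ 0# → e F ≈ 0# → (c ⊞ e) F ≈ 0#
  ⊞-zero c e c≈0 e≈0 = ≈-trans (+-cong c≈0 e≈0) (+-identityˡ 0#)

  ⊟-zero : ∀ (c : Coeffs n) → c F ≈ 0# → (⊟ c) F ≈ 0#
  ⊟-zero c c≈0 = ≈-trans (-‿cong c≈0) -0#≈0#

  suspension : Fin n → Fin n → Coeffs n → Coeffs n
  suspension u w c = cone u c ⊞ ⊟ cone w c

  ∂-suspension : ∀ (c : Coeffs n) → OffStar u c → OffStar w c → (∀ G → ∂ c G ≈ 0#) →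
                 ∀ G → ∂ (suspension u w c) G ≈ 0#
  ∂-suspension {u = u} {w = w} c off-u off-w ∂c≈0 G = begin
    ∂ (suspension u w c) G               ≈⟨ ∂-⊞ (cone u c) (⊟ cone w c) G ⟩
    ∂ (cone u c) G + ∂ (⊟ cone w c) G    ≈⟨ +-cong (∂-cone-cycle c off-u ∂c≈0 G) (≈-trans (∂-⊟ (cone w c) G) (-‿cong (∂-cone-cycle c off-w ∂c≈0 G))) ⟩
    c G + - c G                          ≈⟨ -‿inverseʳ (c G) ⟩
    0#                                   ∎

  suspension-nonzero : ∀ (c : Coeffs n) → u ∉ₛ F → w ∉ₛ F → u ≢ w → ¬ c F ≈ 0# →
                       ¬ suspension u w c (F ∪ ⁅ u ⁆) ≈ 0#
  suspension-nonzero {u = u} {F = F} {w = w} c u∉ w∉ u≢w c≉0 s≈0 = c≉0 (sgn-cancel u (F ∪ ⁅ u ⁆) (begin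
    sgn u (F ∪ ⁅ u ⁆) * c F                                    ≈⟨ *-congˡ (reflexive (cong c (p∪x-x≡p u∉))) ⟨
    sgn u (F ∪ ⁅ u ⁆) * c ((F ∪ ⁅ u ⁆) - u)                    ≈⟨ cone-∈ c (∈∪ʳ (x∈⁅x⁆ u)) ⟨
    cone u c (F ∪ ⁅ u ⁆)                                       ≈⟨ +-identityʳ _ ⟨
    cone u c (F ∪ ⁅ u ⁆) + 0#                                  ≈⟨ +-congˡ (⊟-zero {F = F ∪ ⁅ u ⁆} (cone w c) (cone-∉ c w∉′)) ⟨
    suspension u w c (F ∪ ⁅ u ⁆)                               ≈⟨ s≈0 ⟩
    0#                                                         ∎))
    where
    w∉′ : w ∉ₛ F ∪ ⁅ u ⁆
    w∉′ w∈ = [ w∉ , u≢w ∘ sym ]′ (∈∪⁅⁆⁻ F u w∈)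

  edge-support : F ≢ ⁅ y ⁆ ∪ ⁅ x ⁆ → edge x y F ≈ 0#
  edge-support {F = F} {y = y} {x = x} F≢ =
    cone-zero {u = x} {F = F} (vertex y) λ x∈ → cone-zero {u = y} {F = F - x} empty λ y∈ →
      empty-zero {F = F - x - y} (F≢ ∘ two-elements x∈ y∈)

  edge-nonzero : ∀ {x y : Fin n} → x ≢ y → ¬ edge x y (⁅ y ⁆ ∪ ⁅ x ⁆) ≈ 0#
  edge-nonzero {x = x} {y = y} x≢y e≈0 = 1≉0 (≈-trans (≈-sym (empty-one {F = ⁅ y ⁆ - y} size)) (sgn-cancel y ⁅ y ⁆ (≈-trans
    (≈-sym (cone-∈ empty (x∈⁅x⁆ y))) (sgn-cancel x (⁅ y ⁆ ∪ ⁅ x ⁆) (begin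
      sgn x (⁅ y ⁆ ∪ ⁅ x ⁆) * vertex y ⁅ y ⁆                        ≈⟨ *-congˡ (reflexive (cong (vertex y) (p∪x-x≡p x∉y))) ⟨
      sgn x (⁅ y ⁆ ∪ ⁅ x ⁆) * vertex y ((⁅ y ⁆ ∪ ⁅ x ⁆) - x)        ≈⟨ cone-∈ (vertex y) (∈∪ʳ (x∈⁅x⁆ x)) ⟨
      edge x y (⁅ y ⁆ ∪ ⁅ x ⁆)                                      ≈⟨ e≈0 ⟩
      0#                                                            ∎)))))
    where
    x∉y : x ∉ₛ ⁅ y ⁆
    x∉y x∈ = x≢y (x∈⁅y⁆⇒x≡y y x∈)
    size : ∣ ⁅ y ⁆ - y ∣ ≡ 0
    size = ℕ.suc-injective (trans (sym (∣p∣≡1+∣p-x∣ (x∈⁅x⁆ y))) (∣⁅x⁆∣≡1 y))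

  -- The boundaries of consecutive edges telescope.
  ∂-pathChain : ∀ (x : Fin n) ps z → Linked _≢_ (x ∷ ps ∷ʳ z) →
                ∀ G → ∂ (pathChain (x ∷ ps ∷ʳ z)) G ≈ vertex z G + - vertex x G
  ∂-pathChain x [] z (x≢z ∷ _) G = begin
    ∂ (edge x z ⊞ (λ _ → 0#)) G               ≈⟨ ∂-⊞ (edge x z) (λ _ → 0#) G ⟩
    ∂ (edge x z) G + ∂ (λ _ → 0#) G           ≈⟨ +-cong (∂-edge x≢z G) (∂-zero (λ _ → 0#) (λ _ → ≈-refl) G) ⟩
    vertex z G + - vertex x G + 0#            ≈⟨ +-identityʳ _ ⟩
    vertex z G + - vertex x G                 ∎
  ∂-pathChain x (p ∷ ps) z (x≢p ∷ linked) G = begin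
    ∂ (edge x p ⊞ pathChain (p ∷ ps ∷ʳ z)) G                    ≈⟨ ∂-⊞ (edge x p) (pathChain (p ∷ ps ∷ʳ z)) G ⟩
    ∂ (edge x p) G + ∂ (pathChain (p ∷ ps ∷ʳ z)) G              ≈⟨ +-cong (∂-edge x≢p G) (∂-pathChain p ps z linked G) ⟩
    (vp + - vx) + (vz + - vp)                                   ≈⟨ +-comm _ _ ⟩
    (vz + - vp) + (vp + - vx)                                   ≈⟨ +-assoc _ _ _ ⟩
    vz + (- vp + (vp + - vx))                                   ≈⟨ +-congˡ (+-assoc _ _ _) ⟨
    vz + ((- vp + vp) + - vx)                                   ≈⟨ +-congˡ (≈-trans (+-congʳ (-‿inverseˡ vp)) (+-identityˡ _)) ⟩
    vz + - vx                                                   ∎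
    where
    vx = vertex x G
    vp = vertex p G
    vz = vertex z G

  cycleChain : Fin n → List (Fin n) → Fin n → Coeffs n
  cycleChain x ps z = edge z x ⊞ pathChain (x ∷ ps ∷ʳ z)

  ∂-cycleChain : ∀ (x : Fin n) ps z → Linked _≢_ (x ∷ ps ∷ʳ z) → x ≢ z → ∀ G → ∂ (cycleChain x ps z) G ≈ 0#
  ∂-cycleChain x ps z linked x≢z G = begin
    ∂ (cycleChain x ps z) G                              ≈⟨ ∂-⊞ (edge z x) (pathChain (x ∷ ps ∷ʳ z)) G ⟩
    ∂ (edge z x) G + ∂ (pathChain (x ∷ ps ∷ʳ z)) G       ≈⟨ +-cong (∂-edge (x≢z ∘ sym) G) (∂-pathChain x ps z linked G) ⟩
    (vx + - vz) + (vz + - vx)                            ≈⟨ +-assoc _ _ _ ⟩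
    vx + (- vz + (vz + - vx))                            ≈⟨ +-congˡ (+-assoc _ _ _) ⟨
    vx + ((- vz + vz) + - vx)                            ≈⟨ +-congˡ (≈-trans (+-congʳ (-‿inverseˡ vz)) (+-identityˡ _)) ⟩
    vx + - vx                                            ≈⟨ -‿inverseʳ vx ⟩
    0#                                                   ∎
    where
    vx = vertex x G
    vz = vertex z G

  -- The coefficient is read off at the closing edge, where the path contributes nothing: its first
  -- edge misses `z` and all later ones miss `x`.
  cycleChain-nonzero : ∀ (x p : Fin n) ps z → x ≢ z → z ≢ p → (∀ {y} → y ∈ p ∷ ps ∷ʳ z → x ≢ y) →
                       ¬ cycleChain x (p ∷ ps) z (⁅ x ⁆ ∪ ⁅ z ⁆) ≈ 0#
  cycleChain-nonzero x p ps z x≢z z≢p x≢ c≈0 = edge-nonzero (x≢z ∘ sym) (begin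
    edge z x (⁅ x ⁆ ∪ ⁅ z ⁆)                        ≈⟨ +-identityʳ _ ⟨
    edge z x (⁅ x ⁆ ∪ ⁅ z ⁆) + 0#
      ≈⟨ +-congˡ (⊞-zero {F = ⁅ x ⁆ ∪ ⁅ z ⁆} (edge x p) (pathChain (p ∷ ps ∷ʳ z))
           (edge-zero (∈∪ʳ (x∈⁅x⁆ z)) (x≢z ∘ sym) z≢p) (pathChain-zero (∈∪ˡ (x∈⁅x⁆ x)) (p ∷ ps ∷ʳ z) x≢)) ⟨
    cycleChain x (p ∷ ps) z (⁅ x ⁆ ∪ ⁅ z ⁆)         ≈⟨ c≈0 ⟩
    0#                                              ∎)

  pathChain-support : ∀ (F : Subset n) xs → Linked (λ x y → F ≢ ⁅ y ⁆ ∪ ⁅ x ⁆) xs → pathChain xs F ≈ 0#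
  pathChain-support F []           _       = ≈-refl
  pathChain-support F (x ∷ [])     _       = ≈-refl
  pathChain-support F (x ∷ y ∷ xs) (≢ ∷ l) =
    ⊞-zero {F = F} (edge x y) (pathChain (y ∷ xs)) (edge-support ≢) (pathChain-support F (y ∷ xs) l)

open import Algebra.Properties.Group using (∙-cancelʳ)
import Data.Integer as ℤ
import Data.Integer.Properties as ℤ
open import Data.List.Extrema.Nat using (max; xs≤max)
open import Data.List.Membership.Propositional.Properties
  using (∈-++⁺ˡ; ∈-++⁺ʳ; ∈-++⁻; ∈-allFin; ∈-map⁺; ∈-map⁻; ∈-filter⁺; ∈-filter⁻)
open import Data.List.Properties
  using (++-assoc; length-++; length-ʳ++; length-filter; length-map; length-tabulate; map-∘; map-id-local)
open import Data.List.Relation.Binary.Permutation.Propositional using (_↭_; ↭-sym; ↭⇒↭ₛ)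
import Data.List.Relation.Binary.Permutation.Propositional.Properties as Perm
import Data.List.Relation.Binary.Permutation.Setoid.Properties as SetoidPerm
open import Data.List.Relation.Unary.All as All using (All; []; _∷_)
import Data.List.Relation.Unary.All.Properties as All
open import Data.List.Relation.Unary.AllPairs using (AllPairs; []; _∷_)
open import Data.List.Relation.Unary.Unique.Propositional using (Unique)
import Data.List.Relation.Unary.Unique.Propositional.Properties as Unique
open import Data.Nat hiding (_≟_)
open import Data.Nat.Divisibility using (_∣_; ∣-trans; m∣m*n; m≤n⇒m!∣n!; quotient)
open import Data.Nat.ListAction using (sum)
open import Data.Nat.ListAction.Properties using (sum-↭)
open import Data.Nat.Properties hiding (_≟_)
open import Data.Nat.Tactic.RingSolver using (solve-∀)
import Data.Rational as ℚ
open import Data.Rational using (ℚ; 0ℚ; 1ℚ; ½; ↥_; ↧ₙ_)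
import Data.Rational.Properties as ℚ
open import Data.Rational.Solver using (module +-*-Solver)
import Data.Rational.Unnormalised as ℚᵘ
import Data.Rational.Unnormalised.Properties as ℚᵘ
open import Data.Unit using (⊤; tt)

-- Natural number arithmetic

square-cancel-≤ : ∀ x y → x * x ≤ y * y → x ≤ y
square-cancel-≤ x y le with x ≤? y
... | yes x≤y = x≤y
... | no  x≰y = contradiction le (<⇒≱ (*-mono-< (≰⇒> x≰y) (≰⇒> x≰y)))

am-gm : ∀ x y → 4 * (x * y) ≤ (x + y) * (x + y)
am-gm x y with ≤-total x y
... | inj₁ x≤y with _ , refl ← m≤n⇒∃[o]m+o≡n x≤y = ≤-trans (m≤m+n _ _) (≤-reflexive (rearrange x _))
  where
  rearrange : ∀ x o → 4 * (x * (x + o)) + o * o ≡ (x + (x + o)) * (x + (x + o))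
  rearrange = solve-∀
... | inj₂ y≤x with _ , refl ← m≤n⇒∃[o]m+o≡n y≤x = ≤-trans (m≤m+n _ _) (≤-reflexive (rearrange y _))
  where
  rearrange : ∀ y o → 4 * ((y + o) * y) + o * o ≡ (y + o + y) * (y + o + y)
  rearrange = solve-∀

^-cancel-≤ : ∀ M .{{_ : NonZero M}} x y → x ^ M ≤ y ^ M → x ≤ y
^-cancel-≤ M x y le with x ≤? y
... | yes x≤y = x≤y
... | no  x≰y = contradiction le (<⇒≱ (^-monoˡ-< M (≰⇒> x≰y)))

^-distrib-* : ∀ x y n → (x * y) ^ n ≡ x ^ n * y ^ n
^-distrib-* x y zero    = refl
^-distrib-* x y (suc n) = trans (cong (x * y *_) (^-distrib-* x y n)) (rearrange x y (x ^ n) (y ^ n))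
  where
  rearrange : ∀ x y a b → x * y * (a * b) ≡ x * a * (y * b)
  rearrange = solve-∀

m≤m^n : ∀ m n .{{_ : NonZero n}} → m ≤ m ^ n
m≤m^n zero      n = z≤n
m≤m^n m@(suc _) n = ≤-trans (≤-reflexive (sym (^-identityʳ m))) (^-monoʳ-≤ m (>-nonZero⁻¹ n))

-- The integer substitute for R^(1/N). It turns a bound on N-th powers into one natural number `B`,
-- valid for all quantities in question, at no loss since `B ^ N ≤ R`. The search descends from `R`,
-- an upper bound because y ≤ y^N.
floorRoot : ∀ N .{{_ : NonZero N}} R → ∃[ B ] (B ^ N ≤ R × ∀ y → y ^ N ≤ R → y ≤ B)
floorRoot N R = search R λ y → ≤-trans (m≤m^n y N)
  where
  search : ∀ b → (∀ y → y ^ N ≤ R → y ≤ b) → ∃[ B ] (B ^ N ≤ R × ∀ y → y ^ N ≤ R → y ≤ B)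
  search b max with b ^ N ≤? R
  ... | yes le = b , le , max
  search zero max | no ≰R = ⊥-elim (≰R (≤-trans (≤-reflexive (0^N≡0 N)) z≤n))
    where
    0^N≡0 : ∀ N .{{_ : NonZero N}} → 0 ^ N ≡ 0
    0^N≡0 (suc _) = refl
  search (suc b) max | no ≰R = search b λ y y^N≤R →
    s≤s⁻¹ (≤∧≢⇒< (max y y^N≤R) λ { refl → ≰R y^N≤R })

-- Sums over lists

𝟙[_] : Bool → ℕ
𝟙[ b ] = if b then 1 else 0

𝟙≤1 : ∀ b → 𝟙[ b ] ≤ 1
𝟙≤1 true  = ≤-refl
𝟙≤1 false = z≤n

module _ {V : Set} where

  ∑ : List V → (V → ℕ) → ℕ
  ∑ xs f = sum (map f xs)

  private variable
    φ ψ χ : V → ℕ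

  ∑-mono : ∀ xs → (∀ {x} → x ∈ xs → φ x ≤ ψ x) → ∑ xs φ ≤ ∑ xs ψ
  ∑-mono []       _  = z≤n
  ∑-mono (x ∷ xs) le = +-mono-≤ (le (here refl)) (∑-mono xs (le ∘ there))

  ∑-cong : ∀ xs → (∀ {x} → x ∈ xs → φ x ≡ ψ x) → ∑ xs φ ≡ ∑ xs ψ
  ∑-cong []       _  = refl
  ∑-cong (x ∷ xs) eq = cong₂ _+_ (eq (here refl)) (∑-cong xs (eq ∘ there))

  ∑-+ : ∀ xs (φ ψ : V → ℕ) → ∑ xs (λ x → φ x + ψ x) ≡ ∑ xs φ + ∑ xs ψ
  ∑-+ []       φ ψ = refl
  ∑-+ (x ∷ xs) φ ψ = trans (cong (φ x + ψ x +_) (∑-+ xs φ ψ)) (rearrange (φ x) (ψ x) (∑ xs φ) (∑ xs ψ))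
    where
    rearrange : ∀ a b c d → a + b + (c + d) ≡ a + c + (b + d)
    rearrange = solve-∀

  ∑-*ˡ : ∀ xs c (φ : V → ℕ) → ∑ xs (λ x → c * φ x) ≡ c * ∑ xs φ
  ∑-*ˡ []       c φ = sym (*-zeroʳ c)
  ∑-*ˡ (x ∷ xs) c φ = trans (cong (c * φ x +_) (∑-*ˡ xs c φ)) (sym (*-distribˡ-+ c (φ x) _))

  ∑-*ʳ : ∀ xs c (φ : V → ℕ) → ∑ xs (λ x → φ x * c) ≡ ∑ xs φ * c
  ∑-*ʳ xs c φ = trans (∑-cong xs λ {x} _ → *-comm (φ x) c) (trans (∑-*ˡ xs c φ) (*-comm c _))

  ∑-const : ∀ xs c → ∑ xs (λ _ → c) ≡ length xs * c
  ∑-const []       c = refl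
  ∑-const (x ∷ xs) c = cong (c +_) (∑-const xs c)

  ∑-length : ∀ xs → ∑ xs (λ _ → 1) ≡ length xs
  ∑-length xs = trans (∑-const xs 1) (*-identityʳ _)

  ∑-zero : ∀ xs → ∑ xs (λ _ → 0) ≡ 0
  ∑-zero xs = trans (∑-const xs 0) (*-zeroʳ (length xs))

  ∑-filter : ∀ xs (p : V → Bool) (φ : V → ℕ) → ∑ (filterᵇ p xs) φ ≡ ∑ xs (λ x → 𝟙[ p x ] * φ x)
  ∑-filter []       p φ = refl
  ∑-filter (x ∷ xs) p φ with p x
  ... | true  = cong₂ _+_ (sym (*-identityˡ (φ x))) (∑-filter xs p φ)
  ... | false = ∑-filter xs p φ

  length-filter-∑ : ∀ xs (p : V → Bool) → length (filterᵇ p xs) ≡ ∑ xs (λ x → 𝟙[ p x ])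
  length-filter-∑ xs p = trans (sym (∑-length (filterᵇ p xs)))
    (trans (∑-filter xs p _) (∑-cong xs λ _ → *-identityʳ _))

  ∑-↭ : ∀ {xs ys} (φ : V → ℕ) → xs ↭ ys → ∑ xs φ ≡ ∑ ys φ
  ∑-↭ φ p = sum-↭ (Perm.map⁺ φ p)

  -- The termwise inequality stands in for square roots and has the same shape as the conclusion, so
  -- that the lemma can be iterated over nested sums. The cross term is compared after squaring, by
  -- the AM-GM inequality.
  cauchy-schwarz : ∀ xs → (∀ {x} → x ∈ xs → φ x * φ x ≤ ψ x * χ x) → ∑ xs φ * ∑ xs φ ≤ ∑ xs ψ * ∑ xs χ
  cauchy-schwarz []       _  = z≤n
  cauchy-schwarz {φ} {ψ} {χ} (x ∷ xs) le = begin
    (s + A) * (s + A)                       ≡⟨ expand s A ⟩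
    s * s + 2 * (s * A) + A * A             ≤⟨ +-mono-≤ (+-mono-≤ s²≤bc cross) A²≤BC ⟩
    b * c + (b * C + c * B) + B * C         ≡⟨ collect b c B C ⟩
    (b + B) * (c + C)                       ∎
    where
    open ≤-Reasoning
    s = φ x
    b = ψ x
    c = χ x
    A = ∑ xs φ
    B = ∑ xs ψ
    C = ∑ xs χ
    s²≤bc = le (here refl)
    A²≤BC : A * A ≤ B * C
    A²≤BC = cauchy-schwarz xs (le ∘ there)
    expand : ∀ s A → (s + A) * (s + A) ≡ s * s + 2 * (s * A) + A * A
    expand = solve-∀
    collect : ∀ b c B C → b * c + (b * C + c * B) + B * C ≡ (b + B) * (c + C)
    collect = solve-∀
    regroup₁ : ∀ s A → 2 * (s * A) * (2 * (s * A)) ≡ 4 * (s * s * (A * A))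
    regroup₁ = solve-∀
    regroup₂ : ∀ b c B C → 4 * (b * c * (B * C)) ≡ 4 * (b * C * (c * B))
    regroup₂ = solve-∀
    cross : 2 * (s * A) ≤ b * C + c * B
    cross = square-cancel-≤ _ _ (begin
      2 * (s * A) * (2 * (s * A))          ≡⟨ regroup₁ s A ⟩
      4 * (s * s * (A * A))                ≤⟨ *-monoʳ-≤ 4 (*-mono-≤ s²≤bc A²≤BC) ⟩
      4 * (b * c * (B * C))                ≡⟨ regroup₂ b c B C ⟩
      4 * (b * C * (c * B))                ≤⟨ am-gm (b * C) (c * B) ⟩
      (b * C + c * B) * (b * C + c * B)    ∎)

  filterᵇ-comm : ∀ (p q : V → Bool) xs → filterᵇ p (filterᵇ q xs) ≡ filterᵇ q (filterᵇ p xs)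
  filterᵇ-comm p q [] = refl
  filterᵇ-comm p q (x ∷ xs) with p x in px | q x in qx
  ... | true  | true  rewrite px | qx = cong (x ∷_) (filterᵇ-comm p q xs)
  ... | true  | false rewrite qx      = filterᵇ-comm p q xs
  ... | false | true  rewrite px      = filterᵇ-comm p q xs
  ... | false | false                 = filterᵇ-comm p q xs

  ∈-filterᵇ⁺ : ∀ (p : V → Bool) {x xs} → x ∈ xs → T (p x) → x ∈ filterᵇ p xs
  ∈-filterᵇ⁺ p = ∈-filter⁺ (T? ∘ p)

  ∈-filterᵇ⁻ : ∀ (p : V → Bool) {x} xs → x ∈ filterᵇ p xs → x ∈ xs × T (p x)
  ∈-filterᵇ⁻ p xs = ∈-filter⁻ (T? ∘ p) {xs = xs}

  ∈⇒↭ : ∀ {x : V} {xs} → x ∈ xs → ∃[ ys ] xs ↭ x ∷ ys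
  ∈⇒↭ {xs = x ∷ xs} (here refl) = xs , _↭_.refl
  ∈⇒↭ {xs = y ∷ xs} (there x∈) with ys , p ← ∈⇒↭ x∈ = y ∷ ys , _↭_.trans (_↭_.prep y p) (_↭_.swap y _ _↭_.refl)

∑-swap : ∀ {U V : Set} (xs : List U) (ys : List V) (φ : U → V → ℕ) →
         ∑ xs (λ x → ∑ ys (λ y → φ x y)) ≡ ∑ ys (λ y → ∑ xs (λ x → φ x y))
∑-swap []       ys φ = sym (∑-zero ys)
∑-swap (x ∷ xs) ys φ = trans (cong (∑ ys (φ x) +_) (∑-swap xs ys φ)) (sym (∑-+ ys (φ x) _))

-- Cliques in graphs

∑-filter-≤ : ∀ {V : Set} (xs : List V) (p : V → Bool) (f : V → ℕ) → ∑ (filterᵇ p xs) f ≤ ∑ xs f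
∑-filter-≤ xs p f = begin
  ∑ (filterᵇ p xs) f            ≡⟨ ∑-filter xs p f ⟩
  ∑ xs (λ x → 𝟙[ p x ] * f x)    ≤⟨ ∑-mono xs (λ {x} _ → *-monoˡ-≤ (f x) (𝟙≤1 (p x))) ⟩
  ∑ xs (λ x → 1 * f x)          ≡⟨ ∑-cong xs (λ {x} _ → *-identityˡ (f x)) ⟩
  ∑ xs f                        ∎
  where open ≤-Reasoning

record Graph : Set₁ where
  infix 4 _≟_
  field
    V          : Set
    _≟_        : DecidableEquality V
    adj        : V → V → Bool
    adj-sym    : ∀ u v → adj u v ≡ adj v u
    adj-irrefl : ∀ v → adj v v ≡ false

module Cliques (G : Graph) where

  open Graph G public

  eqᵇ far : V → V → Bool
  eqᵇ u w = does (u ≟ w)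
  far u w = not (eqᵇ u w) ∧ not (adj u w)

  eqᵇ-sym : ∀ u y → eqᵇ u y ≡ eqᵇ y u
  eqᵇ-sym u y with u ≟ y | y ≟ u
  ... | yes _   | yes _   = refl
  ... | no  _   | no  _   = refl
  ... | yes u≡y | no  y≢u = contradiction (sym u≡y) y≢u
  ... | no  u≢y | yes y≡u = contradiction (sym y≡u) u≢y

  𝟙-partition : ∀ u w → 𝟙[ eqᵇ u w ] + 𝟙[ adj u w ] + 𝟙[ far u w ] ≡ 1
  𝟙-partition u w with u ≟ w
  ... | yes refl rewrite adj-irrefl u = refl
  ... | no  _ with adj u w
  ...   | true  = refl
  ...   | false = refl

  trichotomy : ∀ u w → u ≡ w ⊎ T (adj u w) ⊎ T (far u w)
  trichotomy u w with u ≟ w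
  ... | yes u≡w = inj₁ u≡w
  ... | no  _ with adj u w
  ...   | true  = inj₂ (inj₁ _)
  ...   | false = inj₂ (inj₂ _)

  far⇒≢ : ∀ {u w} → T (far u w) → u ≢ w
  far⇒≢ {u} {w} f u≡w with u ≟ w
  ... | no u≢w = u≢w u≡w

  far⇒¬adj : ∀ {u w} → T (far u w) → ¬ T (adj u w)
  far⇒¬adj {u} {w} f a with u ≟ w | adj u w
  far⇒¬adj () a | no _ | true

  adj⇒≢ : ∀ {u w} → T (adj u w) → u ≢ w
  adj⇒≢ {u} a refl = subst T (adj-irrefl u) a

  Tadj-sym : ∀ {u w} → T (adj u w) → T (adj w u)
  Tadj-sym {u} {w} = subst T (adj-sym u w)

  far-intro : ∀ {u w} → u ≢ w → ¬ T (adj u w) → T (far u w)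
  far-intro {u} {w} u≢w ¬a with trichotomy u w
  ... | inj₁ u≡w        = contradiction u≡w u≢w
  ... | inj₂ (inj₁ a)   = contradiction a ¬a
  ... | inj₂ (inj₂ f)   = f

  Tfar-sym : ∀ {u w} → T (far u w) → T (far w u)
  Tfar-sym f = far-intro (far⇒≢ f ∘ sym) (far⇒¬adj f ∘ Tadj-sym)

  ∑-eq≤1 : ∀ u {xs} → Unique xs → ∑ xs (λ w → 𝟙[ eqᵇ u w ]) ≤ 1
  ∑-eq≤1 u [] = z≤n
  ∑-eq≤1 u {w ∷ xs} (w∉xs ∷ uniq) with u ≟ w
  ... | no  _    = ∑-eq≤1 u uniq
  ... | yes refl = ≤-reflexive (cong suc (trans (∑-cong xs none) (∑-zero xs)))
    where
    none : ∀ {x} → x ∈ xs → 𝟙[ eqᵇ u x ] ≡ 0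
    none {x} x∈ with u ≟ x
    ... | yes u≡x = contradiction u≡x (All.lookup w∉xs x∈)
    ... | no  _   = refl

  N : V → List V → List V
  N u = filterᵇ (adj u)

  N-unique : ∀ u {xs} → Unique xs → Unique (N u xs)
  N-unique u = Unique.filter⁺ (T? ∘ adj u)

  N-comm : ∀ u w xs → N u (N w xs) ≡ N w (N u xs)
  N-comm u w = filterᵇ-comm (adj u) (adj w)

  length-N : ∀ u xs → length (N u xs) ≤ length xs
  length-N u = length-filter (T? ∘ adj u)

  _⊑_ : List V → List V → Set
  ys ⊑ xs = ∀ {x} → x ∈ ys → x ∈ xs

  N-⊑ : ∀ u xs → N u xs ⊑ xs
  N-⊑ u xs x∈ = proj₁ (∈-filterᵇ⁻ (adj u) xs x∈)

  N-mono : ∀ u {xs ys} → ys ⊑ xs → N u ys ⊑ N u xs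
  N-mono u {xs} {ys} sub x∈ with x∈ys , a ← ∈-filterᵇ⁻ (adj u) ys x∈ = ∈-filterᵇ⁺ (adj u) (sub x∈ys) a

  ∈N⁻ : ∀ u xs {x} → x ∈ N u xs → x ∈ xs × T (adj u x)
  ∈N⁻ u xs = ∈-filterᵇ⁻ (adj u) xs

  Clique : List V → Set
  Clique = AllPairs (λ u w → T (adj u w))

  NoFar : List V → Set
  NoFar xs = ∀ {u w} → u ∈ xs → w ∈ xs → ¬ T (far u w)

  NoFar⇒Clique : ∀ {xs} → Unique xs → NoFar xs → Clique xs
  NoFar⇒Clique [] nf = []
  NoFar⇒Clique {x ∷ xs} (x∉ ∷ uniq) nf =
    All.tabulate (λ {w} w∈ → [ (λ x≡w → contradiction x≡w (All.lookup x∉ w∈))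
                             , [ id , (λ f → ⊥-elim (nf (here refl) (there w∈) f)) ]′ ]′ (trichotomy x w))
    ∷ NoFar⇒Clique uniq (λ u∈ w∈ → nf (there u∈) (there w∈))

  noFar? : ∀ xs → (∃[ u ] ∃[ w ] (u ∈ xs × w ∈ xs × T (far u w))) ⊎ NoFar xs
  noFar? xs with Any.any? (λ u → Any.any? (λ w → T? (far u w)) xs) xs
  ... | yes p with u , u∈ , q ← find p with w , w∈ , f ← find q = inj₁ (u , w , u∈ , w∈ , f)
  ... | no ¬p = inj₂ λ u∈ w∈ f → ¬p (lose u∈ (lose w∈ f))

  -- If P excludes certain induced subgraphs, then Hered P q excludes their q-fold suspensions.
  Hered : (List V → Set) → ℕ → List V → Set
  Hered P zero    xs = P xs
  Hered P (suc q) xs = ∀ {u w} → u ∈ xs → w ∈ xs → T (far u w) → Hered P q (N u (N w xs))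

  Hered-⊑ : ∀ {P} → (∀ {xs ys} → ys ⊑ xs → P xs → P ys) →
            ∀ q {xs ys} → ys ⊑ xs → Hered P q xs → Hered P q ys
  Hered-⊑ mono zero    sub p = mono sub p
  Hered-⊑ mono (suc q) sub h {u} {w} u∈ w∈ f =
    Hered-⊑ mono q (N-mono u (N-mono w sub)) (h (sub u∈) (sub w∈) f)

  Hered-map : ∀ {P Q} k → (∀ {xs} → P xs → Hered Q k xs) → ∀ q {xs} → Hered P q xs → Hered Q (q + k) xs
  Hered-map k imp zero    p = imp p
  Hered-map k imp (suc q) h = λ u∈ w∈ f → Hered-map k imp q (h u∈ w∈ f)

  NoFar-⊑ : ∀ {xs ys} → ys ⊑ xs → NoFar xs → NoFar ys
  NoFar-⊑ sub nf u∈ w∈ = nf (sub u∈) (sub w∈)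

  farDeg : V → List V → ℕ
  farDeg u xs = ∑ xs (λ w → 𝟙[ far u w ])

  farPairs : List V → ℕ
  farPairs xs = ∑ xs (λ u → farDeg u xs)

  farPairs-N : ∀ u xs → farPairs (N u xs) ≤ farPairs xs
  farPairs-N u xs = ≤-trans (∑-filter-≤ xs (adj u) _) (∑-mono xs λ _ → ∑-filter-≤ xs (adj u) _)

  length-N-N : ∀ u w xs → length (N u (N w xs)) ≡ ∑ xs (λ x → 𝟙[ adj w x ] * 𝟙[ adj u x ])
  length-N-N u w xs = trans (length-filter-∑ (N w xs) (adj u)) (∑-filter xs (adj w) _)

  -- A vertex missed by the common neighbourhood is equal to or far from one of `u` and `w`; the two
  -- units pay for equality.
  common-nbrs : ∀ u w {xs} → Unique xs →
                length xs ≤ length (N u (N w xs)) + (farDeg u xs + 1) + (farDeg w xs + 1)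
  common-nbrs u w {xs} uniq = begin
    length xs                                 ≡⟨ ∑-length xs ⟨
    ∑ xs (λ _ → 1)                            ≤⟨ ∑-mono xs (λ {x} _ → pointwise x) ⟩
    ∑ xs (λ x → 𝟙[ adj w x ] * 𝟙[ adj u x ] + (𝟙[ far u x ] + 𝟙[ eqᵇ u x ]) + (𝟙[ far w x ] + 𝟙[ eqᵇ w x ]))
      ≡⟨ trans (∑-+ xs _ _) (cong (_+ _) (∑-+ xs _ _)) ⟩
    ∑ xs (λ x → 𝟙[ adj w x ] * 𝟙[ adj u x ]) + ∑ xs (λ x → 𝟙[ far u x ] + 𝟙[ eqᵇ u x ])
                                           + ∑ xs (λ x → 𝟙[ far w x ] + 𝟙[ eqᵇ w x ])
      ≤⟨ +-mono-≤ (+-mono-≤ (≤-reflexive (sym (length-N-N u w xs))) (part u)) (part w) ⟩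
    length (N u (N w xs)) + (farDeg u xs + 1) + (farDeg w xs + 1) ∎
    where
    open ≤-Reasoning
    part : ∀ u → ∑ xs (λ x → 𝟙[ far u x ] + 𝟙[ eqᵇ u x ]) ≤ farDeg u xs + 1
    part u = ≤-trans (≤-reflexive (∑-+ xs _ _)) (+-monoʳ-≤ _ (∑-eq≤1 u uniq))
    pointwise : ∀ x → 1 ≤ 𝟙[ adj w x ] * 𝟙[ adj u x ] + (𝟙[ far u x ] + 𝟙[ eqᵇ u x ]) + (𝟙[ far w x ] + 𝟙[ eqᵇ w x ])
    pointwise x with u ≟ x | adj u x | w ≟ x | adj w x
    ... | yes _ | true  | yes _ | true  = s≤s z≤n
    ... | yes _ | true  | yes _ | false = s≤s z≤n
    ... | yes _ | true  | no _ | true  = s≤s z≤n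
    ... | yes _ | true  | no _ | false = s≤s z≤n
    ... | yes _ | false | yes _ | true  = s≤s z≤n
    ... | yes _ | false | yes _ | false = s≤s z≤n
    ... | yes _ | false | no _ | true  = s≤s z≤n
    ... | yes _ | false | no _ | false = s≤s z≤n
    ... | no _ | true  | yes _ | true  = s≤s z≤n
    ... | no _ | true  | yes _ | false = s≤s z≤n
    ... | no _ | true  | no _ | true  = s≤s z≤n
    ... | no _ | true  | no _ | false = s≤s z≤n
    ... | no _ | false | _ | true  = s≤s z≤n
    ... | no _ | false | _ | false = s≤s z≤n

  -- Sum of φ over the common neighbourhoods in xs of all ordered i-cliques in xs.
  cliqueSum : ℕ → (List V → ℕ) → List V → ℕ
  cliqueSum zero    φ xs = φ xs
  cliqueSum (suc i) φ xs = ∑ xs λ x → cliqueSum i φ (N x xs)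

  cliques : ℕ → List V → ℕ
  cliques i = cliqueSum i (λ _ → 1)

  cliques-suc : ∀ i xs → cliques (suc i) xs ≡ cliqueSum i length xs
  cliques-suc zero    xs = ∑-length xs
  cliques-suc (suc i) xs = ∑-cong xs λ {x} _ → cliques-suc i (N x xs)

  cliques≤^ : ∀ i {m} xs → length xs ≤ m → cliques i xs ≤ m ^ i
  cliques≤^ zero        xs le = ≤-refl
  cliques≤^ (suc i) {m} xs le = begin
    ∑ xs (λ x → cliques i (N x xs))   ≤⟨ ∑-mono xs (λ {x} _ → cliques≤^ i (N x xs) (≤-trans (length-N x xs) le)) ⟩
    ∑ xs (λ _ → m ^ i)                ≡⟨ ∑-const xs (m ^ i) ⟩
    length xs * m ^ i                 ≤⟨ *-monoˡ-≤ (m ^ i) le ⟩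
    m * m ^ i                         ∎
    where open ≤-Reasoning

  cliqueSum-*ˡ : ∀ i c φ xs → cliqueSum i (λ ys → c * φ ys) xs ≡ c * cliqueSum i φ xs
  cliqueSum-*ˡ zero    c φ xs = refl
  cliqueSum-*ˡ (suc i) c φ xs = trans (∑-cong xs λ {x} _ → cliqueSum-*ˡ i c φ (N x xs)) (∑-*ˡ xs c _)

  cliqueSum-+ : ∀ i φ ψ xs → cliqueSum i (λ ys → φ ys + ψ ys) xs ≡ cliqueSum i φ xs + cliqueSum i ψ xs
  cliqueSum-+ zero    φ ψ xs = refl
  cliqueSum-+ (suc i) φ ψ xs = trans (∑-cong xs λ {x} _ → cliqueSum-+ i φ ψ (N x xs)) (∑-+ xs _ _)

  cliqueSum-mono : ∀ (P : List V → Set) → (∀ x {xs} → P xs → P (N x xs)) →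
                   ∀ {φ ψ} → (∀ {xs} → P xs → φ xs ≤ ψ xs) →
                   ∀ i {xs} → P xs → cliqueSum i φ xs ≤ cliqueSum i ψ xs
  cliqueSum-mono P closed le zero    p = le p
  cliqueSum-mono P closed le (suc i) {xs} p = ∑-mono xs λ {x} _ → cliqueSum-mono P closed le i (closed x p)

  cliqueSum-cauchy-schwarz : ∀ i φ xs →
    cliqueSum i φ xs * cliqueSum i φ xs ≤ cliques i xs * cliqueSum i (λ ys → φ ys * φ ys) xs
  cliqueSum-cauchy-schwarz zero    φ xs = ≤-reflexive (sym (*-identityˡ _))
  cliqueSum-cauchy-schwarz (suc i) φ xs = cauchy-schwarz xs λ {x} _ → cliqueSum-cauchy-schwarz i φ (N x xs)

  -- Double counting: a far pair in the common neighbourhood of a clique is the same as a clique in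
  -- the common neighbourhood of a far pair.
  cliqueSum-farPairs : ∀ i xs →
    cliqueSum i farPairs xs ≡ ∑ xs (λ u → ∑ xs (λ w → 𝟙[ far u w ] * cliques i (N u (N w xs))))
  cliqueSum-farPairs zero xs = ∑-cong xs λ _ → ∑-cong xs λ _ → sym (*-identityʳ _)
  cliqueSum-farPairs (suc i) xs = begin
    ∑ xs (λ x → cliqueSum i farPairs (N x xs))
      ≡⟨ ∑-cong xs (λ {x} _ → trans (cliqueSum-farPairs i (N x xs)) (restrict x)) ⟩
    ∑ xs (λ x → ∑ xs (λ u → ∑ xs (λ w → term x u w)))
      ≡⟨ ∑-swap xs xs _ ⟩
    ∑ xs (λ u → ∑ xs (λ x → ∑ xs (λ w → term x u w)))
      ≡⟨ ∑-cong xs (λ _ → ∑-swap xs xs _) ⟩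
    ∑ xs (λ u → ∑ xs (λ w → ∑ xs (λ x → term x u w)))
      ≡⟨ ∑-cong xs (λ {u} _ → ∑-cong xs (λ {w} _ → collect u w)) ⟩
    ∑ xs (λ u → ∑ xs (λ w → 𝟙[ far u w ] * cliques (suc i) (N u (N w xs)))) ∎
    where
    open ≡-Reasoning
    term : V → V → V → ℕ
    term x u w = 𝟙[ adj x u ] * (𝟙[ adj x w ] * (𝟙[ far u w ] * cliques i (N u (N w (N x xs)))))
    restrict : ∀ x → ∑ (N x xs) (λ u → ∑ (N x xs) (λ w → 𝟙[ far u w ] * cliques i (N u (N w (N x xs)))))
                   ≡ ∑ xs (λ u → ∑ xs (λ w → term x u w))
    restrict x = trans (∑-filter xs (adj x) _)
      (∑-cong xs λ {u} _ → trans (cong (𝟙[ adj x u ] *_) (∑-filter xs (adj x) _)) (sym (∑-*ˡ xs 𝟙[ adj x u ] _)))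
    swap : ∀ a b c e → a * (b * (c * e)) ≡ c * (b * (a * e))
    swap = solve-∀
    N³ : ∀ x u w → N u (N w (N x xs)) ≡ N x (N u (N w xs))
    N³ x u w = trans (cong (N u) (N-comm w x xs)) (N-comm u x (N w xs))
    collect : ∀ u w → ∑ xs (λ x → term x u w) ≡ 𝟙[ far u w ] * cliques (suc i) (N u (N w xs))
    collect u w = begin
      ∑ xs (λ x → term x u w)
        ≡⟨ ∑-cong xs (λ {x} _ → trans (swap 𝟙[ adj x u ] 𝟙[ adj x w ] 𝟙[ far u w ] _)
             (cong (𝟙[ far u w ] *_) (cong₂ (λ a b → 𝟙[ a ] * b) (adj-sym x w)
               (cong₂ (λ a b → 𝟙[ a ] * cliques i b) (adj-sym x u) (N³ x u w))))) ⟩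
      ∑ xs (λ x → 𝟙[ far u w ] * (𝟙[ adj w x ] * (𝟙[ adj u x ] * cliques i (N x (N u (N w xs))))))
        ≡⟨ ∑-*ˡ xs 𝟙[ far u w ] _ ⟩
      𝟙[ far u w ] * ∑ xs (λ x → 𝟙[ adj w x ] * (𝟙[ adj u x ] * cliques i (N x (N u (N w xs)))))
        ≡⟨ cong (𝟙[ far u w ] *_) (trans (∑-filter (N w xs) (adj u) _) (∑-filter xs (adj w) _)) ⟨
      𝟙[ far u w ] * cliques (suc i) (N u (N w xs)) ∎

  N-↭ : ∀ x {xs ys} → xs ↭ ys → N x xs ↭ N x ys
  N-↭ x = Perm.filter-↭ (T? ∘ adj x)

  N-self : ∀ v ys → N v (v ∷ ys) ≡ N v ys
  N-self v ys rewrite adj-irrefl v = refl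

  cliques-↭ : ∀ i {xs ys} → xs ↭ ys → cliques i xs ≡ cliques i ys
  cliques-↭ zero    p = refl
  cliques-↭ (suc i) {xs} {ys} p =
    trans (∑-↭ _ p) (∑-cong ys λ {x} _ → cliques-↭ i (N-↭ x p))

  -- In an ordered clique through `v`, the vertex `v` takes one of `suc i` positions, and the others
  -- form an ordered `i`-clique among its neighbours.
  cliques-delete : ∀ i {v xs ys} → xs ↭ v ∷ ys →
    cliques (suc i) xs ≡ cliques (suc i) ys + suc i * cliques i (N v ys)
  cliques-delete i {v} {xs} {ys} p = trans (cliques-↭ (suc i) p) (go i ys)
    where
    go : ∀ i ys → cliques (suc i) (v ∷ ys) ≡ cliques (suc i) ys + suc i * cliques i (N v ys)
    inner : ∀ i x ys → cliques (suc i) (N x (v ∷ ys)) ≡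
            cliques (suc i) (N x ys) + 𝟙[ adj v x ] * (suc i * cliques i (N x (N v ys)))
    inner i x ys rewrite adj-sym x v with adj v x
    ... | false = sym (+-identityʳ _)
    ... | true  = trans (go i (N x ys)) (cong (cliques (suc i) (N x ys) +_)
      (trans (cong (λ l → suc i * cliques i l) (N-comm v x ys)) (sym (*-identityˡ _))))
    go zero ys = +-comm 1 _
    go (suc i) ys = begin
      cliques (suc i) (N v (v ∷ ys)) + ∑ ys (λ x → cliques (suc i) (N x (v ∷ ys)))
        ≡⟨ cong₂ _+_ (cong (cliques (suc i)) (N-self v ys)) (∑-cong ys (λ {x} _ → inner i x ys)) ⟩
      B + ∑ ys (λ x → cliques (suc i) (N x ys) + 𝟙[ adj v x ] * (suc i * cliques i (N x (N v ys))))
        ≡⟨ cong (B +_) (∑-+ ys _ _) ⟩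
      B + (A + ∑ ys (λ x → 𝟙[ adj v x ] * (suc i * cliques i (N x (N v ys)))))
        ≡⟨ cong (λ z → B + (A + z)) (trans (sym (∑-filter ys (adj v) _)) (∑-*ˡ (N v ys) (suc i) _)) ⟩
      B + (A + suc i * B)
        ≡⟨ rearrange A B (suc i * B) ⟩
      A + suc (suc i) * B ∎
      where
      open ≡-Reasoning
      A = cliques (suc (suc i)) ys
      B = cliques (suc i) (N v ys)
      rearrange : ∀ a b c → b + (a + c) ≡ a + (b + c)
      rearrange = solve-∀

  CliqueBound : ℕ → Set
  CliqueBound d = ∀ c → Clique c → length c ≤ d

  module Bounded {d} (ω : CliqueBound d) where

    1≤d : V → 1 ≤ d
    1≤d v = ω (v ∷ []) ([] ∷ [])

    -- Let D be the number of vertices and suppose D > 16^(t+1) d. If at least half of the vertices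
    -- have more than D/8 nonneighbours, there are at least D²/16 far pairs. Otherwise the remaining
    -- vertices number more than D/2, hence more than d, so they are no clique and contain a far
    -- pair. Its common neighbourhood has at least D/2 vertices, and induction applies there: its
    -- far pairs already suffice, whereas a bound by 16^t d would make D too small.
    dense : ∀ t {xs} → Unique xs → Hered NoFar t xs →
            length xs ≤ 16 ^ t * d ⊎ length xs * length xs ≤ 16 ^ t * farPairs xs
    dense zero uniq nf = inj₁ (≤-trans (ω _ (NoFar⇒Clique uniq nf)) (≤-reflexive (sym (*-identityˡ d))))
    dense (suc t) {xs} uniq h with length xs ≤? 16 ^ suc t * d
    ... | yes le = inj₁ le
    ... | no  D≰ = inj₂ conclusion
      where
      open ≤-Reasoning
      D K : ℕ
      D = length xs
      K = 16 ^ t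
      1≤K : 1 ≤ K
      1≤K = >-nonZero⁻¹ K {{m^n≢0 16 t}}
      -- With threshold D/8, two such vertices exclude at most D/8 + D/8 + 2 ≤ D/2 vertices from
      -- their common neighbourhood, since D ≥ 8.
      few : V → Bool
      few u = 8 * farDeg u xs ≤ᵇ D
      L : List V
      L = filterᵇ few xs

      conclusion : D * D ≤ 16 * K * farPairs xs
      case-bad : 2 * length L ≤ D → D * D ≤ 16 * K * farPairs xs
      case-bad 2L≤D = ≤-trans (+-cancelʳ-≤ (D * D) _ _ (begin
        D * D + D * D                              ≡⟨ double (D * D) ⟩
        2 * (D * D)                                ≤⟨ *-monoʳ-≤ 2 summed ⟩
        2 * (8 * farPairs xs + D * length L)       ≡⟨ regroup (farPairs xs) D (length L) ⟩
        16 * farPairs xs + D * (2 * length L)      ≤⟨ +-monoʳ-≤ _ (*-monoʳ-≤ D 2L≤D) ⟩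
        16 * farPairs xs + D * D                   ∎))
        (*-monoˡ-≤ (farPairs xs) (*-monoʳ-≤ 16 1≤K))
        where
        double : ∀ x → x + x ≡ 2 * x
        double = solve-∀
        regroup : ∀ f D l → 2 * (8 * f + D * l) ≡ 16 * f + D * (2 * l)
        regroup = solve-∀
        pointwise : ∀ u → D ≤ 8 * farDeg u xs + D * 𝟙[ few u ]
        pointwise u with few u in eq
        ... | true  = ≤-trans (≤-reflexive (sym (*-identityʳ D))) (m≤n+m _ _)
        ... | false = ≤-trans (<⇒≤ (≰⇒> λ le → subst T eq (≤⇒≤ᵇ {8 * farDeg u xs} le))) (m≤m+n _ _)
        summed : D * D ≤ 8 * farPairs xs + D * length L
        summed = begin
          D * D                                           ≡⟨ ∑-const xs D ⟨
          ∑ xs (λ _ → D)                                  ≤⟨ ∑-mono xs (λ {u} _ → pointwise u) ⟩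
          ∑ xs (λ u → 8 * farDeg u xs + D * 𝟙[ few u ])    ≡⟨ ∑-+ xs _ _ ⟩
          ∑ xs (λ u → 8 * farDeg u xs) + ∑ xs (λ u → D * 𝟙[ few u ])
            ≡⟨ cong₂ _+_ (∑-*ˡ xs 8 _) (trans (∑-*ˡ xs D _) (cong (D *_) (sym (length-filter-∑ xs few)))) ⟩
          8 * farPairs xs + D * length L                  ∎

      case-pair : ∀ {u w} → u ∈ L → w ∈ L → T (far u w) → D * D ≤ 16 * K * farPairs xs
      case-pair {u} {w} u∈L w∈L f = fin
        where
        u∈ = ∈-filterᵇ⁻ few xs u∈L
        w∈ = ∈-filterᵇ⁻ few xs w∈L
        M = length (N u (N w xs))
        8≤D : 8 ≤ D
        8≤D = ≤-trans (≤-trans (s≤s (s≤s (s≤s (s≤s (s≤s (s≤s (s≤s (s≤s z≤n))))))))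
          (*-mono-≤ (*-monoʳ-≤ 16 1≤K) (1≤d u))) (<⇒≤ (≰⇒> D≰))
        regroup : ∀ M a b → 8 * (M + (a + 1) + (b + 1)) ≡ 8 * M + 8 * a + 8 * b + 2 * 8
        regroup = solve-∀
        regroup′ : ∀ M D → 8 * M + D + D + 2 * D ≡ 4 * (2 * M) + 4 * D
        regroup′ = solve-∀
        split : ∀ D → 4 * D + 4 * D ≡ 8 * D
        split = solve-∀
        D≤2M : D ≤ 2 * M
        D≤2M = *-cancelˡ-≤ 4 (+-cancelʳ-≤ (4 * D) _ _ (begin
          4 * D + 4 * D                                     ≡⟨ split D ⟩
          8 * D                                             ≤⟨ *-monoʳ-≤ 8 (common-nbrs u w uniq) ⟩
          8 * (M + (farDeg u xs + 1) + (farDeg w xs + 1))   ≡⟨ regroup M _ _ ⟩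
          8 * M + 8 * farDeg u xs + 8 * farDeg w xs + 2 * 8
            ≤⟨ +-mono-≤ (+-mono-≤ (+-monoʳ-≤ (8 * M) (≤ᵇ⇒≤ (8 * farDeg u xs) D (proj₂ u∈))) (≤ᵇ⇒≤ (8 * farDeg w xs) D (proj₂ w∈)))
                        (*-monoʳ-≤ 2 8≤D) ⟩
          8 * M + D + D + 2 * D                             ≡⟨ regroup′ M D ⟩
          4 * (2 * M) + 4 * D                               ∎))
        2≤16 : 2 ≤ 16
        2≤16 = s≤s (s≤s z≤n)
        4≤16 : 4 ≤ 16
        4≤16 = s≤s (s≤s (s≤s (s≤s z≤n)))
        sq : ∀ M → 2 * M * (2 * M) ≡ 4 * (M * M)
        sq = solve-∀
        fin : D * D ≤ 16 * K * farPairs xs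
        fin with dense t (N-unique u (N-unique w uniq)) (h (proj₁ u∈) (proj₁ w∈) f)
        ... | inj₁ M≤ = contradiction (begin
          D                ≤⟨ D≤2M ⟩
          2 * M            ≤⟨ *-mono-≤ 2≤16 M≤ ⟩
          16 * (K * d)     ≡⟨ *-assoc 16 K d ⟨
          16 * K * d       ∎) D≰
        ... | inj₂ M²≤ = begin
          D * D                        ≤⟨ *-mono-≤ D≤2M D≤2M ⟩
          2 * M * (2 * M)              ≡⟨ sq M ⟩
          4 * (M * M)                  ≤⟨ *-mono-≤ 4≤16 (≤-trans M²≤ (*-monoʳ-≤ K
                                            (≤-trans (farPairs-N u (N w xs)) (farPairs-N w xs)))) ⟩
          16 * (K * farPairs xs)       ≡⟨ *-assoc 16 K _ ⟨
          16 * K * farPairs xs         ∎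

      conclusion with 2 * length L ≤? D
      ... | yes 2L≤D = case-bad 2L≤D
      ... | no  2L≰D with noFar? L
      ...   | inj₁ (u , w , u∈ , w∈ , f) = case-pair u∈ w∈ f
      ...   | inj₂ nf = contradiction (begin
        2 * length L    ≤⟨ *-monoʳ-≤ 2 (ω L (NoFar⇒Clique (Unique.filter⁺ (T? ∘ few) uniq) nf)) ⟩
        2 * d           ≤⟨ *-monoˡ-≤ d (*-mono-≤ {2} {16} (s≤s (s≤s z≤n)) 1≤K) ⟩
        16 * K * d      ≤⟨ <⇒≤ (≰⇒> D≰) ⟩
        D               ∎) 2L≰D

    -- Cauchy–Schwarz over the ordered i-cliques σ: the sum of deg(σ)² counts the
    -- pairs u, w in the link of σ, and by density the pairs with u, w nonadjacent
    -- are a positive proportion unless deg(σ) = O(d).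
    cliques-step : ∀ t i {xs} B → Unique xs → Hered NoFar t xs →
      (∀ {u w} → u ∈ xs → w ∈ xs → T (far u w) → cliques i (N u (N w xs)) ≤ B) →
      cliques (suc i) xs * cliques (suc i) xs ≤
      16 ^ t * 16 ^ t * (cliques i xs * (d * d * cliques i xs + length xs * length xs * B))
    cliques-step t i {xs} B uniq h bound = begin
      x * x                                                 ≡⟨ cong₂ _*_ (cliques-suc i xs) (cliques-suc i xs) ⟩
      cliqueSum i length xs * cliqueSum i length xs         ≤⟨ cliqueSum-cauchy-schwarz i length xs ⟩
      y * cliqueSum i (λ ys → length ys * length ys) xs     ≤⟨ *-monoʳ-≤ y squares ⟩
      y * (Q * (d * d * y + length xs * length xs * B))     ≡⟨ regroup y Q _ ⟩
      Q * (y * (d * d * y + length xs * length xs * B))     ∎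
      where
      open ≤-Reasoning
      x = cliques (suc i) xs
      y = cliques i xs
      K = 16 ^ t
      Q = K * K
      regroup : ∀ a b c → a * (b * c) ≡ b * (a * c)
      regroup = solve-∀
      P : List V → Set
      P ys = Unique ys × Hered NoFar t ys
      closed : ∀ x {ys} → P ys → P (N x ys)
      closed x {ys} (u , g) = N-unique x u , Hered-⊑ NoFar-⊑ t (N-⊑ x ys) g
      -- One bound for both alternatives of `dense`. The factor 1 is the summand of `cliques i`, so
      -- summing over cliques gives `d * d * y`.
      pointwise : ∀ {ys} → P ys → length ys * length ys ≤ Q * (d * d * 1 + farPairs ys)
      pointwise {ys} (u , g) with dense t u g
      ... | inj₁ le = begin
        length ys * length ys        ≤⟨ *-mono-≤ le le ⟩
        K * d * (K * d)              ≡⟨ sq K d ⟩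
        Q * (d * d * 1)              ≤⟨ *-monoʳ-≤ Q (m≤m+n _ _) ⟩
        Q * (d * d * 1 + farPairs ys) ∎
        where
        sq : ∀ K d → K * d * (K * d) ≡ K * K * (d * d * 1)
        sq = solve-∀
      ... | inj₂ le = begin
        length ys * length ys        ≤⟨ le ⟩
        K * farPairs ys              ≤⟨ *-mono-≤ (≤-trans (≤-reflexive (sym (*-identityˡ K))) (*-monoˡ-≤ K 1≤K)) (m≤n+m _ _) ⟩
        Q * (d * d * 1 + farPairs ys) ∎
        where
        1≤K : 1 ≤ K
        1≤K = >-nonZero⁻¹ K {{m^n≢0 16 t}}
      pairs : cliqueSum i farPairs xs ≤ length xs * length xs * B
      pairs = begin
        cliqueSum i farPairs xs                                                    ≡⟨ cliqueSum-farPairs i xs ⟩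
        ∑ xs (λ u → ∑ xs (λ w → 𝟙[ far u w ] * cliques i (N u (N w xs))))           ≤⟨ ∑-mono xs (λ u∈ → ∑-mono xs (λ w∈ → le u∈ w∈)) ⟩
        ∑ xs (λ u → ∑ xs (λ w → B))                                                ≡⟨ ∑-cong xs (λ _ → ∑-const xs B) ⟩
        ∑ xs (λ u → length xs * B)                                                 ≡⟨ ∑-const xs _ ⟩
        length xs * (length xs * B)                                                ≡⟨ *-assoc (length xs) _ B ⟨
        length xs * length xs * B                                                  ∎
        where
        le : ∀ {u w} → u ∈ xs → w ∈ xs → 𝟙[ far u w ] * cliques i (N u (N w xs)) ≤ B
        le {u} {w} u∈ w∈ with far u w in eq
        ... | false = z≤n
        ... | true  = ≤-trans (≤-reflexive (*-identityˡ _)) (bound u∈ w∈ (subst T (sym eq) _))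
      squares : cliqueSum i (λ ys → length ys * length ys) xs ≤ Q * (d * d * y + length xs * length xs * B)
      squares = begin
        cliqueSum i (λ ys → length ys * length ys) xs               ≤⟨ cliqueSum-mono P closed pointwise i (uniq , h) ⟩
        cliqueSum i (λ ys → Q * (d * d * 1 + farPairs ys)) xs       ≡⟨ cliqueSum-*ˡ i Q _ xs ⟩
        Q * cliqueSum i (λ ys → d * d * 1 + farPairs ys) xs         ≡⟨ cong (Q *_) (cliqueSum-+ i _ _ xs) ⟩
        Q * (cliqueSum i (λ ys → d * d * 1) xs + cliqueSum i farPairs xs)
          ≤⟨ *-monoʳ-≤ Q (+-mono-≤ (≤-reflexive (cliqueSum-*ˡ i (d * d) _ xs)) pairs) ⟩
        Q * (d * d * y + length xs * length xs * B)                 ∎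

-- Induced paths and cycles

module Paths (G : Graph) where

  open Cliques G

  Far : V → V → Set
  Far x z = T (far x z)

  InducedPath : List V → Set
  InducedPath []           = ⊤
  InducedPath (x ∷ [])     = ⊤
  InducedPath (x ∷ y ∷ zs) = T (adj x y) × All (Far x) zs × InducedPath (y ∷ zs)

  LocallyInduced : List V → Set
  LocallyInduced []               = ⊤
  LocallyInduced (x ∷ [])         = ⊤
  LocallyInduced (x ∷ y ∷ [])     = T (adj x y)
  LocallyInduced (x ∷ y ∷ z ∷ zs) = T (adj x y) × Far x z × LocallyInduced (y ∷ z ∷ zs)

  -- The cycle `x`, `ps`, `z` is cut at its closing edge. The two induced paths overlap in `ps` and
  -- so fix the adjacency of every pair except `x`, `z`.
  NoInducedCycle : ℕ → List V → Set
  NoInducedCycle r xs = ∀ x ps z → All (_∈ xs) (x ∷ ps ∷ʳ z) → 2 ≤ length ps → length ps + 2 ≤ 2 * r →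
    InducedPath (x ∷ ps) → InducedPath (ps ∷ʳ z) → ¬ T (adj x z)

  NoInducedCycle-⊑ : ∀ r {xs ys} → ys ⊑ xs → NoInducedCycle r xs → NoInducedCycle r ys
  NoInducedCycle-⊑ r sub nc x ps z all = nc x ps z (All.map sub all)

  InducedPath-prefix : ∀ ps {qs} → InducedPath (ps ++ qs) → InducedPath ps
  InducedPath-prefix []           _             = tt
  InducedPath-prefix (x ∷ [])     _             = tt
  InducedPath-prefix (x ∷ y ∷ ps) (a , far , p) = a , All.++⁻ˡ ps far , InducedPath-prefix (y ∷ ps) p

  InducedPath-pred : ∀ p ps {w qs} → InducedPath (p ∷ ps ++ w ∷ qs) → ∃[ l ] (l ∈ p ∷ ps × T (adj l w))
  InducedPath-pred p []       (a , _)     = p , here refl , a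
  InducedPath-pred p (q ∷ ps) (_ , _ , i) with l , l∈ , a ← InducedPath-pred q ps i = l , there l∈ , a

  LocallyInduced-tail : ∀ x ps → LocallyInduced (x ∷ ps) → LocallyInduced ps
  LocallyInduced-tail x []           _           = tt
  LocallyInduced-tail x (y ∷ [])     _           = tt
  LocallyInduced-tail x (y ∷ z ∷ ps) (_ , _ , l) = l

  LocallyInduced-adj : ∀ x y ps → LocallyInduced (x ∷ y ∷ ps) → T (adj x y)
  LocallyInduced-adj x y []      a       = a
  LocallyInduced-adj x y (_ ∷ _) (a , _) = a

  LocallyInduced-prefix : ∀ ps {qs} → LocallyInduced (ps ++ qs) → LocallyInduced ps
  LocallyInduced-prefix []               _           = tt
  LocallyInduced-prefix (x ∷ [])         _           = tt
  LocallyInduced-prefix (x ∷ y ∷ []) {qs} l          = LocallyInduced-adj x y qs l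
  LocallyInduced-prefix (x ∷ y ∷ z ∷ ps) (a , f , l) = a , f , LocallyInduced-prefix (y ∷ z ∷ ps) l

  LocallyInduced-pred : ∀ p ps {w} → LocallyInduced (p ∷ ps ∷ʳ w) → ∃[ l ] (l ∈ p ∷ ps × T (adj l w))
  LocallyInduced-pred p []       a = p , here refl , a
  LocallyInduced-pred p (q ∷ ps) i with l , l∈ , a ← LocallyInduced-pred q ps (LocallyInduced-tail p (q ∷ ps ∷ʳ _) i) =
    l , there l∈ , a

  LocallyInduced-ʳ++ : ∀ a b as bs → LocallyInduced (b ∷ a ∷ as) → LocallyInduced (a ∷ b ∷ bs) →
                       LocallyInduced (as ʳ++ (a ∷ b ∷ bs))
  LocallyInduced-ʳ++ a b []       bs l r           = r
  LocallyInduced-ʳ++ a b (c ∷ as) bs (_ , f , l) r =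
    LocallyInduced-ʳ++ c a as (b ∷ bs) l (Tadj-sym (LocallyInduced-adj a c as l) , Tfar-sym f , r)

  -- A first chord or repetition in a locally induced walk closes an induced cycle.
  local⇒induced : ∀ r {xs} → NoInducedCycle r xs → ∀ ws → All (_∈ xs) ws → length ws ≤ 2 * r →
                  LocallyInduced ws → InducedPath ws
  local⇒induced r nc []           _ _ _ = tt
  local⇒induced r nc (x ∷ [])     _ _ _ = tt
  local⇒induced r nc (x ∷ y ∷ []) _ _ a = a , [] , tt
  local⇒induced r {xs} nc (x ∷ y ∷ z ∷ ws) (x∈ ∷ ws∈) len (x~y , x≁z , l) =
    x~y , x≁z ∷ scan z [] ws (x≁z ∷ []) ws∈ len path , path
    where
    path : InducedPath (y ∷ z ∷ ws)
    path = local⇒induced r nc (y ∷ z ∷ ws) ws∈ (<⇒≤ len) l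
    scan : ∀ p ps rest → All (Far x) (p ∷ ps) → All (_∈ xs) (y ∷ p ∷ ps ++ rest) →
           3 + length (ps ++ rest) ≤ 2 * r → InducedPath (y ∷ p ∷ ps ++ rest) → All (Far x) rest
    scan p ps []         _   _  _   _ = []
    scan p ps (w ∷ rest) x≁ps in-xs len path with trichotomy x w
    -- The predecessor of `w` on the path is far from `x`, so `w` cannot be `x`.
    ... | inj₁ refl = contradiction (Tadj-sym (proj₂ (proj₂ q))) (far⇒¬adj (All.lookup x≁ps (proj₁ (proj₂ q))))
      where q = InducedPath-pred p ps (proj₂ (proj₂ path))
    ... | inj₂ (inj₂ x≁w) = x≁w ∷ scan p (ps ∷ʳ w) rest (All.++⁺ x≁ps (x≁w ∷ []))
      (subst (λ l → All (_∈ xs) (y ∷ p ∷ l)) assoc in-xs)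
      (subst (λ l → 3 + length l ≤ 2 * r) assoc len)
      (subst (λ l → InducedPath (y ∷ p ∷ l)) assoc path)
      where
      assoc : ps ++ w ∷ rest ≡ (ps ∷ʳ w) ++ rest
      assoc = sym (++-assoc ps (w ∷ []) rest)
    ... | inj₂ (inj₁ x~w) = contradiction x~w
      (nc x (y ∷ p ∷ ps) w (x∈ ∷ All.++⁻ˡ (y ∷ p ∷ ps ∷ʳ w) (subst (λ l → All (_∈ xs) (y ∷ p ∷ l)) assoc in-xs))
          (s≤s (s≤s z≤n)) short
          (x~y , x≁ps , InducedPath-prefix (y ∷ p ∷ ps) path)
          (InducedPath-prefix (y ∷ p ∷ ps ∷ʳ w) (subst (λ l → InducedPath (y ∷ p ∷ l)) assoc path)))
      where
      assoc : ps ++ w ∷ rest ≡ (ps ∷ʳ w) ++ rest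
      assoc = sym (++-assoc ps (w ∷ []) rest)
      arith : ∀ a b → 2 + a + 2 + b ≡ 3 + (a + suc b)
      arith = solve-∀
      short : 2 + length ps + 2 ≤ 2 * r
      short = ≤-trans (≤-trans (m≤m+n _ (length rest)) (≤-reflexive (trans (arith (length ps) (length rest))
        (cong (3 +_) (sym (length-++ ps)))))) len

  -- Without its last vertex the walk is an induced path by `local⇒induced`, so `y` is far from all
  -- of `ws` but the first vertex; yet the last vertex of `ws` is adjacent to `y`. No condition is
  -- imposed at the point `y` where the walk closes.
  no-closed-walk : ∀ r {xs} → NoInducedCycle r xs → ∀ y ws → All (_∈ xs) (y ∷ ws) → 2 ≤ length ws →
                   suc (length ws) ≤ 2 * r → ¬ LocallyInduced (y ∷ ws ∷ʳ y)
  no-closed-walk r nc y (a ∷ [])     _   (s≤s ())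
  no-closed-walk r nc y (a ∷ b ∷ ws) all _ len l
    with _ , y≁ , _ ← local⇒induced r nc (y ∷ a ∷ b ∷ ws) all len (LocallyInduced-prefix (y ∷ a ∷ b ∷ ws) l)
    with p , p∈ , p~y ← LocallyInduced-pred b ws (LocallyInduced-tail a (b ∷ ws ∷ʳ y) (LocallyInduced-tail y (a ∷ b ∷ ws ∷ʳ y) l)) =
    far⇒¬adj (All.lookup y≁ p∈) (Tadj-sym p~y)

  -- In an induced 4-cycle u a w b the pairs {u, w} and {a, b} are nonadjacent.
  NoInducedCycle⇒Hered : ∀ r {xs} → 2 ≤ r → NoInducedCycle r xs → Hered NoFar 1 xs
  NoInducedCycle⇒Hered r {xs} 2≤r nc {u} {w} u∈ w∈ u≁w {a} {b} a∈ b∈ a≁b =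
    nc u (a ∷ w ∷ []) b (u∈ ∷ proj₁ a∈′ ∷ w∈ ∷ proj₁ b∈′ ∷ []) ≤-refl (*-monoʳ-≤ 2 2≤r)
      (proj₂ (proj₂ a∈′) , u≁w ∷ [] , Tadj-sym (proj₁ (proj₂ a∈′)) , [] , tt)
      (Tadj-sym (proj₁ (proj₂ a∈′)) , a≁b ∷ [] , proj₁ (proj₂ b∈′) , [] , tt)
      (proj₂ (proj₂ b∈′))
    where
    split : ∀ {x} → x ∈ N u (N w xs) → x ∈ xs × T (adj w x) × T (adj u x)
    split x∈ with x∈′ , u~x ← ∈N⁻ u (N w xs) x∈ with x∈″ , w~x ← ∈N⁻ w xs x∈′ = x∈″ , w~x , u~x
    a∈′ = split a∈
    b∈′ = split b∈

  -- The number of locally induced walks with first edge (v, u), t + 1 edges and endpoint y.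
  walks : List V → ℕ → V → V → V → ℕ
  walks xs zero    v u y = 𝟙[ adj v u ] * 𝟙[ eqᵇ u y ]
  walks xs (suc t) w v y = 𝟙[ adj w v ] * ∑ xs (λ u → 𝟙[ far w u ] * walks xs t v u y)

  *-positive : ∀ m {n} → 0 < m * n → 0 < m × 0 < n
  *-positive zero ()
  *-positive (suc m) {zero}  p rewrite *-zeroʳ m with () ← p
  *-positive (suc m) {suc n} p = s≤s z≤n , s≤s z≤n

  𝟙-positive : ∀ {b} → 0 < 𝟙[ b ] → T b
  𝟙-positive {true} _ = tt

  ∑-positive : ∀ (xs : List V) {f} → 0 < ∑ xs f → ∃[ x ] (x ∈ xs × 0 < f x)
  ∑-positive (x ∷ xs) {f} p with f x in eq
  ... | suc _ = x , here refl , subst (0 <_) (sym eq) (s≤s z≤n)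
  ... | zero with y , y∈ , q ← ∑-positive xs p = y , there y∈ , q

  eqᵇ⇒≡ : ∀ {u y} → T (eqᵇ u y) → u ≡ y
  eqᵇ⇒≡ {u} {y} e with u ≟ y
  ... | yes u≡y = u≡y

  walk-witness : ∀ xs t {w v y} → 0 < walks xs (suc t) w v y →
                 ∃[ ws ] (length ws ≡ t × All (_∈ xs) ws × LocallyInduced (w ∷ v ∷ ws ∷ʳ y))
  walk-witness xs t {w} {v} {y} p
    with w~v , q ← *-positive 𝟙[ adj w v ] p
    with u , u∈ , s ← ∑-positive xs q
    with w≁u , c ← *-positive 𝟙[ far w u ] s
    = extend t c
    where
    extend : ∀ t → 0 < walks xs t v u y →
             ∃[ ws ] (length ws ≡ t × All (_∈ xs) ws × LocallyInduced (w ∷ v ∷ ws ∷ʳ y))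
    extend zero c with v~u , e ← *-positive 𝟙[ adj v u ] c with refl ← eqᵇ⇒≡ (𝟙-positive e) =
      [] , refl , [] , 𝟙-positive w~v , 𝟙-positive w≁u , 𝟙-positive v~u
    extend (suc t) c with ws , len , all , l ← walk-witness xs t c =
      u ∷ ws , cong suc len , u∈ ∷ all , 𝟙-positive w~v , 𝟙-positive w≁u , l

  -- Reversing the walk through `v` and continuing with the one through `v′` gives a closed walk
  -- from `y` with 2(t + 2) ≤ 2r edges. It is locally induced at `w` exactly because `v` and `v′`
  -- are far, so `no-closed-walk` excludes it.
  first-steps-NoFar : ∀ {r xs} → NoInducedCycle r xs → ∀ t → 2 + t ≤ r → ∀ {w y} → w ∈ xs → y ∈ xs →
                      NoFar (filterᵇ (λ v → 0 <ᵇ walks xs (suc t) w v y) xs)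
  first-steps-NoFar {r} {xs} nc t le {w} {y} w∈ y∈ {v} {v′} v∈X v′∈X v≁v′
    with v∈ , pos ← ∈-filterᵇ⁻ (λ v → 0 <ᵇ walks xs (suc t) w v y) xs v∈X
    with v′∈ , pos′ ← ∈-filterᵇ⁻ (λ v → 0 <ᵇ walks xs (suc t) w v y) xs v′∈X
    with ws , len , all , l ← walk-witness xs t (<ᵇ⇒< 0 (walks xs (suc t) w v y) pos)
    with ws′ , len′ , all′ , l′ ← walk-witness xs t (<ᵇ⇒< 0 (walks xs (suc t) w v′ y) pos′) =
    no-closed-walk r nc y mid (y∈ ∷ ʳ++-all all (v∈ ∷ w∈ ∷ v′∈ ∷ all′))
      (≤-trans (≤-trans (m≤n+m 2 (t + suc t)) (≤-reflexive (arith₁ t))) (≤-reflexive (sym mid-length)))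
      (≤-trans (≤-reflexive (trans (cong suc mid-length) (arith₂ t))) (*-monoʳ-≤ 2 le))
      (subst LocallyInduced shape
        (LocallyInduced-ʳ++ v w (ws ∷ʳ y) (v′ ∷ ws′ ∷ʳ y) l
          (Tadj-sym (LocallyInduced-adj w v (ws ∷ʳ y) l) , v≁v′ , l′)))
    where
    ʳ++-all : ∀ {as bs} → All (_∈ xs) as → All (_∈ xs) bs → All (_∈ xs) (as ʳ++ bs)
    ʳ++-all []        bs∈ = bs∈
    ʳ++-all (a∈ ∷ as∈) bs∈ = ʳ++-all as∈ (a∈ ∷ bs∈)
    mid : List V
    mid = ws ʳ++ (v ∷ w ∷ v′ ∷ ws′)
    arith₁ : ∀ t → t + suc t + 2 ≡ t + (3 + t)
    arith₁ = solve-∀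
    arith₂ : ∀ t → suc (t + (3 + t)) ≡ 2 * (2 + t)
    arith₂ = solve-∀
    mid-length : length mid ≡ t + (3 + t)
    mid-length = trans (length-ʳ++ ws) (cong₂ (λ a b → a + (3 + b)) len len′)
    ʳ++-∷ʳ : ∀ (as bs cs : List V) → as ʳ++ (bs ++ cs) ≡ (as ʳ++ bs) ++ cs
    ʳ++-∷ʳ []       bs cs = refl
    ʳ++-∷ʳ (a ∷ as) bs cs = ʳ++-∷ʳ as (a ∷ bs) cs
    ∷ʳ-ʳ++ : ∀ (as bs : List V) → (as ∷ʳ y) ʳ++ bs ≡ y ∷ (as ʳ++ bs)
    ∷ʳ-ʳ++ []       bs = refl
    ∷ʳ-ʳ++ (a ∷ as) bs = ∷ʳ-ʳ++ as (a ∷ bs)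
    shape : (ws ∷ʳ y) ʳ++ (v ∷ w ∷ v′ ∷ ws′ ∷ʳ y) ≡ y ∷ mid ∷ʳ y
    shape = trans (∷ʳ-ʳ++ ws _) (cong (y ∷_) (ʳ++-∷ʳ ws (v ∷ w ∷ v′ ∷ ws′) (y ∷ [])))

  -- Each step but the last has at most `d` choices, since the possible ones form a clique; the last
  -- step has to land on `y`.
  walks≤ : ∀ {d} → CliqueBound d → ∀ {r xs} → Unique xs → NoInducedCycle r xs →
           ∀ t → suc t ≤ r → ∀ {v y} → v ∈ xs → y ∈ xs → ∑ xs (λ u → walks xs t v u y) ≤ d ^ t
  walks≤ ω {r} {xs} uniq nc zero le {v} {y} v∈ y∈ = ≤-trans (∑-mono xs λ {u} _ → begin
    𝟙[ adj v u ] * 𝟙[ eqᵇ u y ]   ≤⟨ *-monoˡ-≤ 𝟙[ eqᵇ u y ] (𝟙≤1 (adj v u)) ⟩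
    1 * 𝟙[ eqᵇ u y ]             ≡⟨ *-identityˡ _ ⟩
    𝟙[ eqᵇ u y ]                 ≡⟨ cong 𝟙[_] (eqᵇ-sym u y) ⟩
    𝟙[ eqᵇ y u ]                 ∎) (∑-eq≤1 y uniq)
    where
    open ≤-Reasoning
  walks≤ {d} ω {r} {xs} uniq nc (suc t) le {w} {y} w∈ y∈ = begin
    ∑ xs (λ v → walks xs (suc t) w v y)                   ≤⟨ ∑-mono xs (λ {v} v∈ → step v∈) ⟩
    ∑ xs (λ v → 𝟙[ first v ] * d ^ t)                      ≡⟨ ∑-*ʳ xs (d ^ t) _ ⟩
    ∑ xs (λ v → 𝟙[ first v ]) * d ^ t                      ≡⟨ cong (_* d ^ t) (length-filter-∑ xs first) ⟨
    length (filterᵇ first xs) * d ^ t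
      ≤⟨ *-monoˡ-≤ (d ^ t) (ω _ (NoFar⇒Clique (Unique.filter⁺ (T? ∘ first) uniq) (first-steps-NoFar nc t le w∈ y∈))) ⟩
    d * d ^ t ∎
    where
    open ≤-Reasoning
    first : V → Bool
    first v = 0 <ᵇ walks xs (suc t) w v y
    step : ∀ {v} → v ∈ xs → walks xs (suc t) w v y ≤ 𝟙[ first v ] * d ^ t
    step {v} v∈ with walks xs (suc t) w v y in eq
    ... | zero  = z≤n
    ... | suc k = begin
      suc k                                                            ≡⟨ eq ⟨
      𝟙[ adj w v ] * ∑ xs (λ u → 𝟙[ far w u ] * walks xs t v u y)        ≤⟨ *-mono-≤ (𝟙≤1 (adj w v)) (∑-mono xs λ {u} _ → *-monoˡ-≤ _ (𝟙≤1 (far w u))) ⟩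
      1 * ∑ xs (λ u → 1 * walks xs t v u y)                            ≡⟨ trans (*-identityˡ _) (∑-cong xs λ _ → *-identityˡ _) ⟩
      ∑ xs (λ u → walks xs t v u y)                                    ≤⟨ walks≤ ω uniq nc t (<⇒≤ le) v∈ y∈ ⟩
      d ^ t                                                            ≡⟨ *-identityˡ _ ⟨
      1 * d ^ t                                                        ∎

-- Weighted walks and a Moore-type bound on the minimum degree

module Moore (G : Graph) where

  open Cliques G
  open Paths G

  deg-∑ : ∀ v xs → length (N v xs) ≡ ∑ xs (λ x → 𝟙[ adj v x ])
  deg-∑ v xs = length-filter-∑ xs (adj v)

  -- As walks, but summed over all endpoints, a walk having weight ∏ wt(x) over its inner vertices x.
  weighted : (V → ℕ) → List V → ℕ → V → V → ℕ
  weighted wt xs zero    v u = 𝟙[ adj v u ]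
  weighted wt xs (suc t) w v = 𝟙[ adj w v ] * ∑ xs (λ u → 𝟙[ far w u ] * (wt v * weighted wt xs t v u))

  -- Weighting a walk by the inverse degrees of its inner vertices makes the
  -- uniform distribution on edges stationary, so that a union bound shows most
  -- of the walks to be locally induced.  The common factor P clears denominators.
  module Weights {xs : List V} (wt : V → ℕ) (P : ℕ)
                 (wt-deg : ∀ {v} → v ∈ xs → wt v * length (N v xs) ≡ P) where

    open ≤-Reasoning

    private
      F : ℕ → V → V → ℕ
      F = weighted wt xs

      total : ℕ → ℕ
      total t = ∑ xs λ v → ∑ xs λ u → F t v u

    -- After the far conditions are dropped, each inner vertex contributes its weight times its
    -- degree, that is `P`.
    weighted≤ : ∀ t {w v} → v ∈ xs → F t w v ≤ P ^ t * 𝟙[ adj w v ]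
    weighted≤ zero    v∈ = ≤-reflexive (sym (*-identityˡ _))
    weighted≤ (suc t) {w} {v} v∈ = begin
      𝟙[ adj w v ] * ∑ xs (λ u → 𝟙[ far w u ] * (wt v * F t v u))
        ≤⟨ *-monoʳ-≤ 𝟙[ adj w v ] (∑-mono xs λ {u} u∈ → *-mono-≤ (𝟙≤1 (far w u)) (*-monoʳ-≤ (wt v) (weighted≤ t u∈))) ⟩
      𝟙[ adj w v ] * ∑ xs (λ u → 1 * (wt v * (P ^ t * 𝟙[ adj v u ])))
        ≡⟨ cong (𝟙[ adj w v ] *_) (∑-cong xs λ _ → assoc (wt v) (P ^ t) _) ⟩
      𝟙[ adj w v ] * ∑ xs (λ u → wt v * P ^ t * 𝟙[ adj v u ])
        ≡⟨ cong (𝟙[ adj w v ] *_) (trans (∑-*ˡ xs (wt v * P ^ t) _) (cong (wt v * P ^ t *_) (sym (deg-∑ v xs)))) ⟩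
      𝟙[ adj w v ] * (wt v * P ^ t * length (N v xs))
        ≡⟨ regroup 𝟙[ adj w v ] (wt v) (P ^ t) _ ⟩
      wt v * length (N v xs) * P ^ t * 𝟙[ adj w v ]
        ≡⟨ cong (λ p → p * P ^ t * 𝟙[ adj w v ]) (wt-deg v∈) ⟩
      P * P ^ t * 𝟙[ adj w v ] ∎
      where
      assoc : ∀ a b c → 1 * (a * (b * c)) ≡ a * b * c
      assoc = solve-∀
      regroup : ∀ a b c e → a * (b * c * e) ≡ b * e * c * a
      regroup = solve-∀

    -- Each of the `t` inner vertices has weight at most P/Δ, which compares the weighted count with
    -- the plain one.
    weighted*Δ≤ : ∀ Δ → (∀ {v} → v ∈ xs → wt v * Δ ≤ P) → ∀ t {w v} → v ∈ xs →
                  F t w v * Δ ^ t ≤ P ^ t * ∑ xs (λ y → walks xs t w v y)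
    weighted*Δ≤ Δ wtΔ zero {w} {v} v∈ = begin
      𝟙[ adj w v ] * 1                                  ≤⟨ *-monoʳ-≤ 𝟙[ adj w v ] (hit v∈) ⟩
      𝟙[ adj w v ] * ∑ xs (λ y → 𝟙[ eqᵇ v y ])           ≡⟨ trans (sym (∑-*ˡ xs 𝟙[ adj w v ] _)) (sym (*-identityˡ _)) ⟩
      1 * ∑ xs (λ y → 𝟙[ adj w v ] * 𝟙[ eqᵇ v y ])       ∎
      where
      hit : ∀ {ys} → v ∈ ys → 1 ≤ ∑ ys (λ y → 𝟙[ eqᵇ v y ])
      hit {y ∷ ys} (here refl) with v ≟ v
      ... | yes _  = s≤s z≤n
      ... | no v≢v = contradiction refl v≢v
      hit {y ∷ ys} (there v∈) = ≤-trans (hit v∈) (m≤n+m _ _)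
    weighted*Δ≤ Δ wtΔ (suc t) {w} {v} v∈ = begin
      𝟙[ adj w v ] * ∑ xs (λ u → 𝟙[ far w u ] * (wt v * F t v u)) * (Δ * Δ ^ t)
        ≡⟨ trans (*-assoc 𝟙[ adj w v ] _ _) (cong (𝟙[ adj w v ] *_) (sym (∑-*ʳ xs _ _))) ⟩
      𝟙[ adj w v ] * ∑ xs (λ u → 𝟙[ far w u ] * (wt v * F t v u) * (Δ * Δ ^ t))
        ≤⟨ *-monoʳ-≤ 𝟙[ adj w v ] (∑-mono xs λ {u} u∈ → pointwise u∈) ⟩
      𝟙[ adj w v ] * ∑ xs (λ u → P * P ^ t * ∑ xs (λ y → 𝟙[ far w u ] * walks xs t v u y))
        ≡⟨ cong (𝟙[ adj w v ] *_) (trans (∑-*ˡ xs (P * P ^ t) _) (cong (P * P ^ t *_) (∑-swap xs xs _))) ⟩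
      𝟙[ adj w v ] * (P * P ^ t * ∑ xs (λ y → ∑ xs (λ u → 𝟙[ far w u ] * walks xs t v u y)))
        ≡⟨ regroup 𝟙[ adj w v ] (P * P ^ t) _ ⟩
      P * P ^ t * (𝟙[ adj w v ] * ∑ xs (λ y → ∑ xs (λ u → 𝟙[ far w u ] * walks xs t v u y)))
        ≡⟨ cong (P * P ^ t *_) (∑-*ˡ xs 𝟙[ adj w v ] _) ⟨
      P * P ^ t * ∑ xs (λ y → walks xs (suc t) w v y) ∎
      where
      regroup : ∀ a b c → a * (b * c) ≡ b * (a * c)
      regroup = solve-∀
      regroup₁ : ∀ a b c e g → a * (b * c) * (e * g) ≡ b * e * (a * (c * g))
      regroup₁ = solve-∀
      regroup₂ : ∀ a b c e → a * (b * (c * e)) ≡ a * c * (b * e)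
      regroup₂ = solve-∀
      pointwise : ∀ {u} → u ∈ xs → 𝟙[ far w u ] * (wt v * F t v u) * (Δ * Δ ^ t) ≤
                  P * P ^ t * ∑ xs (λ y → 𝟙[ far w u ] * walks xs t v u y)
      pointwise {u} u∈ = begin
        𝟙[ far w u ] * (wt v * F t v u) * (Δ * Δ ^ t)      ≡⟨ regroup₁ 𝟙[ far w u ] (wt v) (F t v u) Δ (Δ ^ t) ⟩
        wt v * Δ * (𝟙[ far w u ] * (F t v u * Δ ^ t))
          ≤⟨ *-mono-≤ (wtΔ v∈) (*-monoʳ-≤ 𝟙[ far w u ] (weighted*Δ≤ Δ wtΔ t u∈)) ⟩
        P * (𝟙[ far w u ] * (P ^ t * ∑ xs (λ y → walks xs t v u y)))  ≡⟨ regroup₂ P 𝟙[ far w u ] (P ^ t) _ ⟩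
        P * P ^ t * (𝟙[ far w u ] * ∑ xs (λ y → walks xs t v u y))    ≡⟨ cong (P * P ^ t *_) (∑-*ˡ xs 𝟙[ far w u ] _) ⟨
        P * P ^ t * ∑ xs (λ y → 𝟙[ far w u ] * walks xs t v u y)      ∎

    -- The number of two-step walks w, v, u with middle vertex `v` that fail to be locally induced.
    near : V → ℕ
    near v = ∑ xs λ u → ∑ xs λ w → 𝟙[ adj v u ] * (𝟙[ adj v w ] * (𝟙[ eqᵇ w u ] + 𝟙[ adj w u ]))

    near≤ : Unique xs → ∀ v → near v ≤ length (N v xs) + cliques 2 (N v xs)
    near≤ uniq v = begin
      near v
        ≡⟨ ∑-cong xs (λ {u} _ → trans (∑-*ˡ xs 𝟙[ adj v u ] _) (cong (𝟙[ adj v u ] *_) (sym (∑-filter xs (adj v) _)))) ⟩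
      ∑ xs (λ u → 𝟙[ adj v u ] * ∑ (N v xs) (λ w → 𝟙[ eqᵇ w u ] + 𝟙[ adj w u ]))
        ≡⟨ ∑-filter xs (adj v) _ ⟨
      ∑ (N v xs) (λ u → ∑ (N v xs) (λ w → 𝟙[ eqᵇ w u ] + 𝟙[ adj w u ]))
        ≤⟨ ∑-mono (N v xs) (λ {u} _ → row u) ⟩
      ∑ (N v xs) (λ u → 1 + cliques 1 (N u (N v xs)))
        ≡⟨ trans (∑-+ (N v xs) _ _) (cong (_+ cliques 2 (N v xs)) (∑-length (N v xs))) ⟩
      length (N v xs) + cliques 2 (N v xs) ∎
      where
      row : ∀ u → ∑ (N v xs) (λ w → 𝟙[ eqᵇ w u ] + 𝟙[ adj w u ]) ≤ 1 + cliques 1 (N u (N v xs))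
      row u = begin
        ∑ (N v xs) (λ w → 𝟙[ eqᵇ w u ] + 𝟙[ adj w u ])
          ≡⟨ ∑-cong (N v xs) (λ {w} _ → cong₂ (λ a b → 𝟙[ a ] + 𝟙[ b ]) (eqᵇ-sym w u) (adj-sym w u)) ⟩
        ∑ (N v xs) (λ w → 𝟙[ eqᵇ u w ] + 𝟙[ adj u w ])
          ≡⟨ ∑-+ (N v xs) _ _ ⟩
        ∑ (N v xs) (λ w → 𝟙[ eqᵇ u w ]) + ∑ (N v xs) (λ w → 𝟙[ adj u w ])
          ≤⟨ +-mono-≤ (∑-eq≤1 u (N-unique v uniq))
               (≤-reflexive (trans (sym (deg-∑ u (N v xs))) (sym (∑-length (N u (N v xs)))))) ⟩
        1 + cliques 1 (N u (N v xs)) ∎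

    -- Prepending to a walk from `v` every neighbour `w` of `v`, with weight `wt v`, multiplies its
    -- contribution by exactly `P`. The extensions with `w` equal or adjacent to the second vertex
    -- `u` are lost, and `weighted≤` bounds them by `near v`.
    total-step : ∀ t → P * total t ≤ total (suc t) + ∑ xs (λ v → wt v * (P ^ t * near v))
    total-step t = begin
      P * total t
        ≡⟨ trans (sym (∑-*ˡ xs P _)) (∑-cong xs λ {v} v∈ → trans (sym (∑-*ˡ xs P _)) (∑-cong xs λ {u} _ → expand v∈ u)) ⟩
      ∑ xs (λ v → ∑ xs (λ u → ∑ xs (λ w → good w v u) + ∑ xs (λ w → bad w v u)))
        ≡⟨ trans (∑-cong xs λ _ → ∑-+ xs _ _) (∑-+ xs _ _) ⟩
      ∑ xs (λ v → ∑ xs (λ u → ∑ xs (λ w → good w v u))) + ∑ xs (λ v → ∑ xs (λ u → ∑ xs (λ w → bad w v u)))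
        ≤⟨ +-mono-≤ (≤-reflexive goods) (∑-mono xs λ {v} _ → bads v) ⟩
      total (suc t) + ∑ xs (λ v → wt v * (P ^ t * near v)) ∎
      where
      good bad : V → V → V → ℕ
      good w v u = 𝟙[ adj w v ] * (𝟙[ far w u ] * (wt v * F t v u))
      bad  w v u = 𝟙[ adj v w ] * ((𝟙[ eqᵇ w u ] + 𝟙[ adj w u ]) * (wt v * F t v u))
      expand : ∀ {v} → v ∈ xs → ∀ u → P * F t v u ≡ ∑ xs (λ w → good w v u) + ∑ xs (λ w → bad w v u)
      expand {v} v∈ u = begin-equality
        P * F t v u                                               ≡⟨ cong (_* F t v u) (sym (wt-deg v∈)) ⟩
        wt v * length (N v xs) * F t v u                          ≡⟨ regroup (wt v) _ (F t v u) ⟩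
        length (N v xs) * (wt v * F t v u)                        ≡⟨ cong (_* (wt v * F t v u)) (deg-∑ v xs) ⟩
        ∑ xs (λ w → 𝟙[ adj v w ]) * (wt v * F t v u)               ≡⟨ ∑-*ʳ xs _ _ ⟨
        ∑ xs (λ w → 𝟙[ adj v w ] * (wt v * F t v u))               ≡⟨ ∑-cong xs (λ {w} _ → split w) ⟩
        ∑ xs (λ w → good w v u + bad w v u)                       ≡⟨ ∑-+ xs _ _ ⟩
        ∑ xs (λ w → good w v u) + ∑ xs (λ w → bad w v u)          ∎
        where
        regroup : ∀ a b c → a * b * c ≡ b * (a * c)
        regroup = solve-∀
        distrib : ∀ a e f g x → a * ((e + f + g) * x) ≡ a * (g * x) + a * ((e + f) * x)
        distrib = solve-∀
        split : ∀ w → 𝟙[ adj v w ] * (wt v * F t v u) ≡ good w v u + bad w v u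
        split w = begin-equality
          𝟙[ adj v w ] * (wt v * F t v u)
            ≡⟨ cong (𝟙[ adj v w ] *_) (trans (sym (*-identityˡ _)) (cong (_* (wt v * F t v u)) (sym (𝟙-partition w u)))) ⟩
          𝟙[ adj v w ] * ((𝟙[ eqᵇ w u ] + 𝟙[ adj w u ] + 𝟙[ far w u ]) * (wt v * F t v u))
            ≡⟨ distrib 𝟙[ adj v w ] 𝟙[ eqᵇ w u ] 𝟙[ adj w u ] 𝟙[ far w u ] _ ⟩
          𝟙[ adj v w ] * (𝟙[ far w u ] * (wt v * F t v u)) + bad w v u
            ≡⟨ cong (λ b → 𝟙[ b ] * (𝟙[ far w u ] * (wt v * F t v u)) + bad w v u) (adj-sym v w) ⟩
          good w v u + bad w v u ∎
      goods : ∑ xs (λ v → ∑ xs (λ u → ∑ xs (λ w → good w v u))) ≡ total (suc t)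
      goods = begin-equality
        ∑ xs (λ v → ∑ xs (λ u → ∑ xs (λ w → good w v u)))   ≡⟨ ∑-cong xs (λ _ → ∑-swap xs xs _) ⟩
        ∑ xs (λ v → ∑ xs (λ w → ∑ xs (λ u → good w v u)))   ≡⟨ ∑-swap xs xs _ ⟩
        ∑ xs (λ w → ∑ xs (λ v → ∑ xs (λ u → good w v u)))   ≡⟨ ∑-cong xs (λ _ → ∑-cong xs λ _ → ∑-*ˡ xs 𝟙[ adj _ _ ] _) ⟩
        total (suc t)                                       ∎
      bads : ∀ v → ∑ xs (λ u → ∑ xs (λ w → bad w v u)) ≤ wt v * (P ^ t * near v)
      bads v = begin
        ∑ xs (λ u → ∑ xs (λ w → bad w v u))
          ≤⟨ ∑-mono xs (λ {u} u∈ → ∑-mono xs λ {w} _ → *-monoʳ-≤ 𝟙[ adj v w ] (*-monoʳ-≤ (𝟙[ eqᵇ w u ] + 𝟙[ adj w u ]) (*-monoʳ-≤ (wt v) (weighted≤ t u∈)))) ⟩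
        ∑ xs (λ u → ∑ xs (λ w → 𝟙[ adj v w ] * ((𝟙[ eqᵇ w u ] + 𝟙[ adj w u ]) * (wt v * (P ^ t * 𝟙[ adj v u ])))))
          ≡⟨ ∑-cong xs (λ {u} _ → trans (∑-cong xs λ {w} _ → regroup 𝟙[ adj v w ] (𝟙[ eqᵇ w u ] + 𝟙[ adj w u ]) (wt v) (P ^ t) 𝟙[ adj v u ])
               (∑-*ˡ xs (wt v * P ^ t) _)) ⟩
        ∑ xs (λ u → wt v * P ^ t * ∑ xs (λ w → 𝟙[ adj v u ] * (𝟙[ adj v w ] * (𝟙[ eqᵇ w u ] + 𝟙[ adj w u ]))))
          ≡⟨ trans (∑-*ˡ xs (wt v * P ^ t) _) (*-assoc (wt v) (P ^ t) (near v)) ⟩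
        wt v * (P ^ t * near v) ∎
        where
        regroup : ∀ a b c e g → a * (b * (c * (e * g))) ≡ c * e * (g * (a * b))
        regroup = solve-∀

    degree-sum : ℕ
    degree-sum = ∑ xs (λ v → length (N v xs))

    -- In the loss of one step, `c * near v` is at most the squared degree; one factor of the degree
    -- is absorbed by `wt v` into `P`, and the other sums to `degree-sum`. So every step loses at
    -- most the fraction 1/c of the full total, and these losses add up.
    total≥ : ∀ c → (∀ {v} → v ∈ xs → c * near v ≤ length (N v xs) * length (N v xs)) →
             ∀ t → c * (P ^ t * degree-sum) ≤ c * total t + t * (P ^ t * degree-sum)
    total≥ c few zero = ≤-reflexive (trans (cong (c *_) (trans (*-identityˡ degree-sum) (∑-cong xs λ {v} _ → deg-∑ v xs)))
                                       (sym (+-identityʳ _)))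
    total≥ c few (suc t) = begin
      c * (P * P ^ t * S)                                                ≡⟨ regroup₁ c P (P ^ t) S ⟩
      P * (c * (P ^ t * S))                                              ≤⟨ *-monoʳ-≤ P (total≥ c few t) ⟩
      P * (c * total t + t * (P ^ t * S))                                ≡⟨ regroup₂ P c (total t) t (P ^ t) S ⟩
      c * (P * total t) + t * (P * P ^ t * S)                            ≤⟨ +-monoˡ-≤ _ (*-monoʳ-≤ c (total-step t)) ⟩
      c * (total (suc t) + ∑ xs (λ v → wt v * (P ^ t * near v))) + t * (P * P ^ t * S)
        ≡⟨ cong (_+ t * (P * P ^ t * S)) (*-distribˡ-+ c (total (suc t)) _) ⟩
      c * total (suc t) + c * ∑ xs (λ v → wt v * (P ^ t * near v)) + t * (P * P ^ t * S)
        ≤⟨ +-monoˡ-≤ _ (+-monoʳ-≤ (c * total (suc t)) bad≤) ⟩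
      c * total (suc t) + P * P ^ t * S + t * (P * P ^ t * S)            ≡⟨ +-assoc (c * total (suc t)) _ _ ⟩
      c * total (suc t) + suc t * (P * P ^ t * S)                        ∎
      where
      S = degree-sum
      regroup₁ : ∀ c p q s → c * (p * q * s) ≡ p * (c * (q * s))
      regroup₁ = solve-∀
      regroup₂ : ∀ p c x t q s → p * (c * x + t * (q * s)) ≡ c * (p * x) + t * (p * q * s)
      regroup₂ = solve-∀
      regroup₃ : ∀ c w q n → c * (w * (q * n)) ≡ w * q * (c * n)
      regroup₃ = solve-∀
      regroup₄ : ∀ w q a → w * q * (a * a) ≡ w * a * q * a
      regroup₄ = solve-∀
      bad≤ : c * ∑ xs (λ v → wt v * (P ^ t * near v)) ≤ P * P ^ t * S
      bad≤ = begin
        c * ∑ xs (λ v → wt v * (P ^ t * near v))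
          ≡⟨ trans (sym (∑-*ˡ xs c _)) (∑-cong xs λ {v} _ → regroup₃ c (wt v) (P ^ t) (near v)) ⟩
        ∑ xs (λ v → wt v * P ^ t * (c * near v))
          ≤⟨ ∑-mono xs (λ {v} v∈ → *-monoʳ-≤ (wt v * P ^ t) (few v∈)) ⟩
        ∑ xs (λ v → wt v * P ^ t * (length (N v xs) * length (N v xs)))
          ≡⟨ ∑-cong xs (λ {v} v∈ → trans (regroup₄ (wt v) (P ^ t) (length (N v xs)))
               (cong (λ p → p * P ^ t * length (N v xs)) (wt-deg v∈))) ⟩
        ∑ xs (λ v → P * P ^ t * length (N v xs))
          ≡⟨ ∑-*ˡ xs (P * P ^ t) _ ⟩
        P * P ^ t * S ∎

  module _ {d} (ω : CliqueBound d) where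

    open Bounded ω

    -- The weighted number of locally induced walks with t + 1 edges is counted twice. From below it
    -- is at least half of P^t times the degree sum, hence of P^t m Δ; from above, each of the m²
    -- pairs of endpoints carries at most d^t walks, each of weight at most (P/Δ)^t.
    moore : ∀ t {xs} Δ → Unique xs → NoInducedCycle (suc t) xs → ∃[ v ] v ∈ xs → 1 ≤ Δ →
            (∀ {v} → v ∈ xs → Δ ≤ length (N v xs)) →
            (∀ {v} → v ∈ xs → 2 * suc t * (length (N v xs) + cliques 2 (N v xs)) ≤ length (N v xs) * length (N v xs)) →
            Δ ^ suc t ≤ 2 * (length xs * d ^ t)
    moore t {xs} Δ uniq nc (v₀ , v₀∈) 1≤Δ Δ≤deg few = *-cancelˡ-≤ m (*-cancelˡ-≤ (P ^ t) (begin
      P ^ t * (m * Δ ^ suc t)                      ≡⟨ regroup₁ (P ^ t) m Δ (Δ ^ t) ⟩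
      P ^ t * (m * Δ) * Δ ^ t                      ≤⟨ *-monoˡ-≤ (Δ ^ t) (*-monoʳ-≤ (P ^ t) mΔ≤S) ⟩
      P ^ t * degree-sum * Δ ^ t                   ≤⟨ *-monoˡ-≤ (Δ ^ t) PS≤2T ⟩
      2 * total * Δ ^ t                            ≡⟨ *-assoc 2 total _ ⟩
      2 * (total * Δ ^ t)                          ≤⟨ *-monoʳ-≤ 2 TΔ≤ ⟩
      2 * (P ^ t * (m * (m * d ^ t)))              ≡⟨ regroup₂ (P ^ t) m (d ^ t) ⟩
      P ^ t * (m * (2 * (m * d ^ t)))              ∎))
      where
      open ≤-Reasoning
      m P : ℕ
      m = length xs
      -- Every degree lies between 1 and `m`, so it divides `m !`, and the inverse degrees scaled by
      -- `P` are integers. The value 0 in `wt` is not attained on `xs`, where degrees are at least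
      -- `Δ`.
      P = m !
      instance
        m≢0 : NonZero m
        m≢0 = nonEmpty v₀∈
          where
          nonEmpty : ∀ {x xs} → x ∈ xs → NonZero (length xs)
          nonEmpty (here _)  = _
          nonEmpty (there _) = _
        P^t≢0 : NonZero (P ^ t)
        P^t≢0 = m^n≢0 P t {{m !≢0}}
      deg : V → ℕ
      deg v = length (N v xs)
      k∣n! : ∀ {k n} → 1 ≤ k → k ≤ n → k ∣ n !
      k∣n! {suc k} _ k≤n = ∣-trans (m∣m*n (k !)) (m≤n⇒m!∣n! k≤n)
      wt : V → ℕ
      wt v with 1 ≤? deg v
      ... | yes 1≤δ = quotient (k∣n! 1≤δ (length-N v xs))
      ... | no  _   = 0
      wt-deg : ∀ {v} → v ∈ xs → wt v * deg v ≡ P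
      wt-deg {v} v∈ with 1 ≤? deg v
      ... | yes 1≤δ = sym (_∣_.equality (k∣n! 1≤δ (length-N v xs)))
      ... | no  1≰δ = contradiction (≤-trans 1≤Δ (Δ≤deg v∈)) 1≰δ
      open Weights {xs} wt P wt-deg
      total : ℕ
      total = ∑ xs λ v → ∑ xs λ u → weighted wt xs t v u
      regroup₁ : ∀ p m a b → p * (m * (a * b)) ≡ p * (m * a) * b
      regroup₁ = solve-∀
      regroup₂ : ∀ p m e → 2 * (p * (m * (m * e))) ≡ p * (m * (2 * (m * e)))
      regroup₂ = solve-∀
      mΔ≤S : m * Δ ≤ degree-sum
      mΔ≤S = ≤-trans (≤-reflexive (sym (∑-const xs Δ))) (∑-mono xs Δ≤deg)
      -- With c = 2(t + 1), `t` steps lose the fraction t/c, less than one half.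
      PS≤2T : P ^ t * degree-sum ≤ 2 * total
      PS≤2T = *-cancelˡ-≤ (suc t) (+-cancelʳ-≤ (suc t * X) _ _ (begin
        suc t * X + suc t * X                 ≡⟨ double (suc t) X ⟩
        2 * suc t * X                         ≤⟨ total≥ (2 * suc t) (λ {v} v∈ →
                                                   ≤-trans (*-monoʳ-≤ (2 * suc t) (near≤ uniq v)) (few v∈)) t ⟩
        2 * suc t * total + t * X             ≤⟨ +-mono-≤ (≤-reflexive (swap (suc t) total)) (*-monoˡ-≤ X (n≤1+n t)) ⟩
        suc t * (2 * total) + suc t * X       ∎))
        where
        X = P ^ t * degree-sum
        double : ∀ a x → a * x + a * x ≡ 2 * a * x
        double = solve-∀
        swap : ∀ a x → 2 * a * x ≡ a * (2 * x)
        swap = solve-∀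
      TΔ≤ : total * Δ ^ t ≤ P ^ t * (m * (m * d ^ t))
      TΔ≤ = begin
        total * Δ ^ t
          ≡⟨ trans (sym (∑-*ʳ xs _ _)) (∑-cong xs λ _ → sym (∑-*ʳ xs _ _)) ⟩
        ∑ xs (λ v → ∑ xs (λ u → weighted wt xs t v u * Δ ^ t))
          ≤⟨ ∑-mono xs (λ _ → ∑-mono xs λ u∈ → weighted*Δ≤ Δ
               (λ {v} v∈ → ≤-trans (*-monoʳ-≤ (wt v) (Δ≤deg v∈)) (≤-reflexive (wt-deg v∈))) t u∈) ⟩
        ∑ xs (λ v → ∑ xs (λ u → P ^ t * ∑ xs (λ y → walks xs t v u y)))
          ≡⟨ trans (∑-cong xs λ _ → ∑-*ˡ xs (P ^ t) _) (∑-*ˡ xs (P ^ t) _) ⟩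
        P ^ t * ∑ xs (λ v → ∑ xs (λ u → ∑ xs (λ y → walks xs t v u y)))
          ≡⟨ cong (P ^ t *_) (∑-cong xs λ _ → ∑-swap xs xs _) ⟩
        P ^ t * ∑ xs (λ v → ∑ xs (λ y → ∑ xs (λ u → walks xs t v u y)))
          ≤⟨ *-monoʳ-≤ (P ^ t) (∑-mono xs λ v∈ → ∑-mono xs λ y∈ → walks≤ ω uniq nc t ≤-refl v∈ y∈) ⟩
        P ^ t * ∑ xs (λ v → ∑ xs (λ y → d ^ t))
          ≡⟨ cong (P ^ t *_) (trans (∑-cong xs λ _ → ∑-const xs _) (∑-const xs _)) ⟩
        P ^ t * (m * (m * d ^ t)) ∎

-- Vertices of low degree and successive deletion

module Degeneracy (G : Graph) where

  open Cliques G
  open Paths G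
  open Moore G

  minimum-degree : ∀ {v₀ : V} {ys} xs → v₀ ∈ xs →
                   ∃[ v ] (v ∈ xs × ∀ {u} → u ∈ xs → length (N v ys) ≤ length (N u ys))
  minimum-degree (x ∷ [])     _ = x , here refl , λ { (here refl) → ≤-refl }
  minimum-degree {ys = ys} (x ∷ y ∷ xs) _ with v , v∈ , min ← minimum-degree {ys = ys} (y ∷ xs) (here refl)
    with ≤-total (length (N x ys)) (length (N v ys))
  ... | inj₁ x≤v = x , here refl , λ { (here refl) → ≤-refl ; (there u∈) → ≤-trans x≤v (min u∈) }
  ... | inj₂ v≤x = v , there v∈ , λ { (here refl) → v≤x ; (there u∈) → min u∈ }

  cliques-1 : ∀ xs → cliques 1 xs ≡ length xs
  cliques-1 = ∑-length

  module _ {d} (ω : CliqueBound d) where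

    open Bounded ω
    open ≤-Reasoning

    -- In the absence of induced 4-cycles the common neighbourhood of a far pair is a clique, so
    -- `cliques-step` applies with bound `d` and gives E² ≤ Q m (d² m + m² d) ≤ 2Q d m³ for the
    -- number E of ordered edges. The constant 32 r² Q is what makes 16 r² E² at most m⁴.
    few-edges : ∀ r K {zs} → 1 ≤ r → 32 * (r * r) * (16 ^ 1 * 16 ^ 1) ≤ K → 1 ≤ d → K * d ≤ length zs →
                Unique zs → Hered NoFar 1 zs →
                2 * r * (length zs + cliques 2 zs) ≤ length zs * length zs
    few-edges r K {zs} 1≤r K≥ 1≤d Kd≤m uniq h = *-cancelˡ-≤ 2 (begin
      2 * (2 * r * (m + E))                   ≡⟨ expand r m E ⟩
      4 * r * m + 4 * r * E                   ≤⟨ +-mono-≤ (*-monoˡ-≤ m 4r≤m) 4rE≤m² ⟩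
      m * m + m * m                           ≡⟨ double (m * m) ⟩
      2 * (m * m)                             ∎)
      where
      m E Q : ℕ
      m = length zs
      E = cliques 2 zs
      Q = 16 ^ 1 * 16 ^ 1
      expand : ∀ r m e → 2 * (2 * r * (m + e)) ≡ 4 * r * m + 4 * r * e
      expand = solve-∀
      double : ∀ x → x + x ≡ 2 * x
      double = solve-∀
      32r²≤K : 32 * (r * r) ≤ K
      32r²≤K = ≤-trans (m≤m*n (32 * (r * r)) Q) K≥
      4r≤m : 4 * r ≤ m
      4r≤m = begin
        4 * r             ≤⟨ *-mono-≤ {4} {32} (s≤s (s≤s (s≤s (s≤s z≤n)))) (m≤m*n r r {{>-nonZero 1≤r}}) ⟩
        32 * (r * r)      ≤⟨ 32r²≤K ⟩
        K                 ≤⟨ m≤m*n K d {{>-nonZero 1≤d}} ⟩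
        K * d             ≤⟨ Kd≤m ⟩
        m                 ∎
      d≤m : d ≤ m
      d≤m = ≤-trans (m≤n*m d K {{>-nonZero (≤-trans (≤-trans (*-mono-≤ {1} {32} (s≤s z≤n) (*-mono-≤ 1≤r 1≤r)) ≤-refl) 32r²≤K)}}) Kd≤m
      E²≤ : E * E ≤ Q * (m * (d * d * m + m * m * d))
      E²≤ = subst (λ c → E * E ≤ Q * (c * (d * d * c + m * m * d))) (cliques-1 zs)
        (cliques-step 1 1 d uniq h λ {u} {w} u∈ w∈ f →
          ≤-trans (≤-reflexive (cliques-1 (N u (N w zs))))
            (ω _ (NoFar⇒Clique (N-unique u (N-unique w uniq)) (h u∈ w∈ f))))
      scale : ∀ r e → 4 * r * e * (4 * r * e) ≡ 16 * (r * r) * (e * e)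
      scale = solve-∀
      collect : ∀ r Q m d → 16 * (r * r) * (Q * (m * (m * d * m + m * m * d))) ≡ 32 * (r * r) * Q * d * (m * m * m)
      collect = solve-∀
      assoc : ∀ m → m * (m * m * m) ≡ m * m * (m * m)
      assoc = solve-∀
      4rE≤m² : 4 * r * E ≤ m * m
      4rE≤m² = square-cancel-≤ _ _ (begin
        4 * r * E * (4 * r * E)                                     ≡⟨ scale r E ⟩
        16 * (r * r) * (E * E)                                      ≤⟨ *-monoʳ-≤ (16 * (r * r)) E²≤ ⟩
        16 * (r * r) * (Q * (m * (d * d * m + m * m * d)))
          ≤⟨ *-monoʳ-≤ (16 * (r * r)) (*-monoʳ-≤ Q (*-monoʳ-≤ m (+-monoˡ-≤ (m * m * d) (*-monoˡ-≤ m (*-monoˡ-≤ d d≤m))))) ⟩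
        16 * (r * r) * (Q * (m * (m * d * m + m * m * d)))          ≡⟨ collect r Q m d ⟩
        32 * (r * r) * Q * d * (m * m * m)                          ≤⟨ *-monoˡ-≤ (m * m * m) (≤-trans (*-monoˡ-≤ d K≥) Kd≤m) ⟩
        m * (m * m * m)                                             ≡⟨ assoc m ⟩
        m * m * (m * m)                                             ∎)

    -- A vertex of minimum degree Δ is taken. If Δ < K d, one factor Δ is bounded by the number of
    -- vertices and the other `t` by K d. Otherwise every neighbourhood is large enough for
    -- `few-edges`, which supplies the hypothesis of `moore`.
    low-degree : ∀ t K {ys} → 1 ≤ t → 32 * (suc t * suc t) * (16 ^ 1 * 16 ^ 1) ≤ K → Unique ys →
                 NoInducedCycle (suc t) ys → ∃[ v ] v ∈ ys →
                 ∃[ v ] (v ∈ ys × length (N v ys) ^ suc t ≤ (K ^ t + 2) * (d ^ t * length ys))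
    low-degree t K {ys} 1≤t K≥ uniq nc (v₀ , v₀∈) with v , v∈ , min ← minimum-degree {ys = ys} ys v₀∈ =
      v , v∈ , bound
      where
      Δ = length (N v ys)
      m = length ys
      1≤K : 1 ≤ K
      1≤K = ≤-trans (*-mono-≤ {1} {32 * (suc t * suc t)} {1} {16 ^ 1 * 16 ^ 1} (s≤s z≤n) (s≤s z≤n)) K≥
      swap : ∀ m k e → m * (k * e) ≡ k * (e * m)
      swap = solve-∀
      bound : Δ ^ suc t ≤ (K ^ t + 2) * (d ^ t * m)
      bound with K * d ≤? Δ
      ... | no  ≰Δ = begin
        Δ * Δ ^ t                        ≤⟨ *-mono-≤ (length-N v ys) (^-monoˡ-≤ t (<⇒≤ (≰⇒> ≰Δ))) ⟩
        m * (K * d) ^ t                  ≡⟨ cong (m *_) (^-distrib-* K d t) ⟩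
        m * (K ^ t * d ^ t)              ≡⟨ swap m (K ^ t) (d ^ t) ⟩
        K ^ t * (d ^ t * m)              ≤⟨ *-monoˡ-≤ (d ^ t * m) (m≤m+n (K ^ t) 2) ⟩
        (K ^ t + 2) * (d ^ t * m)        ∎
      ... | yes ≤Δ = begin
        Δ ^ suc t
          ≤⟨ moore ω t Δ uniq nc (v₀ , v₀∈) (≤-trans (*-mono-≤ 1≤K (1≤d v)) ≤Δ) min
               (λ {u} u∈ → few-edges (suc t) K (s≤s z≤n) K≥ (1≤d v) (≤-trans ≤Δ (min u∈)) (N-unique u uniq)
                 (Hered-⊑ NoFar-⊑ 1 (N-⊑ u ys) (NoInducedCycle⇒Hered (suc t) (s≤s 1≤t) nc))) ⟩
        2 * (m * d ^ t)                  ≡⟨ cong (2 *_) (*-comm m (d ^ t)) ⟩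
        2 * (d ^ t * m)                  ≤⟨ *-monoˡ-≤ (d ^ t * m) (m≤n+m 2 (K ^ t)) ⟩
        (K ^ t + 2) * (d ^ t * m)        ∎

  -- Vertices lying in few cliques are deleted one at a time; by `cliques-delete` each deletion
  -- destroys at most `suc i * B` ordered cliques. `P` collects what survives deletion.
  degenerate-cliques : ∀ (P : List V → Set) → (∀ {v xs ys} → xs ↭ v ∷ ys → P xs → P ys) → ∀ i B →
    (∀ {xs} → P xs → ∃[ v ] v ∈ xs → ∃[ v ] (v ∈ xs × cliques i (N v xs) ≤ B)) →
    ∀ {xs} → P xs → cliques (suc i) xs ≤ suc i * (length xs * B)
  degenerate-cliques P closed i B low {xs} p = go (length xs) xs refl p
    where
    open ≤-Reasoning
    go : ∀ n xs → length xs ≡ n → P xs → cliques (suc i) xs ≤ suc i * (length xs * B)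
    go zero    []       _  _ = z≤n
    go (suc n) xs@(x ∷ _) eq p
      with v , v∈ , few ← low p (x , here refl)
      with ys , perm ← ∈⇒↭ v∈ = begin
        cliques (suc i) xs                                        ≡⟨ cliques-delete i perm ⟩
        cliques (suc i) ys + suc i * cliques i (N v ys)
          ≤⟨ +-mono-≤ (go n ys (suc-injective (trans (sym (Perm.↭-length perm)) eq)) (closed perm p))
                      (*-monoʳ-≤ (suc i) (≤-trans (≤-reflexive same) few)) ⟩
        suc i * (length ys * B) + suc i * B                       ≡⟨ collect (suc i) (length ys) B ⟩
        suc i * (suc (length ys) * B)                             ≡⟨ cong (λ l → suc i * (l * B)) (Perm.↭-length perm) ⟨
        suc i * (length xs * B)                                   ∎
      where
      collect : ∀ a l b → a * (l * b) + a * b ≡ a * ((1 + l) * b)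
      collect = solve-∀
      same : cliques i (N v ys) ≡ cliques i (N v xs)
      same = trans (cong (cliques i) (sym (N-self v ys))) (cliques-↭ i (N-↭ v (↭-sym perm)))

-- Clique estimates with integer exponents

-- The estimate x ≤ C^(1/M) d^(α/M) m^(β/M), for the number x of ordered i-cliques
-- in a set of m vertices, with both sides raised to the power M.
CliqueEstimate : (q r i M α β C : ℕ) → Set₁
CliqueEstimate q r i M α β C = ∀ (G : Graph) → let open Cliques G; open Paths G in
  ∀ {d} → CliqueBound d → ∀ {xs} → Unique xs → Hered (NoInducedCycle r) q xs →
  cliques i xs ^ M ≤ C * (d ^ α * length xs ^ β)

^-distrib-monomial : ∀ C x a y b k → (C * (x ^ a * y ^ b)) ^ k ≡ C ^ k * (x ^ (a * k) * y ^ (b * k))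
^-distrib-monomial C x a y b k = trans (^-distrib-* C (x ^ a * y ^ b) k)
  (cong (C ^ k *_) (trans (^-distrib-* (x ^ a) (y ^ b) k) (cong₂ _*_ (^-*-assoc x a k) (^-*-assoc y b k))))

-- At equal total degree, factors `d` are traded for the larger factors `m`.
^-exchange : ∀ {d m} → d ≤ m → ∀ {a b a′ b′} → a + b ≡ a′ + b′ → b ≤ b′ → d ^ a * m ^ b ≤ d ^ a′ * m ^ b′
^-exchange {d} {m} d≤m {a} {b} {a′} {b′} sum b≤b′ with o , refl ← m≤n⇒∃[o]m+o≡n b≤b′ = begin
  d ^ a * m ^ b                ≡⟨ cong (λ e → d ^ e * m ^ b) a≡ ⟩
  d ^ (a′ + o) * m ^ b         ≡⟨ cong (_* m ^ b) (^-distribˡ-+-* d a′ o) ⟩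
  d ^ a′ * d ^ o * m ^ b       ≤⟨ *-monoˡ-≤ (m ^ b) (*-monoʳ-≤ (d ^ a′) (^-monoˡ-≤ o d≤m)) ⟩
  d ^ a′ * m ^ o * m ^ b       ≡⟨ *-assoc (d ^ a′) _ _ ⟩
  d ^ a′ * (m ^ o * m ^ b)     ≡⟨ cong (d ^ a′ *_) (trans (*-comm (m ^ o) _) (sym (^-distribˡ-+-* m b o))) ⟩
  d ^ a′ * m ^ (b + o)         ∎
  where
  open ≤-Reasoning
  shuffle : ∀ a b o → a + (b + o) ≡ a + o + b
  shuffle = solve-∀
  a≡ : a ≡ a′ + o
  a≡ = +-cancelʳ-≡ b a (a′ + o) (trans sum (shuffle a′ b o))

trivial-estimate : ∀ q r i → CliqueEstimate q r i 1 0 i 1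
trivial-estimate q r i G _ {xs} _ _ = begin
  cliques i xs ^ 1                   ≡⟨ ^-identityʳ _ ⟩
  cliques i xs                       ≤⟨ cliques≤^ i xs ≤-refl ⟩
  length xs ^ i                      ≡⟨ trans (*-identityˡ _) (*-identityˡ _) ⟨
  1 * (1 * length xs ^ i)            ∎
  where
  open ≤-Reasoning
  open Cliques G

-- A deleted vertex has degree D with D^r ≤ C₁ d^t m. Substituting this into the r-th power of the
-- estimate for its neighbourhood yields the exponents α r + t β of d and β of m; the m deletions
-- contribute the summand M r.
degeneracy-step : ∀ t {i M α β C} → 1 ≤ t → .{{NonZero M}} → CliqueEstimate 0 (suc t) i M α β C →
  ∃[ C′ ] CliqueEstimate 0 (suc t) (suc i) (M * suc t) (α * suc t + t * β) (M * suc t + β) C′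
degeneracy-step t {i} {M} {α} {β} {C} 1≤t {{M≢0}} est = suc i ^ L * (C ^ r * C₁ ^ β) , bound
  where
  open ≤-Reasoning
  r L K C₁ : ℕ
  r = suc t
  L = M * r
  K = 32 * (r * r) * (16 ^ 1 * 16 ^ 1)
  C₁ = K ^ t + 2
  bound : CliqueEstimate 0 r (suc i) L (α * r + t * β) (L + β) (suc i ^ L * (C ^ r * C₁ ^ β))
  bound G {d} ω {xs} uniq nc = begin
    cliques (suc i) xs ^ L
      ≤⟨ ^-monoˡ-≤ L (degenerate-cliques P closed i B low (uniq , nc , ≤-refl)) ⟩
    (suc i * (m * B)) ^ L
      ≡⟨ trans (^-distrib-* (suc i) (m * B) L) (cong (suc i ^ L *_) (^-distrib-* m B L)) ⟩
    suc i ^ L * (m ^ L * B ^ L)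
      ≤⟨ *-monoʳ-≤ (suc i ^ L) (*-monoʳ-≤ (m ^ L) B^L≤R) ⟩
    suc i ^ L * (m ^ L * (C ^ r * C₁ ^ β * (d ^ (α * r + t * β) * m ^ β)))
      ≡⟨ regroup (suc i ^ L) (m ^ L) (C ^ r * C₁ ^ β) (d ^ (α * r + t * β)) (m ^ β) ⟩
    suc i ^ L * (C ^ r * C₁ ^ β) * (d ^ (α * r + t * β) * (m ^ L * m ^ β))
      ≡⟨ cong (λ z → suc i ^ L * (C ^ r * C₁ ^ β) * (d ^ (α * r + t * β) * z)) (^-distribˡ-+-* m L β) ⟨
    suc i ^ L * (C ^ r * C₁ ^ β) * (d ^ (α * r + t * β) * m ^ (L + β)) ∎
    where
    open Cliques G
    open Paths G
    open Degeneracy G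
    m R : ℕ
    m = length xs
    R = C ^ r * C₁ ^ β * (d ^ (α * r + t * β) * m ^ β)
    root = floorRoot L {{m*n≢0 M r}} R
    B = proj₁ root
    B^L≤R : B ^ L ≤ R
    B^L≤R = proj₁ (proj₂ root)
    regroup : ∀ a b c e g → a * (b * (c * (e * g))) ≡ a * c * (e * (b * g))
    regroup = solve-∀
    regroup′ : ∀ a b c e g → a * (b * (c * (e * g))) ≡ a * c * (b * e * g)
    regroup′ = solve-∀
    -- `B` is computed from `xs` once and for all, so the bound by `m` has to accompany every list
    -- that remains during the deletions.
    P : List V → Set
    P ys = Unique ys × NoInducedCycle r ys × length ys ≤ m
    closed : ∀ {v xs ys} → xs ↭ v ∷ ys → P xs → P ys
    closed perm (u , n , le) =
      unique-tail (SetoidPerm.Unique-resp-↭ (≡.setoid V) (↭⇒↭ₛ perm) u) ,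
      NoInducedCycle-⊑ r (Perm.∈-resp-↭ (↭-sym perm) ∘ there) n ,
      ≤-trans (n≤1+n _) (≤-trans (≤-reflexive (sym (Perm.↭-length perm))) le)
      where
      unique-tail : ∀ {v ys} → Unique (v ∷ ys) → Unique ys
      unique-tail (_ ∷ u) = u
    low : ∀ {ys} → P ys → ∃[ v ] v ∈ ys → ∃[ v ] (v ∈ ys × cliques i (N v ys) ≤ B)
    low {ys} (u , n , le) ne with v , v∈ , deg≤ ← low-degree ω t K 1≤t ≤-refl u n ne =
      v , v∈ , proj₂ (proj₂ root) _ (begin
        cliques i (N v ys) ^ L                        ≡⟨ ^-*-assoc (cliques i (N v ys)) M r ⟨
        (cliques i (N v ys) ^ M) ^ r
          ≤⟨ ^-monoˡ-≤ r (est G ω (N-unique v u) (NoInducedCycle-⊑ r (N-⊑ v ys) n)) ⟩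
        (C * (d ^ α * D ^ β)) ^ r                     ≡⟨ ^-distrib-monomial C d α D β r ⟩
        C ^ r * (d ^ (α * r) * D ^ (β * r))
          ≡⟨ cong (λ z → C ^ r * (d ^ (α * r) * z)) (trans (cong (D ^_) (*-comm β r)) (sym (^-*-assoc D r β))) ⟩
        C ^ r * (d ^ (α * r) * (D ^ r) ^ β)
          ≤⟨ *-monoʳ-≤ (C ^ r) (*-monoʳ-≤ (d ^ (α * r)) (^-monoˡ-≤ β
               (≤-trans deg≤ (*-monoʳ-≤ C₁ (*-monoʳ-≤ (d ^ t) le))))) ⟩
        C ^ r * (d ^ (α * r) * (C₁ * (d ^ t * m)) ^ β)
          ≡⟨ cong (λ z → C ^ r * (d ^ (α * r) * z)) (trans (^-distrib-* C₁ (d ^ t * m) β)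
               (cong (C₁ ^ β *_) (trans (^-distrib-* (d ^ t) m β) (cong (_* m ^ β) (^-*-assoc d t β))))) ⟩
        C ^ r * (d ^ (α * r) * (C₁ ^ β * (d ^ (t * β) * m ^ β)))
          ≡⟨ regroup′ (C ^ r) (d ^ (α * r)) (C₁ ^ β) (d ^ (t * β)) (m ^ β) ⟩
        C ^ r * C₁ ^ β * (d ^ (α * r) * d ^ (t * β) * m ^ β)
          ≡⟨ cong (λ z → C ^ r * C₁ ^ β * (z * m ^ β)) (^-distribˡ-+-* d (α * r) (t * β)) ⟨
        R ∎)
      where D = length (N v ys)

-- The larger of the two summands in `cliques-step` decides. If it is m² B, the exponents come out
-- as claimed, with M₁ M₂ as a common denominator and 2 M₁ M₂ because a square is bounded. If it is
-- d² y, the power of m is no larger, and d ≤ m makes up the difference by `^-exchange`. The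
-- inequality between β₁ and β₂ needed for this expresses that the exponent a does not decrease from
-- i to i + 1.
suspension-step : ∀ {q r i M₁ α₁ β₁ C₁ M₂ α₂ β₂ C₂} → 2 ≤ r → .{{NonZero M₁}} → .{{NonZero M₂}} →
  α₁ + β₁ ≡ i * M₁ → α₂ + β₂ ≡ i * M₂ → β₂ * M₁ ≤ β₁ * M₂ + 2 * (M₁ * M₂) →
  CliqueEstimate q r i M₁ α₁ β₁ C₁ → CliqueEstimate (suc q) r i M₂ α₂ β₂ C₂ →
  ∃[ C ] CliqueEstimate (suc q) r (suc i) (2 * (M₁ * M₂)) (α₂ * M₁ + α₁ * M₂)
           (β₂ * M₁ + β₁ * M₂ + 2 * (M₁ * M₂)) C
suspension-step {q} {r} {i} {M₁} {α₁} {β₁} {C₁} {M₂} {α₂} {β₂} {C₂} 2≤r sums₁ sums₂ mono est₁ est₂ = C , bound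
  where
  open ≤-Reasoning
  L α β Q E C : ℕ
  L = M₁ * M₂
  α = α₂ * M₁ + α₁ * M₂
  β = β₂ * M₁ + β₁ * M₂ + 2 * L
  Q = 16 ^ (suc q + 1) * 16 ^ (suc q + 1)
  E = C₂ ^ M₁
  -- The summand 1 serves the case m ≤ d, where the trivial bound m^(i+1) suffices; the other two
  -- serve the two summands of the recursion.
  C = 1 + (2 * Q) ^ L * (E * C₁ ^ M₂ + E * E)
  sums : α + β ≡ suc i * (2 * L)
  sums = trans (shuffle (α₂ * M₁) (α₁ * M₂) (β₂ * M₁) (β₁ * M₂) (2 * L))
    (trans (cong₂ (λ a b → a + b + 2 * L)
        (trans (sym (*-distribʳ-+ M₁ α₂ β₂)) (cong (_* M₁) sums₂))
        (trans (sym (*-distribʳ-+ M₂ α₁ β₁)) (cong (_* M₂) sums₁)))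
      (collect i M₁ M₂))
    where
    shuffle : ∀ a b c e l → a + b + (c + e + l) ≡ (a + c) + (b + e) + l
    shuffle = solve-∀
    collect : ∀ i a b → i * b * a + i * a * b + 2 * (a * b) ≡ (1 + i) * (2 * (a * b))
    collect = solve-∀
  bound : CliqueEstimate (suc q) r (suc i) (2 * L) α β C
  bound G {d} ω {xs} uniq h with ≤-total (length xs) d
  ... | inj₁ m≤d = begin
    x ^ (2 * L)                    ≤⟨ ^-monoˡ-≤ (2 * L) (cliques≤^ (suc i) xs ≤-refl) ⟩
    (m ^ suc i) ^ (2 * L)          ≡⟨ trans (^-*-assoc m (suc i) (2 * L)) (cong (m ^_) (sym sums)) ⟩
    m ^ (α + β)                    ≡⟨ ^-distribˡ-+-* m α β ⟩
    m ^ α * m ^ β                  ≤⟨ *-monoˡ-≤ (m ^ β) (^-monoˡ-≤ α m≤d) ⟩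
    d ^ α * m ^ β                  ≤⟨ m≤m+n _ _ ⟩
    C * (d ^ α * m ^ β)            ∎
    where
    open Cliques G
    m = length xs
    x = cliques (suc i) xs
  ... | inj₂ d≤m = ≤-trans (main (≤-total (m * m * B) (d * d * y)))
    (*-monoˡ-≤ (d ^ α * m ^ β) (n≤1+n ((2 * Q) ^ L * (E * C₁ ^ M₂ + E * E))))
    where
    open Cliques G
    open Paths G
    open Bounded ω
    m x y R : ℕ
    m = length xs
    x = cliques (suc i) xs
    y = cliques i xs
    R = C₁ * (d ^ α₁ * m ^ β₁)
    root = floorRoot M₁ R
    B = proj₁ root
    recursion : x * x ≤ Q * (y * (d * d * y + m * m * B))
    recursion = cliques-step (suc q + 1) i B uniq
      (Hered-map {P = NoInducedCycle r} 1 (NoInducedCycle⇒Hered r 2≤r) (suc q) h)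
      λ {u} {w} u∈ w∈ f → proj₂ (proj₂ root) _ (≤-trans
        (est₁ G ω (N-unique u (N-unique w uniq)) (h u∈ w∈ f))
        (*-monoʳ-≤ C₁ (*-monoʳ-≤ (d ^ α₁) (^-monoˡ-≤ β₁ (≤-trans (length-N u (N w xs)) (length-N w xs))))))
    y^L≤ : y ^ L ≤ E * (d ^ (α₂ * M₁) * m ^ (β₂ * M₁))
    y^L≤ = begin
      y ^ (M₁ * M₂)                              ≡⟨ trans (cong (y ^_) (*-comm M₁ M₂)) (sym (^-*-assoc y M₂ M₁)) ⟩
      (y ^ M₂) ^ M₁                              ≤⟨ ^-monoˡ-≤ M₁ (est₂ G ω uniq h) ⟩
      (C₂ * (d ^ α₂ * m ^ β₂)) ^ M₁              ≡⟨ ^-distrib-monomial C₂ d α₂ m β₂ M₁ ⟩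
      E * (d ^ (α₂ * M₁) * m ^ (β₂ * M₁))        ∎
    B^L≤ : B ^ L ≤ C₁ ^ M₂ * (d ^ (α₁ * M₂) * m ^ (β₁ * M₂))
    B^L≤ = begin
      B ^ (M₁ * M₂)                              ≡⟨ ^-*-assoc B M₁ M₂ ⟨
      (B ^ M₁) ^ M₂                              ≤⟨ ^-monoˡ-≤ M₂ (proj₁ (proj₂ root)) ⟩
      R ^ M₂                                     ≡⟨ ^-distrib-monomial C₁ d α₁ m β₁ M₂ ⟩
      C₁ ^ M₂ * (d ^ (α₁ * M₂) * m ^ (β₁ * M₂))  ∎
    powers : ∀ z w → x * x ≤ 2 * Q * (y * (z * z * w)) → x ^ (2 * L) ≤ (2 * Q) ^ L * (y ^ L * (z ^ (2 * L) * w ^ L))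
    powers z w le = begin
      x ^ (2 * L)                                 ≡⟨ ^-*-assoc x 2 L ⟨
      (x ^ 2) ^ L                                 ≡⟨ cong (λ s → (x * s) ^ L) (*-identityʳ x) ⟩
      (x * x) ^ L                                 ≤⟨ ^-monoˡ-≤ L le ⟩
      (2 * Q * (y * (z * z * w))) ^ L             ≡⟨ ^-distrib-* (2 * Q) _ L ⟩
      (2 * Q) ^ L * (y * (z * z * w)) ^ L         ≡⟨ cong ((2 * Q) ^ L *_) (^-distrib-* y _ L) ⟩
      (2 * Q) ^ L * (y ^ L * (z * z * w) ^ L)     ≡⟨ cong (λ s → (2 * Q) ^ L * (y ^ L * s)) (^-distrib-* (z * z) w L) ⟩
      (2 * Q) ^ L * (y ^ L * ((z * z) ^ L * w ^ L))
        ≡⟨ cong (λ s → (2 * Q) ^ L * (y ^ L * (s * w ^ L)))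
             (trans (cong (λ s → (z * s) ^ L) (sym (*-identityʳ z))) (^-*-assoc z 2 L)) ⟩
      (2 * Q) ^ L * (y ^ L * (z ^ (2 * L) * w ^ L)) ∎
    widen : ∀ {s u} → s ≤ u → Q * (y * (u + s)) ≤ 2 * Q * (y * u)
    widen {s} {u} s≤u = ≤-trans (*-monoʳ-≤ Q (*-monoʳ-≤ y (+-monoʳ-≤ u s≤u))) (≤-reflexive (move Q y u))
      where
      move : ∀ Q y u → Q * (y * (u + u)) ≡ 2 * Q * (y * u)
      move = solve-∀
    main : m * m * B ≤ d * d * y ⊎ d * d * y ≤ m * m * B →
           x ^ (2 * L) ≤ (2 * Q) ^ L * (E * C₁ ^ M₂ + E * E) * (d ^ α * m ^ β)
    main (inj₁ le) = begin
      x ^ (2 * L)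
        ≤⟨ powers d y (≤-trans recursion (widen le)) ⟩
      (2 * Q) ^ L * (y ^ L * (d ^ (2 * L) * y ^ L))
        ≤⟨ *-monoʳ-≤ ((2 * Q) ^ L) (*-mono-≤ y^L≤ (*-monoʳ-≤ (d ^ (2 * L)) y^L≤)) ⟩
      (2 * Q) ^ L * (E * (dᵃ * mᵇ) * (d ^ (2 * L) * (E * (dᵃ * mᵇ))))
        ≡⟨ regroup ((2 * Q) ^ L) E dᵃ mᵇ (d ^ (2 * L)) ⟩
      (2 * Q) ^ L * (E * E) * (dᵃ * dᵃ * d ^ (2 * L) * (mᵇ * mᵇ))
        ≡⟨ cong₂ (λ a b → (2 * Q) ^ L * (E * E) * (a * b))
             (trans (cong (_* d ^ (2 * L)) (sym (^-distribˡ-+-* d (α₂ * M₁) (α₂ * M₁))))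
                    (sym (^-distribˡ-+-* d (α₂ * M₁ + α₂ * M₁) (2 * L))))
             (sym (^-distribˡ-+-* m (β₂ * M₁) (β₂ * M₁))) ⟩
      (2 * Q) ^ L * (E * E) * (d ^ (α₂ * M₁ + α₂ * M₁ + 2 * L) * m ^ (β₂ * M₁ + β₂ * M₁))
        ≤⟨ *-mono-≤ (*-monoʳ-≤ ((2 * Q) ^ L) (m≤n+m (E * E) (E * C₁ ^ M₂)))
             (^-exchange d≤m {α₂ * M₁ + α₂ * M₁ + 2 * L} {β₂ * M₁ + β₂ * M₁} {α} {β} same-sums smaller) ⟩
      (2 * Q) ^ L * (E * C₁ ^ M₂ + E * E) * (d ^ α * m ^ β) ∎
      where
      dᵃ = d ^ (α₂ * M₁)
      mᵇ = m ^ (β₂ * M₁)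
      regroup : ∀ q e a b c → q * (e * (a * b) * (c * (e * (a * b)))) ≡ q * (e * e) * (a * a * c * (b * b))
      regroup = solve-∀
      smaller : β₂ * M₁ + β₂ * M₁ ≤ β
      smaller = ≤-trans (+-monoʳ-≤ (β₂ * M₁) mono) (≤-reflexive (sym (+-assoc (β₂ * M₁) _ _)))
      shuffle : ∀ a l b → a + a + l + (b + b) ≡ (a + b) + (a + b) + l
      shuffle = solve-∀
      collect : ∀ i a b → i * b * a + i * b * a + 2 * (a * b) ≡ (1 + i) * (2 * (a * b))
      collect = solve-∀
      half : α₂ * M₁ + β₂ * M₁ ≡ i * M₂ * M₁
      half = trans (sym (*-distribʳ-+ M₁ α₂ β₂)) (cong (_* M₁) sums₂)
      same-sums : α₂ * M₁ + α₂ * M₁ + 2 * L + (β₂ * M₁ + β₂ * M₁) ≡ α + β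
      same-sums = trans (shuffle (α₂ * M₁) (2 * L) (β₂ * M₁))
        (trans (cong (λ s → s + s + 2 * L) half) (trans (collect i M₁ M₂) (sym sums)))
    main (inj₂ le) = begin
      x ^ (2 * L)
        ≤⟨ powers m B (≤-trans recursion (≤-trans (≤-reflexive (cong (λ s → Q * (y * s)) (+-comm (d * d * y) _))) (widen le))) ⟩
      (2 * Q) ^ L * (y ^ L * (m ^ (2 * L) * B ^ L))
        ≤⟨ *-monoʳ-≤ ((2 * Q) ^ L) (*-mono-≤ y^L≤ (*-monoʳ-≤ (m ^ (2 * L)) B^L≤)) ⟩
      (2 * Q) ^ L * (E * (d ^ (α₂ * M₁) * m ^ (β₂ * M₁)) * (m ^ (2 * L) * (C₁ ^ M₂ * (d ^ (α₁ * M₂) * m ^ (β₁ * M₂)))))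
        ≡⟨ regroup ((2 * Q) ^ L) E (C₁ ^ M₂) (d ^ (α₂ * M₁)) (d ^ (α₁ * M₂)) (m ^ (β₂ * M₁)) (m ^ (β₁ * M₂)) (m ^ (2 * L)) ⟩
      (2 * Q) ^ L * (E * C₁ ^ M₂) *
        (d ^ (α₂ * M₁) * d ^ (α₁ * M₂) * (m ^ (β₂ * M₁) * m ^ (β₁ * M₂) * m ^ (2 * L)))
        ≡⟨ cong₂ (λ a b → (2 * Q) ^ L * (E * C₁ ^ M₂) * (a * b))
             (sym (^-distribˡ-+-* d (α₂ * M₁) (α₁ * M₂)))
             (trans (cong (_* m ^ (2 * L)) (sym (^-distribˡ-+-* m (β₂ * M₁) (β₁ * M₂))))
                    (sym (^-distribˡ-+-* m (β₂ * M₁ + β₁ * M₂) (2 * L)))) ⟩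
      (2 * Q) ^ L * (E * C₁ ^ M₂) * (d ^ α * m ^ β)
        ≤⟨ *-monoˡ-≤ (d ^ α * m ^ β) (*-monoʳ-≤ ((2 * Q) ^ L) (m≤m+n (E * C₁ ^ M₂) (E * E))) ⟩
      (2 * Q) ^ L * (E * C₁ ^ M₂ + E * E) * (d ^ α * m ^ β) ∎
      where
      regroup : ∀ q e c a a′ b b′ l → q * (e * (a * b) * (l * (c * (a′ * b′)))) ≡ q * (e * c) * (a * a′ * (b * b′ * l))
      regroup = solve-∀

-- Rational exponents

toℚᵘ-fromℕ : ∀ m → ℚ.toℚᵘ (fromℕ m) ℚᵘ.≃ ℚᵘ.mkℚᵘ (ℤ.+ m) 0
toℚᵘ-fromℕ m = ℚ.toℚᵘ-fromℚᵘ (ℚᵘ.mkℚᵘ (ℤ.+ m) 0)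

fromℕ-+ : ∀ m n → fromℕ (m + n) ≡ fromℕ m ℚ.+ fromℕ n
fromℕ-+ m n = ℚ.toℚᵘ-injective (begin
  ℚ.toℚᵘ (fromℕ (m + n))                         ≈⟨ toℚᵘ-fromℕ (m + n) ⟩
  ℚᵘ.mkℚᵘ (ℤ.+ (m + n)) 0                        ≈⟨ ℚᵘ.*≡* (cong (ℤ._* ℤ.1ℤ) (sym (cong₂ ℤ._+_ (ℤ.*-identityʳ (ℤ.+ m)) (ℤ.*-identityʳ (ℤ.+ n))))) ⟩
  ℚᵘ.mkℚᵘ (ℤ.+ m) 0 ℚᵘ.+ ℚᵘ.mkℚᵘ (ℤ.+ n) 0       ≈⟨ ℚᵘ.+-cong (toℚᵘ-fromℕ m) (toℚᵘ-fromℕ n) ⟨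
  ℚ.toℚᵘ (fromℕ m) ℚᵘ.+ ℚ.toℚᵘ (fromℕ n)         ≈⟨ ℚ.toℚᵘ-homo-+ (fromℕ m) (fromℕ n) ⟨
  ℚ.toℚᵘ (fromℕ m ℚ.+ fromℕ n)                   ∎)
  where open ℚᵘ.≃-Reasoning

fromℕ-* : ∀ m n → fromℕ (m * n) ≡ fromℕ m ℚ.* fromℕ n
fromℕ-* m n = ℚ.toℚᵘ-injective (begin
  ℚ.toℚᵘ (fromℕ (m * n))                         ≈⟨ toℚᵘ-fromℕ (m * n) ⟩
  ℚᵘ.mkℚᵘ (ℤ.+ (m * n)) 0                        ≈⟨ ℚᵘ.*≡* (cong (ℤ._* ℤ.1ℤ) (ℤ.pos-* m n)) ⟩
  ℚᵘ.mkℚᵘ (ℤ.+ m) 0 ℚᵘ.* ℚᵘ.mkℚᵘ (ℤ.+ n) 0       ≈⟨ ℚᵘ.*-cong (toℚᵘ-fromℕ m) (toℚᵘ-fromℕ n) ⟨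
  ℚ.toℚᵘ (fromℕ m) ℚᵘ.* ℚ.toℚᵘ (fromℕ n)         ≈⟨ ℚ.toℚᵘ-homo-* (fromℕ m) (fromℕ n) ⟨
  ℚ.toℚᵘ (fromℕ m ℚ.* fromℕ n)                   ∎)
  where open ℚᵘ.≃-Reasoning

fromℕ-cancel-≤ : ∀ m n → fromℕ m ℚ.≤ fromℕ n → m ≤ n
fromℕ-cancel-≤ m n le with ℚᵘ.*≤* le′ ←
  ℚᵘ.≤-respʳ-≃ (toℚᵘ-fromℕ n) (ℚᵘ.≤-respˡ-≃ (toℚᵘ-fromℕ m) (ℚ.toℚᵘ-mono-≤ le)) =
  ℤ.drop‿+≤+ (subst₂ ℤ._≤_ (ℤ.*-identityʳ (ℤ.+ m)) (ℤ.*-identityʳ (ℤ.+ n)) le′)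

numerator : ∀ y M β → y ℚ.* fromℕ M ≡ fromℕ β → ℤ.∣ ↥ y ∣ * M ≡ β * ↧ₙ y
numerator y@record{} M β eq with ℚᵘ.*≡* eq′ ← ℚᵘ.≃-trans (ℚᵘ.*-congˡ {ℚ.toℚᵘ y} (ℚᵘ.≃-sym (toℚᵘ-fromℕ M)))
    (ℚᵘ.≃-trans (ℚᵘ.≃-sym (ℚ.toℚᵘ-homo-* y (fromℕ M))) (ℚᵘ.≃-trans (ℚᵘ.≃-reflexive (cong ℚ.toℚᵘ eq)) (toℚᵘ-fromℕ β))) = begin
  ℤ.∣ ↥ y ∣ * M                                          ≡⟨ ℤ.abs-* (↥ y) (ℤ.+ M) ⟨
  ℤ.∣ ↥ y ℤ.* ℤ.+ M ∣                                    ≡⟨ cong ℤ.∣_∣ (ℤ.*-identityʳ (↥ y ℤ.* ℤ.+ M)) ⟨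
  ℤ.∣ ↥ y ℤ.* ℤ.+ M ℤ.* ℤ.1ℤ ∣                           ≡⟨ cong ℤ.∣_∣ eq′ ⟩
  ℤ.∣ ℤ.+ β ℤ.* ℤ.+ (↧ₙ y * 1) ∣                         ≡⟨ ℤ.abs-* (ℤ.+ β) (ℤ.+ (↧ₙ y * 1)) ⟩
  β * (↧ₙ y * 1)                                         ≡⟨ cong (β *_) (*-identityʳ (↧ₙ y)) ⟩
  β * ↧ₙ y                                               ∎
  where open ≡-Reasoning

module _ (r : ℕ) .{{_ : NonZero r}} where

  1/r^ : ℕ → ℚ
  1/r^ j = (ℤ.1ℤ ℚ./ (r ^ j)) {{m^n≢0 r j}}

  r*1/r^suc : ∀ j → fromℕ r ℚ.* 1/r^ (suc j) ≡ 1/r^ j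
  r*1/r^suc j = ℚ.toℚᵘ-injective (begin
    ℚ.toℚᵘ (fromℕ r ℚ.* 1/r^ (suc j))                  ≈⟨ ℚ.toℚᵘ-homo-* (fromℕ r) (1/r^ (suc j)) ⟩
    ℚ.toℚᵘ (fromℕ r) ℚᵘ.* ℚ.toℚᵘ (1/r^ (suc j))        ≈⟨ ℚᵘ.*-cong (toℚᵘ-fromℕ r) (reduce (r ^ suc j)) ⟩
    ℚᵘ.mkℚᵘ (ℤ.+ r) 0 ℚᵘ.* (ℤ.1ℤ ℚᵘ./ (r ^ suc j))     ≈⟨ cancel (r ^ j) ⟩
    ℤ.1ℤ ℚᵘ./ (r ^ j)                                  ≈⟨ reduce (r ^ j) ⟨
    ℚ.toℚᵘ (1/r^ j)                                    ∎)
    where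
    open ℚᵘ.≃-Reasoning
    instance
      _ = m^n≢0 r j
      _ = m^n≢0 r (suc j)
    reduce : ∀ k .{{_ : NonZero k}} → ℚ.toℚᵘ (ℤ.1ℤ ℚ./ k) ℚᵘ.≃ ℤ.1ℤ ℚᵘ./ k
    reduce (suc k) = ℚ.toℚᵘ-fromℚᵘ (ℚᵘ.mkℚᵘ ℤ.1ℤ k)
    cancel : ∀ k .{{_ : NonZero k}} .{{_ : NonZero (r * k)}} →
             ℚᵘ.mkℚᵘ (ℤ.+ r) 0 ℚᵘ.* (ℤ.1ℤ ℚᵘ./ (r * k)) ℚᵘ.≃ ℤ.1ℤ ℚᵘ./ k
    cancel (suc k) with r * suc k in eq
    ... | suc l = ℚᵘ.*≡* (trans (cong₂ ℤ._*_ (ℤ.*-identityʳ (ℤ.+ r)) refl)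
      (trans (sym (ℤ.pos-* r (suc k))) (trans (cong ℤ.+_ (trans eq (sym (+-identityʳ (suc l))))) (sym (ℤ.*-identityˡ _)))))

  r*geometric : ∀ j → fromℕ r ℚ.* geometric r (suc j) ≡ geometric r j ℚ.+ fromℕ r
  r*geometric zero = trans (cong (fromℕ r ℚ.*_) (ℚ.+-identityˡ 1ℚ)) (trans (ℚ.*-identityʳ (fromℕ r)) (sym (ℚ.+-identityˡ (fromℕ r))))
  r*geometric (suc j) = begin
    fromℕ r ℚ.* (geometric r (suc j) ℚ.+ 1/r^ (suc j))              ≡⟨ ℚ.*-distribˡ-+ (fromℕ r) _ _ ⟩
    fromℕ r ℚ.* geometric r (suc j) ℚ.+ fromℕ r ℚ.* 1/r^ (suc j)    ≡⟨ cong₂ ℚ._+_ (r*geometric j) (r*1/r^suc j) ⟩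
    geometric r j ℚ.+ fromℕ r ℚ.+ 1/r^ j                            ≡⟨ swap (geometric r j) (fromℕ r) (1/r^ j) ⟩
    geometric r j ℚ.+ 1/r^ j ℚ.+ fromℕ r                            ∎
    where
    open ≡-Reasoning
    open +-*-Solver
    swap : ∀ x y z → x ℚ.+ y ℚ.+ z ≡ x ℚ.+ z ℚ.+ y
    swap = solve 3 (λ x y z → x :+ y :+ z := x :+ z :+ y) refl

  a-base : ∀ q → a (2 + q) r (1 + q) ≡ fromℕ (1 + q)
  a-base zero = refl
  a-base (suc q) with suc q ≡ᵇ suc q in eq
  ... | true  = refl
  ... | false with () ← subst T eq (≡⇒≡ᵇ (suc q) (suc q) refl)

  a-suc : ∀ q i → 2 + q ≤ i → a (3 + q) r (suc i) ≡ ½ ℚ.* a (2 + q) r i ℚ.+ ½ ℚ.* a (3 + q) r i ℚ.+ 1ℚ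
  a-suc q i le with i ≡ᵇ suc q in eq
  ... | false = refl
  ... | true  = contradiction (subst (_≤ suc q) (sym (≡ᵇ⇒≡ i (suc q) (subst T (sym eq) _))) ≤-refl) (<⇒≱ le)

  -- Writing i as `k + (1 + q)` starts `k` at the diagonal of the recursion, where the value is
  -- explicit; above it the recursion averages two increments that are nonnegative by induction.
  a-mono′ : ∀ q k → a (2 + q) r (k + (1 + q)) ℚ.≤ a (2 + q) r (suc (k + (1 + q)))
  a-mono′ zero k = ≤-+ (geometric r (k + 1)) (1/r^ (k + 1))
      (ℚ.nonNegative⁻¹ _ {{ℚ.normalize-nonNeg 1 (r ^ (k + 1)) {{m^n≢0 r (k + 1)}}}})
    where
    ≤-+ : ∀ x y → 0ℚ ℚ.≤ y → x ℚ.≤ x ℚ.+ y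
    ≤-+ x y 0≤y = subst (ℚ._≤ x ℚ.+ y) (ℚ.+-identityʳ x) (ℚ.+-monoʳ-≤ x 0≤y)
  a-mono′ (suc q) (suc k) =
    subst₂ ℚ._≤_ (sym (a-suc q i (m≤n+m (2 + q) k))) (sym (a-suc q (suc i) (m≤n⇒m≤1+n (m≤n+m (2 + q) k))))
      (ℚ.+-monoˡ-≤ 1ℚ (ℚ.+-mono-≤
        (ℚ.*-monoˡ-≤-nonNeg ½ (subst (λ i → a (2 + q) r i ℚ.≤ a (2 + q) r (suc i)) (sym (+-suc k (1 + q))) (a-mono′ q (suc k))))
        (ℚ.*-monoˡ-≤-nonNeg ½ (a-mono′ (suc q) k))))
    where
    i = k + (2 + q)
  -- On the diagonal, with x = q + 1, the next value is at least x/2 + (1 + x)/2 + 1, which exceeds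
  -- the value 1 + x by ½.
  a-mono′ (suc q) zero = subst₂ ℚ._≤_ (sym (a-base (suc q))) (sym (a-suc q (2 + q) ≤-refl)) (begin
    fromℕ (2 + q)                                                       ≡⟨ fromℕ-+ 1 (1 + q) ⟩
    1ℚ ℚ.+ x                                                            ≡⟨ ℚ.+-identityʳ _ ⟨
    1ℚ ℚ.+ x ℚ.+ 0ℚ                                                     ≤⟨ ℚ.+-monoʳ-≤ (1ℚ ℚ.+ x) (ℚ.nonNegative⁻¹ ½) ⟩
    1ℚ ℚ.+ x ℚ.+ ½                                                      ≡⟨ halves x ⟩
    ½ ℚ.* x ℚ.+ ½ ℚ.* (1ℚ ℚ.+ x) ℚ.+ 1ℚ
      ≡⟨ cong₂ (λ u v → ½ ℚ.* u ℚ.+ ½ ℚ.* v ℚ.+ 1ℚ) (sym (a-base q)) (trans (sym (fromℕ-+ 1 (1 + q))) (sym (a-base (suc q)))) ⟩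
    ½ ℚ.* a (2 + q) r (1 + q) ℚ.+ ½ ℚ.* a (3 + q) r (2 + q) ℚ.+ 1ℚ
      ≤⟨ ℚ.+-monoˡ-≤ 1ℚ (ℚ.+-monoˡ-≤ (½ ℚ.* a (3 + q) r (2 + q)) (ℚ.*-monoˡ-≤-nonNeg ½ (a-mono′ q 0))) ⟩
    ½ ℚ.* a (2 + q) r (2 + q) ℚ.+ ½ ℚ.* a (3 + q) r (2 + q) ℚ.+ 1ℚ      ∎)
    where
    open ℚ.≤-Reasoning
    open +-*-Solver
    x = fromℕ (1 + q)
    halves : ∀ x → 1ℚ ℚ.+ x ℚ.+ ½ ≡ ½ ℚ.* x ℚ.+ ½ ℚ.* (1ℚ ℚ.+ x) ℚ.+ 1ℚ
    halves = solve 1 (λ x → con 1ℚ :+ x :+ con ½ := con ½ :* x :+ con ½ :* (con 1ℚ :+ x) :+ con 1ℚ) refl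

  a-mono : ∀ q i → 1 + q ≤ i → a (2 + q) r i ℚ.≤ a (2 + q) r (suc i)
  a-mono q i le = subst (λ i → a (2 + q) r i ℚ.≤ a (2 + q) r (suc i)) (m∸n+n≡m le) (a-mono′ q (i ∸ (1 + q)))

-- Estimates with the exponents of the theorem

-- Here p = q + 2 and β/M is the exponent a. The field `sums` makes the estimate homogeneous of
-- degree i in d and m together, so that α/M is i - a.
record Estimate (q r i : ℕ) .{{_ : NonZero r}} : Set₁ where
  field
    M α β C  : ℕ
    M≢0      : NonZero M
    sums     : α + β ≡ i * M
    exponent : a (2 + q) r i ℚ.* fromℕ M ≡ fromℕ β
    estimate : CliqueEstimate q r i M α β C

base-estimate : ∀ q r .{{_ : NonZero r}} → Estimate q r (1 + q)
base-estimate q r = record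
  { M = 1 ; α = 0 ; β = 1 + q ; C = 1
  ; M≢0 = _
  ; sums = sym (*-identityʳ (1 + q))
  ; exponent = trans (ℚ.*-identityʳ (a (2 + q) r (1 + q))) (a-base r q)
  ; estimate = trivial-estimate q r (1 + q)
  }

estimate-degenerate : ∀ t i → 1 ≤ t → Estimate 0 (suc t) i → Estimate 0 (suc t) (suc i)
estimate-degenerate t i 1≤t e = record
  { M = M * r ; α = α * r + t * β ; β = M * r + β ; C = proj₁ step
  ; M≢0 = m*n≢0 M r {{M≢0}}
  ; sums = trans (shuffle α β t M) (trans (cong (λ s → s * r + M * r) sums) (collect i M r))
  ; exponent = begin
      geometric r (suc i) ℚ.* fromℕ (M * r)                   ≡⟨ cong (geometric r (suc i) ℚ.*_) (fromℕ-* M r) ⟩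
      geometric r (suc i) ℚ.* (fromℕ M ℚ.* fromℕ r)           ≡⟨ rotate (geometric r (suc i)) (fromℕ M) (fromℕ r) ⟩
      fromℕ r ℚ.* geometric r (suc i) ℚ.* fromℕ M             ≡⟨ cong (ℚ._* fromℕ M) (r*geometric r i) ⟩
      (geometric r i ℚ.+ fromℕ r) ℚ.* fromℕ M                 ≡⟨ distrib (geometric r i) (fromℕ r) (fromℕ M) ⟩
      fromℕ M ℚ.* fromℕ r ℚ.+ geometric r i ℚ.* fromℕ M       ≡⟨ cong₂ ℚ._+_ (sym (fromℕ-* M r)) exponent ⟩
      fromℕ (M * r) ℚ.+ fromℕ β                               ≡⟨ fromℕ-+ (M * r) β ⟨
      fromℕ (M * r + β)                                       ∎
  ; estimate = proj₂ step
  }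
  where
  open Estimate e
  open ≡-Reasoning
  r = suc t
  step = degeneracy-step t {i} {M} {α} {β} {C} 1≤t {{M≢0}} estimate
  shuffle : ∀ α β t M → α * (1 + t) + t * β + (M * (1 + t) + β) ≡ (α + β) * (1 + t) + M * (1 + t)
  shuffle = solve-∀
  collect : ∀ i M r → i * M * r + M * r ≡ (1 + i) * (M * r)
  collect = solve-∀
  open +-*-Solver using (solve; _:+_; _:*_; _:=_)
  rotate : ∀ x y z → x ℚ.* (y ℚ.* z) ≡ z ℚ.* x ℚ.* y
  rotate = solve 3 (λ x y z → x :* (y :* z) := z :* x :* y) refl
  distrib : ∀ x y z → (x ℚ.+ y) ℚ.* z ≡ z ℚ.* y ℚ.+ x ℚ.* z
  distrib = solve 3 (λ x y z → (x :+ y) :* z := z :* y :+ x :* z) refl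

estimate-suspend : ∀ q r i .{{_ : NonZero r}} → 2 ≤ r → 2 + q ≤ i →
                   Estimate q r i → Estimate (suc q) r i → Estimate (suc q) r (suc i)
estimate-suspend q r i 2≤r le e₁ e₂ = record
  { M = 2 * (M₁ * M₂) ; α = α₂ * M₁ + α₁ * M₂ ; β = β₂ * M₁ + β₁ * M₂ + 2 * (M₁ * M₂) ; C = proj₁ step
  ; M≢0 = m*n≢0 2 (M₁ * M₂) {{_}} {{m*n≢0 M₁ M₂ {{M₁≢0}} {{M₂≢0}}}}
  ; sums = trans (shuffle (α₂ * M₁) (α₁ * M₂) (β₂ * M₁) (β₁ * M₂) (2 * (M₁ * M₂)))
      (trans (cong₂ (λ a b → a + b + 2 * (M₁ * M₂))
          (trans (sym (*-distribʳ-+ M₁ α₂ β₂)) (cong (_* M₁) sums₂))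
          (trans (sym (*-distribʳ-+ M₂ α₁ β₁)) (cong (_* M₂) sums₁)))
        (collect i M₁ M₂))
  ; exponent = trans (cong (ℚ._* fromℕ (2 * (M₁ * M₂))) (a-suc r q i le)) average
  ; estimate = proj₂ step
  }
  where
  open Estimate e₁ renaming (M to M₁; α to α₁; β to β₁; C to C₁; M≢0 to M₁≢0; sums to sums₁; exponent to exponent₁; estimate to estimate₁)
  open Estimate e₂ renaming (M to M₂; α to α₂; β to β₂; C to C₂; M≢0 to M₂≢0; sums to sums₂; exponent to exponent₂; estimate to estimate₂)
  open +-*-Solver using (solve; con; _:+_; _:*_; _:=_)
  m₁ m₂ x y : ℚ
  m₁ = fromℕ M₁
  m₂ = fromℕ M₂
  x = a (2 + q) r i
  y = a (3 + q) r i
  shuffle : ∀ a b c e l → a + b + (c + e + l) ≡ (a + c) + (b + e) + l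
  shuffle = solve-∀
  collect : ∀ i a b → i * b * a + i * a * b + 2 * (a * b) ≡ (1 + i) * (2 * (a * b))
  collect = solve-∀
  fromℕ-2* : ∀ k l → fromℕ (2 * (k * l)) ≡ fromℕ 2 ℚ.* (fromℕ k ℚ.* fromℕ l)
  fromℕ-2* k l = trans (fromℕ-* 2 (k * l)) (cong (fromℕ 2 ℚ.*_) (fromℕ-* k l))
  expand : ∀ x y m₁ m₂ → (½ ℚ.* x ℚ.+ ½ ℚ.* y ℚ.+ 1ℚ) ℚ.* (fromℕ 2 ℚ.* (m₁ ℚ.* m₂)) ≡
                         y ℚ.* m₂ ℚ.* m₁ ℚ.+ x ℚ.* m₁ ℚ.* m₂ ℚ.+ fromℕ 2 ℚ.* (m₁ ℚ.* m₂)
  expand = solve 4 (λ x y m₁ m₂ → (con ½ :* x :+ con ½ :* y :+ con 1ℚ) :* (con (fromℕ 2) :* (m₁ :* m₂)) :=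
                                  y :* m₂ :* m₁ :+ x :* m₁ :* m₂ :+ con (fromℕ 2) :* (m₁ :* m₂)) refl
  average : (½ ℚ.* x ℚ.+ ½ ℚ.* y ℚ.+ 1ℚ) ℚ.* fromℕ (2 * (M₁ * M₂)) ≡ fromℕ (β₂ * M₁ + β₁ * M₂ + 2 * (M₁ * M₂))
  average = begin
    (½ ℚ.* x ℚ.+ ½ ℚ.* y ℚ.+ 1ℚ) ℚ.* fromℕ (2 * (M₁ * M₂))
      ≡⟨ cong ((½ ℚ.* x ℚ.+ ½ ℚ.* y ℚ.+ 1ℚ) ℚ.*_) (fromℕ-2* M₁ M₂) ⟩
    (½ ℚ.* x ℚ.+ ½ ℚ.* y ℚ.+ 1ℚ) ℚ.* (fromℕ 2 ℚ.* (m₁ ℚ.* m₂))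
      ≡⟨ expand x y m₁ m₂ ⟩
    y ℚ.* m₂ ℚ.* m₁ ℚ.+ x ℚ.* m₁ ℚ.* m₂ ℚ.+ fromℕ 2 ℚ.* (m₁ ℚ.* m₂)
      ≡⟨ cong₂ (λ u v → u ℚ.* m₁ ℚ.+ v ℚ.* m₂ ℚ.+ fromℕ 2 ℚ.* (m₁ ℚ.* m₂)) exponent₂ exponent₁ ⟩
    fromℕ β₂ ℚ.* m₁ ℚ.+ fromℕ β₁ ℚ.* m₂ ℚ.+ fromℕ 2 ℚ.* (m₁ ℚ.* m₂)
      ≡⟨ cong₂ ℚ._+_ (cong₂ ℚ._+_ (fromℕ-* β₂ M₁) (fromℕ-* β₁ M₂)) (fromℕ-2* M₁ M₂) ⟨
    fromℕ (β₂ * M₁) ℚ.+ fromℕ (β₁ * M₂) ℚ.+ fromℕ (2 * (M₁ * M₂))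
      ≡⟨ cong (ℚ._+ fromℕ (2 * (M₁ * M₂))) (fromℕ-+ (β₂ * M₁) (β₁ * M₂)) ⟨
    fromℕ (β₂ * M₁ + β₁ * M₂) ℚ.+ fromℕ (2 * (M₁ * M₂))
      ≡⟨ fromℕ-+ (β₂ * M₁ + β₁ * M₂) _ ⟨
    fromℕ (β₂ * M₁ + β₁ * M₂ + 2 * (M₁ * M₂)) ∎
    where open ≡-Reasoning
  mono : β₂ * M₁ ≤ β₁ * M₂ + 2 * (M₁ * M₂)
  mono = +-cancelˡ-≤ (β₂ * M₁) _ _ (fromℕ-cancel-≤ _ _ (begin
    fromℕ (β₂ * M₁ + β₂ * M₁)                         ≡⟨ trans (fromℕ-+ (β₂ * M₁) _) (cong₂ ℚ._+_ (fromℕ-* β₂ M₁) (fromℕ-* β₂ M₁)) ⟩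
    fromℕ β₂ ℚ.* m₁ ℚ.+ fromℕ β₂ ℚ.* m₁               ≡⟨ cong (λ u → u ℚ.* m₁ ℚ.+ u ℚ.* m₁) exponent₂ ⟨
    y ℚ.* m₂ ℚ.* m₁ ℚ.+ y ℚ.* m₂ ℚ.* m₁               ≡⟨ double y m₁ m₂ ⟩
    y ℚ.* (fromℕ 2 ℚ.* (m₁ ℚ.* m₂))                   ≡⟨ cong (y ℚ.*_) (fromℕ-2* M₁ M₂) ⟨
    y ℚ.* fromℕ (2 * (M₁ * M₂))
      ≤⟨ ℚ.*-monoʳ-≤-nonNeg (fromℕ (2 * (M₁ * M₂))) {{ℚ.normalize-nonNeg (2 * (M₁ * M₂)) 1}} (a-mono r (suc q) i le) ⟩
    a (3 + q) r (suc i) ℚ.* fromℕ (2 * (M₁ * M₂))     ≡⟨ cong (ℚ._* fromℕ (2 * (M₁ * M₂))) (a-suc r q i le) ⟩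
    (½ ℚ.* x ℚ.+ ½ ℚ.* y ℚ.+ 1ℚ) ℚ.* fromℕ (2 * (M₁ * M₂))  ≡⟨ average ⟩
    fromℕ (β₂ * M₁ + β₁ * M₂ + 2 * (M₁ * M₂))         ≡⟨ cong fromℕ (+-assoc (β₂ * M₁) _ _) ⟩
    fromℕ (β₂ * M₁ + (β₁ * M₂ + 2 * (M₁ * M₂)))       ∎))
    where
    open ℚ.≤-Reasoning
    double : ∀ y m₁ m₂ → y ℚ.* m₂ ℚ.* m₁ ℚ.+ y ℚ.* m₂ ℚ.* m₁ ≡ y ℚ.* (fromℕ 2 ℚ.* (m₁ ℚ.* m₂))
    double = solve 3 (λ y m₁ m₂ → y :* m₂ :* m₁ :+ y :* m₂ :* m₁ := y :* (con (fromℕ 2) :* (m₁ :* m₂))) refl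
  step = suspension-step {q} {r} {i} {M₁} {α₁} {β₁} {C₁} {M₂} {α₂} {β₂} {C₂} 2≤r {{M₁≢0}} {{M₂≢0}} sums₁ sums₂ mono estimate₁ estimate₂

-- The induction follows the recursion for a: for fixed i, the summand with p - 1 has the same
-- `suc k` and smaller `q`, while the summand with the same p has smaller `k`.
clique-estimate′ : ∀ q r k .{{_ : NonZero r}} → 2 ≤ r → Estimate q r (k + (1 + q))
clique-estimate′ q       r       zero    2≤r       = base-estimate q r
clique-estimate′ zero    (suc t) (suc k) (s≤s 1≤t) = estimate-degenerate t _ 1≤t (clique-estimate′ zero (suc t) k (s≤s 1≤t))
clique-estimate′ (suc q) r       (suc k) 2≤r       = estimate-suspend q r (k + (2 + q)) 2≤r (m≤n+m (2 + q) k)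
  (subst (λ i → Estimate q r i) (sym (+-suc k (1 + q))) (clique-estimate′ q r (suc k) 2≤r)) (clique-estimate′ (suc q) r k 2≤r)

clique-estimate : ∀ q r i .{{_ : NonZero r}} → 2 ≤ r → 1 + q ≤ i → Estimate q r i
clique-estimate q r i 2≤r le = subst (λ i → Estimate q r i) (m∸n+n≡m le) (clique-estimate′ q r (i ∸ (1 + q)) 2≤r)

complement-exponent : ∀ {i M α β} y → α + β ≡ i * M → y ℚ.* fromℕ M ≡ fromℕ β →
                      (fromℕ i ℚ.- y) ℚ.* fromℕ M ≡ fromℕ α
complement-exponent {i} {M} {α} {β} y sums yM≡β = begin
  (fromℕ i ℚ.- y) ℚ.* fromℕ M                   ≡⟨ distrib (fromℕ i) y (fromℕ M) ⟩
  fromℕ i ℚ.* fromℕ M ℚ.- y ℚ.* fromℕ M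
    ≡⟨ cong₂ ℚ._-_ (trans (sym (fromℕ-* i M)) (trans (cong fromℕ (sym sums)) (fromℕ-+ α β))) yM≡β ⟩
  fromℕ α ℚ.+ fromℕ β ℚ.- fromℕ β               ≡⟨ cancel (fromℕ α) (fromℕ β) ⟩
  fromℕ α                                       ∎
  where
  open ≡-Reasoning
  open +-*-Solver using (solve; _:+_; _:*_; _:-_; _:=_)
  distrib : ∀ x y z → (x ℚ.- y) ℚ.* z ≡ x ℚ.* z ℚ.- y ℚ.* z
  distrib = solve 3 (λ x y z → (x :- y) :* z := x :* z :- y :* z) refl
  cancel : ∀ x y → x ℚ.+ y ℚ.- y ≡ x
  cancel = solve 2 (λ x y → x :+ y :- y := x) refl

-- The M-th powers of the estimate and the common denominator N in the statement are reconciled by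
-- comparing MN-th powers and then taking M-th roots. The bound C^N ≤ (C^N)^M keeps `C` itself as
-- the constant.
≤·^-intro : ∀ {x i C d n M α β} .{{_ : NonZero M}} y → α + β ≡ i * M → y ℚ.* fromℕ M ≡ fromℕ β →
            x ^ M ≤ C * (d ^ α * n ^ β) → x ≤ C · d ^[ fromℕ i ℚ.- y ]· n ^[ y ]
≤·^-intro {x} {i} {C} {d} {n} {M} {α} {β} y sums yM≡β le = ^-cancel-≤ M _ _ (begin
  (x ^ N) ^ M                                    ≡⟨ trans (^-*-assoc x N M) (trans (cong (x ^_) (*-comm N M)) (sym (^-*-assoc x M N))) ⟩
  (x ^ M) ^ N                                    ≤⟨ ^-monoˡ-≤ N le ⟩
  (C * (d ^ α * n ^ β)) ^ N                      ≡⟨ ^-distrib-monomial C d α n β N ⟩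
  C ^ N * (d ^ (α * N) * n ^ (β * N))            ≤⟨ *-monoˡ-≤ _ (m≤m^n (C ^ N) M) ⟩
  (C ^ N) ^ M * (d ^ (α * N) * n ^ (β * N))      ≡⟨ cong₂ (λ s t → (C ^ N) ^ M * (d ^ s * n ^ t)) αN βN ⟨
  (C ^ N) ^ M * (d ^ (A * M) * n ^ (B * M))      ≡⟨ ^-distrib-monomial (C ^ N) d A n B M ⟨
  (C ^ N * (d ^ A * n ^ B)) ^ M                  ≡⟨ cong (_^ M) (*-assoc (C ^ N) _ _) ⟨
  (C ^ N * d ^ A * n ^ B) ^ M                    ∎)
  where
  open ≤-Reasoning
  z = fromℕ i ℚ.- y
  N = ↧ₙ z * ↧ₙ y
  A = ℤ.∣ ↥ z ∣ * ↧ₙ y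
  B = ℤ.∣ ↥ y ∣ * ↧ₙ z
  zM≡α = complement-exponent {i} {M} {α} {β} y sums yM≡β
  αN : A * M ≡ α * N
  αN = trans (right ℤ.∣ ↥ z ∣ (↧ₙ y) M) (trans (cong (_* ↧ₙ y) (numerator z M α zM≡α)) (*-assoc α _ _))
    where
    right : ∀ a b c → a * b * c ≡ a * c * b
    right = solve-∀
  βN : B * M ≡ β * N
  βN = trans (right ℤ.∣ ↥ y ∣ (↧ₙ z) M) (trans (cong (_* ↧ₙ z) (numerator y M β yM≡β))
      (trans (*-assoc β _ _) (cong (β *_) (*-comm (↧ₙ y) (↧ₙ z)))))
    where
    right : ∀ a b c → a * b * c ≡ a * c * b
    right = solve-∀

-- Flag complexes

graph : ∀ {n} → Complex n → Graph
graph {n} Γ = record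
  { V = Fin n
  ; _≟_ = Fin._≟_
  ; adj = adj
  ; adj-sym = λ u v → cong₂ (λ p q → not p ∧ q) (≟-sym u v) (cong (does ∘ face? Γ) (∪-comm ⁅ u ⁆ ⁅ v ⁆))
  ; adj-irrefl = λ v → cong (λ b → not b ∧ does (face? Γ (⁅ v ⁆ ∪ ⁅ v ⁆))) (dec-true (v Fin.≟ v) refl)
  }
  where
  adj : Fin n → Fin n → Bool
  -- For u = v the union is a singleton, which is a face of a flag complex, so loops have to be
  -- excluded separately.
  adj u v = not (does (u Fin.≟ v)) ∧ does (face? Γ (⁅ u ⁆ ∪ ⁅ v ⁆))
  ≟-sym : ∀ (u v : Fin n) → does (u Fin.≟ v) ≡ does (v Fin.≟ u)
  ≟-sym u v with v Fin.≟ u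
  ... | yes v≡u = dec-true (u Fin.≟ v) (sym v≡u)
  ... | no  v≢u = dec-false (u Fin.≟ v) (v≢u ∘ sym)

module FlagComplex {n} (Γ : Complex n) (flag : Flag Γ) where

  open Cliques (graph Γ) hiding (_≟_)
  open Paths (graph Γ)

  adj⇒face : ∀ {u v} → T (adj u v) → Face Γ (⁅ u ⁆ ∪ ⁅ v ⁆)
  adj⇒face {u} {v} t with u Fin.≟ v | face? Γ (⁅ u ⁆ ∪ ⁅ v ⁆)
  ... | no _ | yes uv∈Γ = uv∈Γ

  face⇒adj : ∀ {F u v} → Face Γ F → u ∈ₛ F → v ∈ₛ F → u ≢ v → T (adj u v)
  face⇒adj {F} {u} {v} F∈Γ u∈ v∈ u≢v with u Fin.≟ v | face? Γ (⁅ u ⁆ ∪ ⁅ v ⁆)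
  ... | yes u≡v | _        = contradiction u≡v u≢v
  ... | no _    | yes _    = tt
  ... | no _    | no uv∉Γ  = contradiction (down-closed Γ uv⊆F F∈Γ) uv∉Γ
    where
    uv⊆F : ⁅ u ⁆ ∪ ⁅ v ⁆ ⊆ₛ F
    uv⊆F x∈ with ∈∪⁅⁆⁻ ⁅ u ⁆ v x∈
    ... | inj₁ x∈u with refl ← x∈⁅y⁆⇒x≡y u x∈u = u∈
    ... | inj₂ refl = v∈

  adjacent⇒face : ∀ F → (∀ {u v} → u ∈ₛ F → v ∈ₛ F → u ≢ v → T (adj u v)) → Face Γ F
  adjacent⇒face F pairwise = flag F λ E size E⊆F →
    let x , y , x∈ , y∈ , y≢x , E≡ = pair E size in
    subst (Face Γ) (sym E≡) (adj⇒face (pairwise (E⊆F y∈) (E⊆F x∈) y≢x))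

  fromList-face : ∀ {c} → Clique c → Face Γ (fromList c)
  fromList-face {c} cl = adjacent⇒face (fromList c) λ u∈ v∈ → go cl (∈-fromList⁻ c u∈) (∈-fromList⁻ c v∈)
    where
    go : ∀ {c u v} → Clique c → u ∈ c → v ∈ c → u ≢ v → T (adj u v)
    go (a ∷ cl) (here refl) (here refl) u≢v = contradiction refl u≢v
    go (a ∷ cl) (here refl) (there v∈)  u≢v = All.lookup a v∈
    go {v = v} (a ∷ cl) (there u∈)  (here refl) u≢v = Tadj-sym {v} (All.lookup a u∈)
    go (a ∷ cl) (there u∈)  (there v∈)  u≢v = go cl u∈ v∈ u≢v

  ∣fromList∣-clique : ∀ {c} → Clique c → length c ≤ ∣ fromList c ∣
  ∣fromList∣-clique []                   = z≤n
  ∣fromList∣-clique {x ∷ c} (a ∷ cl) = ≤-trans (s≤s (∣fromList∣-clique cl))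
    (≤-reflexive (sym (∣p∪x∣≡1+∣p∣ (fromList c) x λ x∈ → adj⇒≢ {x} (All.lookup a (∈-fromList⁻ c x∈)) refl)))

  InducedPath⇒Linked : ∀ xs → InducedPath xs → Linked (λ x y → T (adj x y)) xs
  InducedPath⇒Linked []           _           = []
  InducedPath⇒Linked (x ∷ [])     _           = [-]
  InducedPath⇒Linked (x ∷ y ∷ xs) (a , _ , p) = a ∷ InducedPath⇒Linked (y ∷ xs) p

  first-neighbour : ∀ x y ys → InducedPath (x ∷ y ∷ ys) → ∀ {v} → v ∈ x ∷ y ∷ ys → T (adj x v) → v ≡ y
  first-neighbour x y ys _             (here refl)         x~v = contradiction refl (adj⇒≢ {x} x~v)
  first-neighbour x y ys _             (there (here v≡y))  x~v = v≡y
  first-neighbour x y ys (_ , far , _) (there (there v∈))  x~v = contradiction x~v (far⇒¬adj {x} (All.lookup far v∈))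

  TriangleFree : List (Fin n) → Set
  TriangleFree xs = ∀ {u v w} → u ∈ xs → v ∈ xs → w ∈ xs → u ≢ v → u ≢ w → v ≢ w →
                    T (adj u v) → T (adj u w) → ¬ T (adj v w)

  triangleFree-∷ : ∀ x xs → (∀ {v w} → v ∈ x ∷ xs → w ∈ x ∷ xs → v ≢ w → T (adj x v) → T (adj x w) → ¬ T (adj v w)) →
                   TriangleFree xs → TriangleFree (x ∷ xs)
  triangleFree-∷ x xs no∆ tf (here refl) v∈ w∈ u≢v u≢w v≢w u~v u~w v~w = no∆ v∈ w∈ v≢w u~v u~w v~w
  triangleFree-∷ x xs no∆ tf u∈@(there _) (here refl) w∈ u≢v u≢w v≢w u~v u~w v~w = no∆ u∈ w∈ u≢w (Tadj-sym {w = x} u~v) v~w u~w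
  triangleFree-∷ x xs no∆ tf {u} {v} u∈@(there _) v∈@(there _) (here refl) u≢v u≢w v≢w u~v u~w v~w =
    no∆ u∈ v∈ u≢v (Tadj-sym {u} u~w) (Tadj-sym {v} v~w) u~v
  triangleFree-∷ x xs no∆ tf (there u∈) (there v∈) (there w∈) = tf u∈ v∈ w∈

  path-triangleFree : ∀ xs → InducedPath xs → TriangleFree xs
  path-triangleFree (x ∷ []) p (here refl) (here refl) w∈ u≢v = contradiction refl u≢v
  path-triangleFree (x ∷ y ∷ xs) p = triangleFree-∷ x (y ∷ xs)
    (λ v∈ w∈ v≢w x~v x~w _ → v≢w (trans (first-neighbour x y xs p v∈ x~v) (sym (first-neighbour x y xs p w∈ x~w))))
    (path-triangleFree (y ∷ xs) (proj₂ (proj₂ p)))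

  -- The only neighbours of `x` on the cycle are `p` and `z`, which are far as `q` lies between
  -- them; a triangle without `x` would lie in an induced path.
  cycle-triangleFree : ∀ x p q ps z → InducedPath (x ∷ p ∷ q ∷ ps) → InducedPath (p ∷ q ∷ ps ∷ʳ z) →
                       TriangleFree (x ∷ p ∷ q ∷ ps ∷ʳ z)
  cycle-triangleFree x p q ps z ip₁ ip₂ = triangleFree-∷ x (p ∷ q ∷ ps ∷ʳ z)
    (λ v∈ w∈ v≢w x~v x~w v~w → no∆ (neighbour v∈ x~v) (neighbour w∈ x~w) v≢w v~w)
    (path-triangleFree (p ∷ q ∷ ps ∷ʳ z) ip₂)
    where
    neighbour : ∀ {v} → v ∈ x ∷ p ∷ q ∷ ps ∷ʳ z → T (adj x v) → v ≡ p ⊎ v ≡ z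
    neighbour v∈ x~v with ∈-++⁻ (x ∷ p ∷ q ∷ ps) v∈
    ... | inj₁ v∈′         = inj₁ (first-neighbour x p (q ∷ ps) ip₁ v∈′ x~v)
    ... | inj₂ (here v≡z)  = inj₂ v≡z
    p≁z : ¬ T (adj p z)
    p≁z = far⇒¬adj {p} (All.lookup (proj₁ (proj₂ ip₂)) (∈-++⁺ʳ ps (here refl)))
    no∆ : ∀ {v w} → v ≡ p ⊎ v ≡ z → w ≡ p ⊎ w ≡ z → v ≢ w → ¬ T (adj v w)
    no∆ (inj₁ refl) (inj₁ refl) v≢w _   = v≢w refl
    no∆ (inj₁ refl) (inj₂ refl) _   v~w = p≁z v~w
    no∆ (inj₂ refl) (inj₁ refl) _   v~w = p≁z (Tadj-sym {z} v~w)
    no∆ (inj₂ refl) (inj₂ refl) v≢w _   = v≢w refl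

  -- Suspended induced cycles as homology classes

  module _ {c ℓ₁ ℓ₂} (k : HeytingField c ℓ₁ ℓ₂) where

    open Chains k

    cycle-TopCycle : ∀ x p q ps z → InducedPath (x ∷ p ∷ q ∷ ps) → InducedPath (p ∷ q ∷ ps ∷ʳ z) → T (adj x z) →
                     TopCycle Γ (fromList (x ∷ p ∷ q ∷ ps ∷ʳ z)) 1
    cycle-TopCycle x p q ps z ip₁ ip₂ x~z = record
      { chain   = cycleChain x (p ∷ q ∷ ps) z
      ; support = λ F ¬good → ⊞-zero {F = F} (edge z x) (pathChain vs)
          (edge-support (not-edge F ¬good x~z (here refl) z∈))
          (pathChain-support F vs (not-edges F ¬good vs id linked))
      ; cycle   = ∂-cycleChain x (p ∷ q ∷ ps) z (Linked.map (λ {u} → adj⇒≢ {u}) linked) x≢z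
      ; simplex = ⁅ x ⁆ ∪ ⁅ z ⁆
      ; nonzero = cycleChain-nonzero x p (q ∷ ps) z x≢z z≢p x≢
      ; top     = small
      }
      where
      vs : List (Fin n)
      vs = x ∷ p ∷ q ∷ ps ∷ʳ z
      W : Subset n
      W = fromList vs
      z∈ : z ∈ vs
      z∈ = ∈-++⁺ʳ (x ∷ p ∷ q ∷ ps) (here refl)
      x≢z : x ≢ z
      x≢z = adj⇒≢ {x} x~z
      z≢p : z ≢ p
      z≢p = far⇒≢ {p} (All.lookup (proj₁ (proj₂ ip₂)) (∈-++⁺ʳ ps (here refl))) ∘ sym
      linked : Linked (λ u v → T (adj u v)) vs
      linked = proj₁ ip₁ ∷ InducedPath⇒Linked (p ∷ q ∷ ps ∷ʳ z) ip₂
      x≢ : ∀ {y} → y ∈ p ∷ q ∷ ps ∷ʳ z → x ≢ y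
      x≢ y∈ with ∈-++⁻ (p ∷ q ∷ ps) y∈
      ... | inj₁ (here refl)  = adj⇒≢ {x} (proj₁ ip₁)
      ... | inj₁ (there y∈′)  = far⇒≢ {x} (All.lookup (proj₁ (proj₂ ip₁)) y∈′)
      ... | inj₂ (here refl)  = x≢z
      not-edge : ∀ F → ¬ (Face Γ F × F ⊆ₛ W × ∣ F ∣ ≡ 2) → ∀ {u v} → T (adj u v) → u ∈ vs → v ∈ vs → F ≢ ⁅ u ⁆ ∪ ⁅ v ⁆
      not-edge F ¬good {u} {v} u~v u∈ v∈ refl = ¬good (adj⇒face u~v , F⊆W ,
        trans (∣p∪x∣≡1+∣p∣ ⁅ u ⁆ v λ v∈u → adj⇒≢ {u} u~v (sym (x∈⁅y⁆⇒x≡y u v∈u))) (cong suc (∣⁅x⁆∣≡1 u)))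
        where
        F⊆W : ⁅ u ⁆ ∪ ⁅ v ⁆ ⊆ₛ W
        F⊆W y∈ with ∈∪⁅⁆⁻ ⁅ u ⁆ v y∈
        ... | inj₁ y∈u with refl ← x∈⁅y⁆⇒x≡y u y∈u = ∈-fromList⁺ u∈
        ... | inj₂ refl = ∈-fromList⁺ v∈
      not-edges : ∀ F → ¬ (Face Γ F × F ⊆ₛ W × ∣ F ∣ ≡ 2) → ∀ us → (∀ {u} → u ∈ us → u ∈ vs) →
                  Linked (λ u v → T (adj u v)) us → Linked (λ u v → F ≢ ⁅ v ⁆ ∪ ⁅ u ⁆) us
      not-edges F ¬good []           sub []        = []
      not-edges F ¬good (u ∷ [])     sub [-]       = [-]
      not-edges F ¬good (u ∷ v ∷ us) sub (u~v ∷ l) =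
        not-edge F ¬good (Tadj-sym {u} u~v) (sub (there (here refl))) (sub (here refl)) ∷ not-edges F ¬good (v ∷ us) (sub ∘ there) l
      small : ∀ F → Face Γ F → F ⊆ₛ W → ∣ F ∣ ≤ 2
      small F F∈Γ F⊆W with ∣ F ∣ ≤? 2
      ... | yes le = le
      ... | no  ≰2 with u , v , w , u∈ , v∈ , w∈ , u≢v , u≢w , v≢w ← three-elements F (≰⇒> ≰2) =
        contradiction (face⇒adj F∈Γ v∈ w∈ v≢w)
          (cycle-triangleFree x p q ps z ip₁ ip₂ (in-vs u∈) (in-vs v∈) (in-vs w∈) u≢v u≢w v≢w
            (face⇒adj F∈Γ u∈ v∈ u≢v) (face⇒adj F∈Γ u∈ w∈ u≢w))
        where
        in-vs : ∀ {u} → u ∈ₛ F → u ∈ vs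
        in-vs u∈ = ∈-fromList⁻ vs (F⊆W u∈)

    -- No face contains both apexes because they are far, and a face without its apex lies in `W`;
    -- so the top dimension rises by exactly one. The join of an apex with a face in `W` is again a
    -- face since the complex is flag.
    suspend-TopCycle : ∀ {W D u w} → T (far u w) → (∀ {x} → x ∈ₛ W → T (adj u x)) → (∀ {x} → x ∈ₛ W → T (adj w x)) →
                       TopCycle Γ W D → TopCycle Γ ((W ∪ ⁅ u ⁆) ∪ ⁅ w ⁆) (suc D)
    suspend-TopCycle {W} {D} {u} {w} u≁w u~W w~W t = record
      { chain   = suspension u w chain
      ; support = λ F ¬good → ⊞-zero {F = F} (cone u chain) (⊟ cone w chain)
          (cone-zero {u = u} {F = F} chain (apex-support u~W (∈∪ˡ ∘ ∈∪ˡ) (∈∪ˡ (∈∪ʳ (x∈⁅x⁆ u))) F ¬good))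
          (⊟-zero {F = F} (cone w chain)
            (cone-zero {u = w} {F = F} chain (apex-support w~W (∈∪ˡ ∘ ∈∪ˡ) (∈∪ʳ (x∈⁅x⁆ w)) F ¬good)))
      ; cycle   = ∂-suspension chain (off u~W) (off w~W) cycle
      ; simplex = simplex ∪ ⁅ u ⁆
      ; nonzero = suspension-nonzero chain (nonzero ∘ off u~W simplex) (nonzero ∘ off w~W simplex) (far⇒≢ {u} u≁w) nonzero
      ; top     = small
      }
      where
      open TopCycle t
      W′ : Subset n
      W′ = (W ∪ ⁅ u ⁆) ∪ ⁅ w ⁆
      off : ∀ {v} → (∀ {x} → x ∈ₛ W → T (adj v x)) → OffStar v chain
      off {v} v~W F v∈F = support F λ (_ , F⊆W , _) → adj⇒≢ {v} (v~W (F⊆W v∈F)) refl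
      apex-support : ∀ {v} → (∀ {x} → x ∈ₛ W → T (adj v x)) → W ⊆ₛ W′ → v ∈ₛ W′ →
                     ∀ F → ¬ (Face Γ F × F ⊆ₛ W′ × ∣ F ∣ ≡ suc (suc D)) → v ∈ₛ F → _
      apex-support {v} v~W W⊆W′ v∈W′ F ¬good v∈F = support (F - v) λ (F-v∈Γ , F-v⊆W , size) → ¬good
        ( adjacent⇒face F (pairwise F-v∈Γ F-v⊆W)
        , (λ {x} x∈F → in-W′ F-v⊆W x∈F)
        , trans (∣p∣≡1+∣p-x∣ v∈F) (cong suc size))
        where
        in-W′ : F - v ⊆ₛ W → F ⊆ₛ W′
        in-W′ F-v⊆W {x} x∈F with x Fin.≟ v
        ... | yes refl = v∈W′
        ... | no  x≢v  = W⊆W′ (F-v⊆W (x∈p∧x≢y⇒x∈p-y x∈F x≢v))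
        pairwise : Face Γ (F - v) → F - v ⊆ₛ W → ∀ {x y} → x ∈ₛ F → y ∈ₛ F → x ≢ y → T (adj x y)
        pairwise F-v∈Γ F-v⊆W {x} {y} x∈ y∈ x≢y with x Fin.≟ v | y Fin.≟ v
        ... | yes refl | yes refl = contradiction refl x≢y
        ... | yes refl | no  y≢v  = v~W (F-v⊆W (x∈p∧x≢y⇒x∈p-y y∈ y≢v))
        ... | no  x≢v  | yes refl = Tadj-sym {v} (v~W (F-v⊆W (x∈p∧x≢y⇒x∈p-y x∈ x≢v)))
        ... | no  x≢v  | no  y≢v  = face⇒adj F-v∈Γ (x∈p∧x≢y⇒x∈p-y x∈ x≢v) (x∈p∧x≢y⇒x∈p-y y∈ y≢v) x≢y
      small : ∀ F → Face Γ F → F ⊆ₛ W′ → ∣ F ∣ ≤ suc (suc D)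
      small F F∈Γ F⊆W′ with u ∈? F | w ∈? F
      ... | yes u∈ | yes w∈ = contradiction (face⇒adj F∈Γ u∈ w∈ (far⇒≢ {u} u≁w)) (far⇒¬adj {u} u≁w)
      ... | yes u∈ | no  w∉ = ≤-trans (≤-reflexive (∣p∣≡1+∣p-x∣ u∈))
        (s≤s (top (F - u) (down-closed Γ (p─q⊆p F ⁅ u ⁆) F∈Γ) λ {x} x∈ → let x∈F , x≢u = ∈-⁻ F u x∈ in
          [ (λ x∈Wu → [ id , (λ x≡u → contradiction x≡u x≢u) ]′ (∈∪⁅⁆⁻ W u x∈Wu))
          , (λ { refl → contradiction x∈F w∉ }) ]′ (∈∪⁅⁆⁻ (W ∪ ⁅ u ⁆) w (F⊆W′ x∈F))))
      ... | no  u∉ | yes w∈ = ≤-trans (≤-reflexive (∣p∣≡1+∣p-x∣ w∈))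
        (s≤s (top (F - w) (down-closed Γ (p─q⊆p F ⁅ w ⁆) F∈Γ) λ {x} x∈ → let x∈F , x≢w = ∈-⁻ F w x∈ in
          [ (λ x∈Wu → [ id , (λ { refl → contradiction x∈F u∉ }) ]′ (∈∪⁅⁆⁻ W u x∈Wu))
          , (λ x≡w → contradiction x≡w x≢w) ]′ (∈∪⁅⁆⁻ (W ∪ ⁅ u ⁆) w (F⊆W′ x∈F))))
      ... | no  u∉ | no  w∉ = m≤n⇒m≤1+n (top F F∈Γ λ {x} x∈F →
          [ (λ x∈Wu → [ id , (λ { refl → contradiction x∈F u∉ }) ]′ (∈∪⁅⁆⁻ W u x∈Wu))
          , (λ { refl → contradiction x∈F w∉ }) ]′ (∈∪⁅⁆⁻ (W ∪ ⁅ u ⁆) w (F⊆W′ x∈F)))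

    NoTopCycle : ℕ → ℕ → List (Fin n) → Set _
    NoTopCycle D s xs = ∀ W → (∀ {x} → x ∈ₛ W → x ∈ xs) → ∣ W ∣ ≤ s → ¬ TopCycle Γ W D

    -- An induced cycle suspended q times is a flag sphere of dimension q + 1.
    NoTopCycle⇒Hered : ∀ r q {xs} → NoTopCycle (suc q) (2 * (q + r)) xs → Hered (NoInducedCycle r) q xs
    NoTopCycle⇒Hered r zero    nt x []       z all ()
    NoTopCycle⇒Hered r zero    nt x (p ∷ []) z all (s≤s ())
    NoTopCycle⇒Hered r zero    nt x (p ∷ q ∷ ps) z all _ len ip₁ ip₂ x~z =
      nt (fromList vs) (λ y∈ → All.lookup all (∈-fromList⁻ vs y∈)) (≤-trans (∣fromList∣≤ vs) (≤-trans (≤-reflexive vs-length) len))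
        (cycle-TopCycle x p q ps z ip₁ ip₂ x~z)
      where
      vs = x ∷ p ∷ q ∷ ps ∷ʳ z
      arith : ∀ l → 3 + (l + 1) ≡ 2 + l + 2
      arith = solve-∀
      vs-length : length vs ≡ 2 + length ps + 2
      vs-length = trans (cong (3 +_) (length-++ ps)) (arith (length ps))
    NoTopCycle⇒Hered r (suc q) {xs} nt {u} {w} u∈ w∈ u≁w = NoTopCycle⇒Hered r q λ W W⊆ size t →
      nt ((W ∪ ⁅ u ⁆) ∪ ⁅ w ⁆)
        (λ y∈ → [ (λ y∈Wu → [ N-⊑ w xs ∘ N-⊑ u (N w xs) ∘ W⊆ , (λ { refl → u∈ }) ]′ (∈∪⁅⁆⁻ W u y∈Wu))
                , (λ { refl → w∈ }) ]′ (∈∪⁅⁆⁻ (W ∪ ⁅ u ⁆) w y∈))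
        (≤-trans (∣p∪x∣≤1+∣p∣ (W ∪ ⁅ u ⁆) w) (≤-trans (s≤s (∣p∪x∣≤1+∣p∣ W u))
          (≤-trans (s≤s (s≤s size)) (≤-reflexive (arith q r)))))
        (suspend-TopCycle u≁w (λ x∈ → proj₂ (∈N⁻ u (N w xs) (W⊆ x∈)))
          (λ x∈ → proj₂ (∈N⁻ w xs (proj₁ (∈N⁻ u (N w xs) (W⊆ x∈))))) t)
      where
      arith : ∀ q r → 2 + 2 * (q + r) ≡ 2 * (1 + q + r)
      arith = solve-∀

-- From face numbers to clique counts, and the theorem

open import Data.Integer using (+_; -_; 1ℤ) renaming (_-_ to _-ℤ_)
open import Data.Rational using () renaming (_-_ to _-ℚ_)
open import Relation.Binary.Construct.Add.Supremum.Strict _<_ using (_<⁺_; [_])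
open import Relation.Nullary.Construct.Add.Supremum using (_⁺; [_]; ⊤⁺)

∈-subsets : ∀ {n} (F : Subset n) → F ∈ subsets n
∈-subsets Vec.[] = here refl
∈-subsets (outside Vec.∷ F) = ∈-++⁺ˡ (∈-map⁺ (outside Vec.∷_) (∈-subsets F))
∈-subsets {suc n} (inside Vec.∷ F) = ∈-++⁺ʳ (map (outside Vec.∷_) (subsets n)) (∈-map⁺ (inside Vec.∷_) (∈-subsets F))

subsets-unique : ∀ n → Unique (subsets n)
subsets-unique zero    = [] ∷ []
subsets-unique (suc n) = Unique.++⁺ (Unique.map⁺ VecP.∷-injectiveʳ (subsets-unique n)) (Unique.map⁺ VecP.∷-injectiveʳ (subsets-unique n))
  λ (F∈out , F∈in) → let _ , _ , F≡out = ∈-map⁻ (outside Vec.∷_) F∈out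
                         _ , _ , F≡in  = ∈-map⁻ (inside Vec.∷_) F∈in
                     in contradiction (VecP.∷-injectiveˡ (trans (sym F≡out) F≡in)) λ ()

term≤∑ : ∀ {V : Set} {xs : List V} {x} (φ : V → ℕ) → x ∈ xs → φ x ≤ ∑ xs φ
term≤∑ φ (here refl) = m≤m+n _ _
term≤∑ φ (there x∈)  = ≤-trans (term≤∑ φ x∈) (m≤n+m _ _)

module FaceCount {n} (Γ : Complex n) (flag : Flag Γ) where

  open Cliques (graph Γ) hiding (_≟_)
  open FlagComplex Γ flag

  -- Every nonempty face has a vertex `x`, and removing `x` leaves a smaller face among the
  -- neighbours of `x`. Counting a face once for each of its vertices only enlarges the bound.
  length-faces≤cliques : ∀ i xs {Fs} → Unique Fs →
    (∀ {F} → F ∈ Fs → Face Γ F × (∀ {x} → x ∈ₛ F → x ∈ xs) × ∣ F ∣ ≡ i) → length Fs ≤ cliques i xs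
  length-faces≤cliques zero xs {[]}         _ _ = z≤n
  length-faces≤cliques zero xs {F ∷ []}     _ _ = s≤s z≤n
  length-faces≤cliques zero xs {F ∷ G ∷ Fs} ((F≢G ∷ _) ∷ _) good = contradiction
    (trans (∣∣≡0⇒≡∅ F (proj₂ (proj₂ (good (here refl))))) (sym (∣∣≡0⇒≡∅ G (proj₂ (proj₂ (good (there (here refl)))))))) F≢G
  length-faces≤cliques (suc i) xs {Fs} uniq good = begin
    length Fs                                                   ≡⟨ ∑-length Fs ⟨
    ∑ Fs (λ F → 1)                                              ≤⟨ ∑-mono Fs some-vertex ⟩
    ∑ Fs (λ F → ∑ xs (λ x → 𝟙[ does (x ∈? F) ]))                 ≡⟨ ∑-swap Fs xs _ ⟩
    ∑ xs (λ x → ∑ Fs (λ F → 𝟙[ does (x ∈? F) ]))                 ≡⟨ ∑-cong xs (λ {x} _ → length-filter-∑ Fs (λ F → does (x ∈? F))) ⟨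
    ∑ xs (λ x → length (star x))                                ≤⟨ ∑-mono xs (λ {x} _ → star≤ x) ⟩
    ∑ xs (λ x → cliques i (N x xs))                             ∎
    where
    open ≤-Reasoning
    star : Fin n → List (Subset n)
    star x = filterᵇ (λ F → does (x ∈? F)) Fs
    T⇒∈ : ∀ {x} {F : Subset n} → T (does (x ∈? F)) → x ∈ₛ F
    T⇒∈ {x} {F} t with x ∈? F
    ... | yes x∈ = x∈
    ∈⇒T : ∀ {x} {F : Subset n} → x ∈ₛ F → 1 ≤ 𝟙[ does (x ∈? F) ]
    ∈⇒T {x} {F} x∈ with x ∈? F
    ... | yes _  = ≤-refl
    ... | no  x∉ = contradiction x∈ x∉
    some-vertex : ∀ {F} → F ∈ Fs → 1 ≤ ∑ xs (λ x → 𝟙[ does (x ∈? F) ])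
    some-vertex {F} F∈ with _ , F⊆xs , size ← good F∈
      with x , x∈ ← nonempty F (≤-trans (s≤s z≤n) (≤-reflexive (sym size))) =
      ≤-trans (∈⇒T x∈) (term≤∑ _ (F⊆xs x∈))
    star≤ : ∀ x → length (star x) ≤ cliques i (N x xs)
    star≤ x = ≤-trans (≤-reflexive (sym (length-map (_- x) (star x))))
      (length-faces≤cliques i (N x xs) (Unique.map⁻ (subst Unique (sym restore) (Unique.filter⁺ (T? ∘ _) uniq))) good′)
      where
      ∈-star : ∀ {F} → F ∈ star x → F ∈ Fs × x ∈ₛ F
      ∈-star F∈ with F∈Fs , t ← ∈-filterᵇ⁻ (λ F → does (x ∈? F)) Fs F∈ = F∈Fs , T⇒∈ t
      -- Adding `x` back inverts its removal on the star, so distinct faces stay distinct after `x`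
      -- is removed.
      restore : map (_∪ ⁅ x ⁆) (map (_- x) (star x)) ≡ star x
      restore = trans (sym (map-∘ (star x))) (map-id-local (All.tabulate λ F∈ → p-x∪x≡p (proj₂ (∈-star F∈))))
      good′ : ∀ {G} → G ∈ map (_- x) (star x) → Face Γ G × (∀ {y} → y ∈ₛ G → y ∈ N x xs) × ∣ G ∣ ≡ i
      good′ G∈ with F , F∈star , refl ← ∈-map⁻ (_- x) G∈ with F∈Fs , x∈F ← ∈-star F∈star
        with F∈Γ , F⊆xs , size ← good F∈Fs =
        down-closed Γ (p─q⊆p F ⁅ x ⁆) F∈Γ ,
        (λ y∈ → let y∈F , y≢x = ∈-⁻ F x y∈ in ∈-filterᵇ⁺ (adj x) (F⊆xs y∈F) (face⇒adj F∈Γ x∈F y∈F (y≢x ∘ sym))) ,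
        suc-injective (trans (sym (∣p∣≡1+∣p-x∣ x∈F)) size)

  f≤cliques : ∀ j → f Γ j ≤ cliques (suc j) (allFin n)
  f≤cliques j = length-faces≤cliques (suc j) (allFin n)
    (Unique.filter⁺ (λ F → ∣ F ∣ ℕ.≟ suc j) (Unique.filter⁺ (face? Γ) (subsets-unique n)))
    λ F∈ → let F∈faces , size = ∈-filter⁻ (λ F → ∣ F ∣ ℕ.≟ suc j) {xs = faces Γ} F∈
               _ , F∈Γ        = ∈-filter⁻ (face? Γ) {xs = subsets n} F∈faces
           in F∈Γ , (λ {x} _ → ∈-allFin x) , size

  dim⇒CliqueBound : ∀ d → dim Γ ≡ + d -ℤ 1ℤ → CliqueBound d
  dim⇒CliqueBound d dim≡ c cl = begin
    length c                             ≤⟨ ∣fromList∣-clique cl ⟩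
    ∣ fromList c ∣                       ≤⟨ All.lookup (xs≤max 0 (map ∣_∣ (faces Γ)))
                                              (∈-map⁺ ∣_∣ (∈-filter⁺ (face? Γ) (∈-subsets (fromList c)) (fromList-face cl))) ⟩
    max 0 (map ∣_∣ (faces Γ))            ≡⟨ ℤ.+-injective (∙-cancelʳ (AbelianGroup.group ℤ.+-0-abelianGroup) (- 1ℤ) _ (+ d) dim≡) ⟩
    d                                    ∎
    where open ≤-Reasoning

  girth⇒NoTopCycle : ∀ {c ℓ₁ ℓ₂} (k : HeytingField c ℓ₁ ℓ₂) D s g → IsGirth k Γ D g → [ s ] <⁺ g →
                     NoTopCycle k D s (allFin n)
  girth⇒NoTopCycle k D s g girth s<g W _ ∣W∣≤s t = go g girth s<g
    where
    witness : ∃[ W′ ] ∣ W′ ∣ ≡ ∣ W ∣ × ∃[ F ] Face Γ F × Homology.H̃≢0 k (lk Γ F ⟦ W′ ⟧) D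
    witness = W , refl , ∅ , adjacent⇒face ∅ (λ u∈ → contradiction u∈ ∉⊥) , Chains.TopCycle⇒H̃≢0 k t
    go : ∀ g → IsGirth k Γ D g → [ s ] <⁺ g → ⊥
    go ⊤⁺    none        _       = none ∣ W ∣ witness
    go [ m ] (_ , least) [ s<m ] = <-irrefl refl (<-≤-trans s<m (≤-trans (least ∣ W ∣ witness) ∣W∣≤s))

face-estimate : ∀ q r j .{{_ : NonZero r}} → 2 ≤ r → (e : Estimate q r (suc j)) →
  ∀ {c ℓ₁ ℓ₂} (k : HeytingField c ℓ₁ ℓ₂) (n d : ℕ) (Γ : Complex n) (g : ℕ ⁺) →
  Flag Γ → dim Γ ≡ + d -ℤ 1ℤ → IsGirth k Γ (suc q) g → [ 2 * (2 + q) + 2 * r ∸ 4 ] <⁺ g →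
  f Γ j ≤ Estimate.C e · d ^[ fromℕ (suc j) -ℚ a (2 + q) r (suc j) ]· n ^[ a (2 + q) r (suc j) ]
face-estimate q r j 2≤r e k n d Γ g flag dim≡ girth s<g =
  ≤·^-intro {f Γ j} {suc j} {C} {d} {n} {M} {α} {β} {{M≢0}} (a (2 + q) r (suc j)) sums exponent
    (≤-trans (^-monoˡ-≤ M (f≤cliques j))
      (subst (λ m → cliques (suc j) (allFin n) ^ M ≤ C * (d ^ α * m ^ β)) (length-tabulate id)
        (estimate (graph Γ) (dim⇒CliqueBound d dim≡) (Unique.allFin⁺ n) hered)))
  where
  open Estimate e
  open Cliques (graph Γ)
  open Paths (graph Γ)
  open FlagComplex Γ flag
  open FaceCount Γ flag
  -- With p = q + 2 the girth threshold 2p + 2r - 4 is 2(q + r), the size of a cycle of length 2r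
  -- suspended `q` times.
  arith : ∀ q r → 2 * (2 + q) + 2 * r ≡ 4 + 2 * (q + r)
  arith = solve-∀
  hered : Hered (NoInducedCycle r) q (allFin n)
  hered = NoTopCycle⇒Hered k r q (girth⇒NoTopCycle k (suc q) (2 * (q + r)) g girth
    (subst (λ s → [ s ] <⁺ g) (cong (_∸ 4) (arith q r)) s<g))

mainTheorem10 : ∀ {c ℓ₁ ℓ₂} (p r i : ℕ) .{{_ : NonZero r}} →
    2 ≤ p → 2 ≤ r → p ∸ 1 ≤ i → 1 ≤ i →
    ∃[ C ] (∀ (k : HeytingField c ℓ₁ ℓ₂) (n d : ℕ) (Γ : Complex n) (g : ℕ ⁺) →
    Flag Γ → dim Γ ≡ + d -ℤ 1ℤ →
    IsGirth k Γ (p ∸ 1) g → [ 2 * p + 2 * r ∸ 4 ] <⁺ g →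
    f Γ (i ∸ 1) ≤ C · d ^[ fromℕ i -ℚ a p r i ]· n ^[ a p r i ])
mainTheorem10 1 r i (s≤s ()) 2≤r p-1≤i 1≤i
mainTheorem10 (suc (suc q)) r (suc j) _ 2≤r q+1≤i _ = Estimate.C e , face-estimate q r j 2≤r e
  where
  e = clique-estimate q r (suc j) 2≤r q+1≤i
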